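{- A graph $G$ is a polygonal 2-tree if and only if $G$ is a 2-connected partial 2-tree and the set of induced cycles of $G$ is a cycle basis of $G$.
   Context: All graphs are finite, simple, undirected and unweighted. A polygonal 2-tree is defined recursively: every cycle is a polygonal 2-tree; if $G$ is a polygonal 2-tree and $(u,v) \in E(G)$, then adding a new path $P$ between $u$ and $v$ with $E(G) \cap E(P) = \emptyset$, $V(G) \cap V(P) = \{u,v\}$ and $|E(P)| \geq 2$ yields a polygonal 2-tree. A 2-tree is obtained from a triangle by repeatedly choosing an edge $(u,v)$ and adding a new vertex adjacent to both $u$ and $v$; a partial 2-tree is a subgraph of a 2-tree. An induced cycle is a chordless cycle. A graph is Eulerian if every vertex has even degree. For subgraphs $H_1,\ldots,H_k$, $H_1 \oplus \cdots \oplus H_k$ is the graph consisting of the edges appearing in an odd number of the $H_i$. A cycle basis of $G$ is a minimal set $\mathcal{B}$ of Eulerian subgraphs of $G$ such that every cycle of $G$ is the $\oplus$-sum of a subset of $\mathcal{B}$. -}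

module Defs where

open import Data.Nat using (ℕ; zero; suc; _≤_; _+_)
open import Data.Nat.Divisibility using (_∣_)
open import Data.Bool using (Bool; true; false; _∧_; _∨_; _xor_; T)
open import Data.Fin using (Fin; _≟_)
open import Data.Vec as V using (Vec; lookup)
open import Data.List as L using (List; []; _∷_; _++_; [_]; zip; allFin; length)
open import Data.Bool.ListAction using (any)
open import Data.List.Membership.Propositional using (_∈_)
open import Data.List.Relation.Unary.All using (All)
open import Data.List.Relation.Unary.Unique.Propositional using (Unique)
open import Data.Product using (Σ; ∃; _×_; _,_)
open import Data.Sum using (_⊎_)
open import Data.Unit using (⊤)
open import Data.Empty using (⊥)
open import Relation.Nullary using (¬_)
open import Relation.Nullary.Decidable using (⌊_⌋)
open import Relation.Binary.PropositionalEquality using (_≡_; _≢_)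
open import Function.Definitions using (Injective)

-- Edge sets on the vertex set Fin n, as Boolean adjacency matrices.
-- A (spanning) subgraph of a graph is identified with its edge set.

Mat : ℕ → Set
Mat n = Vec (Vec Bool n) n

at : ∀ {n} → Mat n → Fin n → Fin n → Bool
at M u v = lookup (lookup M u) v

emptyM : ∀ {n} → Mat n
emptyM {n} = V.replicate n (V.replicate n false)

_⊕_ : ∀ {n} → Mat n → Mat n → Mat n
M ⊕ N = V.zipWith (V.zipWith _xor_) M N

_∪ₘ_ : ∀ {n} → Mat n → Mat n → Mat n
M ∪ₘ N = V.zipWith (V.zipWith _∨_) M N

⊕Σ : ∀ {n} → List (Mat n) → Mat n
⊕Σ []       = emptyM
⊕Σ (H ∷ Hs) = H ⊕ ⊕Σ Hs

record Graph (n : ℕ) : Set where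
  field
    adj  : Mat n
    sym  : ∀ u v → at adj u v ≡ at adj v u
    irr  : ∀ u → at adj u u ≡ false
open Graph public

Adj : ∀ {n} → Graph n → Fin n → Fin n → Set
Adj G u v = T (at (adj G) u v)

edgesOf : ∀ {n} → List (Fin n × Fin n) → Mat n
edgesOf ps = V.tabulate λ u → V.tabulate λ v →
  any (λ { (a , b) → (⌊ u ≟ a ⌋ ∧ ⌊ v ≟ b ⌋) ∨ (⌊ u ≟ b ⌋ ∧ ⌊ v ≟ a ⌋) }) ps

cycPairs : ∀ {n} → List (Fin n) → List (Fin n × Fin n)
cycPairs []       = []
cycPairs (x ∷ xs) = zip (x ∷ xs) (xs ++ [ x ])

pathPairs : ∀ {n} → List (Fin n) → List (Fin n × Fin n)
pathPairs []       = []
pathPairs (x ∷ xs) = zip (x ∷ xs) xs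

cycEdges : ∀ {n} → List (Fin n) → Mat n
cycEdges vs = edgesOf (cycPairs vs)

pathEdges : ∀ {n} → List (Fin n) → Mat n
pathEdges vs = edgesOf (pathPairs vs)

ones : ∀ {k} → Vec Bool k → ℕ
ones V.[]           = 0
ones (true  V.∷ bs) = suc (ones bs)
ones (false V.∷ bs) = ones bs

Subgraph : ∀ {n} → Graph n → Mat n → Set
Subgraph G H = (∀ u v → at H u v ≡ at H v u) × (∀ u v → T (at H u v) → Adj G u v)

Eulerian : ∀ {n} → Mat n → Set
Eulerian H = ∀ v → 2 ∣ ones (lookup H v)

EulerianSubgraph : ∀ {n} → Graph n → Mat n → Set
EulerianSubgraph G H = Subgraph G H × Eulerian H

IsCycleIn : ∀ {n} → Graph n → List (Fin n) → Set
IsCycleIn G vs = (3 ≤ length vs) × Unique vs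
               × All (λ { (a , b) → Adj G a b }) (cycPairs vs)

IsInducedCycleIn : ∀ {n} → Graph n → List (Fin n) → Set
IsInducedCycleIn G vs = IsCycleIn G vs
  × (∀ u v → u ∈ vs → v ∈ vs → Adj G u v → T (at (cycEdges vs) u v))

SubgraphSet : ℕ → Set₁
SubgraphSet n = Mat n → Set

Cycles : ∀ {n} → Graph n → SubgraphSet n
Cycles G H = Σ (List _) λ vs → IsCycleIn G vs × cycEdges vs ≡ H

InducedCycles : ∀ {n} → Graph n → SubgraphSet n
InducedCycles G H = Σ (List _) λ vs → IsInducedCycleIn G vs × cycEdges vs ≡ H

SumOfSubset : ∀ {n} → SubgraphSet n → Mat n → Set
SumOfSubset B H = Σ (List _) λ L → Unique L × All B L × ⊕Σ L ≡ H

Generates : ∀ {n} → Graph n → SubgraphSet n → Set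
Generates G B = ∀ H → Cycles G H → SumOfSubset B H

CycleBasis : ∀ {n} → Graph n → SubgraphSet n → Set₁
CycleBasis G B =
    (∀ H → B H → EulerianSubgraph G H)
  × Generates G B
  × ¬ (Σ (SubgraphSet _) λ B′ → (∀ H → B′ H → B H) × Generates G B′
        × Σ (Mat _) λ H → B H × ¬ B′ H)

data Reach {n} (G : Graph n) (ok : Fin n → Set) : Fin n → Fin n → Set where
  here : ∀ {x} → Reach G ok x x
  step : ∀ {x y z} → Adj G x y → ok y → Reach G ok y z → Reach G ok x z

Connected : ∀ {n} → Graph n → Set
Connected {n} G = ∀ x y → Reach G (λ _ → ⊤) x y

TwoConnected : ∀ {n} → Graph n → Set
TwoConnected {n} G = (3 ≤ n) × Connected G
  × (∀ z x y → x ≢ z → y ≢ z → Reach G (λ w → w ≢ z) x y)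

IsCycleGraph : ∀ {n} → Graph n → Set
IsCycleGraph {n} G = Σ (List (Fin n)) λ vs →
  (3 ≤ length vs) × Unique vs × (∀ x → x ∈ vs) × adj G ≡ cycEdges vs

-- G′ is (an isomorphic copy of) the graph obtained from G by adding a new
-- path  ι u , int , ι v  between the endpoints of the edge (u,v) of G;
-- ι identifies the old vertices inside G′, int are the new internal
-- vertices (nonempty, so |E(P)| ≥ 2).
AddsPath : ∀ {n n′} → Graph n → Graph n′ → (Fin n → Fin n′) → Fin n → Fin n
         → List (Fin n′) → Set
AddsPath {n} {n′} G G′ ι u v int =
    Injective _≡_ _≡_ ι
  × Adj G u v
  × (int ≢ [])
  × Unique int
  × (∀ x → x ∈ int → ∀ a → ι a ≢ x)
  × (∀ x → (∃ λ a → ι a ≡ x) ⊎ x ∈ int)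
  × (∀ x y → at (adj G′) x y ≡
       (any (λ a → any (λ b → ⌊ ι a ≟ x ⌋ ∧ ⌊ ι b ≟ y ⌋ ∧ at (adj G) a b)
                            (allFin n)) (allFin n)
        ∨ at (pathEdges (ι u ∷ int ++ [ ι v ])) x y))

data Polygonal2Tree : ∀ {n} → Graph n → Set where
  cycle : ∀ {n} {G : Graph n} → IsCycleGraph G → Polygonal2Tree G
  addPath : ∀ {n n′} {G : Graph n} {G′ : Graph n′} ι u v int →
            Polygonal2Tree G → AddsPath G G′ ι u v int → Polygonal2Tree G′

data TwoTree : ∀ {n} → Graph n → Set where
  triangle : ∀ {G : Graph 3} → IsCycleGraph G → TwoTree G
  addVertex : ∀ {n n′} {G : Graph n} {G′ : Graph n′} ι u v w →
              TwoTree G → AddsPath G G′ ι u v [ w ] → TwoTree G′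

PartialTwoTree : ∀ {n} → Graph n → Set
PartialTwoTree {n} G = Σ ℕ λ m → Σ (Graph m) λ T₂ → TwoTree T₂
  × Σ (Fin n → Fin m) λ ι → Injective _≡_ _≡_ ι
  × (∀ a b → Adj G a b → Adj T₂ (ι a) (ι b))

{-# OPTIONS --safe #-}

-- Call G independent if no induced cycle is the sum of other induced cycles. A closed walk that repeats a vertex
-- or has a chord is the sum of two shorter ones, so induced cycles always generate, and they form a cycle basis
-- exactly when G is independent.
--
-- If a path P is attached to an edge uv, then an induced cycle using an edge of P uses all of P, hence u and v,
-- hence the edge uv, so P + uv is the only such cycle; independence is preserved.
--
-- Conversely, let w be the last vertex of a 2-tree containing the 2-connected graph G. If w is in G, it has exactly
-- two neighbours a, b, and G - w + ab is 2-connected, lies in a smaller 2-tree and inherits independence, hence is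
-- polygonal. If ab is an edge of G, then G arises by attaching the path a w b. Otherwise G subdivides ab. Two induced
-- cycles of G through w would sum to a closed walk avoiding w, contradicting independence; hence ab lies on only one
-- polygon of G - w + ab, and that polygon can be lengthened.
module Submission where

open import Defs renaming (sym to adj-sym; here to stop; step to move)
open import Data.Nat using (ℕ; zero; suc; _≤_; _+_; z≤n; s≤s; s≤s⁻¹)
open import Data.Nat.Properties using (≤-refl; ≤-trans; ≤-reflexive; ≤-antisym; _≤?_; ≰⇒>; m≤m+n; m≤n+m; n≤1+n; +-suc)
open import Data.Nat.Divisibility using (_∣_; _∣0; ∣m∣n⇒∣m+n; ∣-refl)
open import Data.Bool as Bool using (Bool; true; false; _∧_; _∨_; _xor_; T; if_then_else_)
open import Data.Bool.Properties using (xor-assoc; xor-comm; xor-same; xor-identityʳ; T-∨; T?)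
open import Data.Bool.ListAction using (any)
open import Data.Fin using (Fin; zero; suc; _≟_; punchIn; punchOut)
open import Data.Fin.Properties using (any?; 0≢1+n; suc-injective; injective⇒≤; punchIn-injective; punchInᵢ≢i; punchIn-punchOut)
open import Data.Maybe using (Maybe; just; nothing; maybe′)
open import Data.Vec as V using (Vec; lookup)
open import Data.Vec.Properties as Vₚ using (lookup∘tabulate; tabulate∘lookup; tabulate-cong; lookup-zipWith; lookup-replicate)
open import Data.List as L using (List; []; _∷_; _++_; [_]; map; length; zip; reverse; initLast; _∷ʳ′_; allFin)
open import Data.List.Properties using (++-assoc; ++-identityʳ; map-++; length-++; length-map; unfold-reverse; reverse-++)
open import Data.List.Membership.Propositional using (_∈_; _∉_; lose)
open import Data.List.Membership.Propositional.Properties using (∈-++⁺ˡ; ∈-++⁺ʳ; ∈-++⁻; ∈-map⁺; ∈-map⁻; ∈-∃++; ∈-allFin; ∈-lookup)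
open import Data.List.Membership.DecPropositional using (_∈?_)
open import Data.List.Relation.Unary.Any as Any using (Any; here; there)
open import Data.List.Relation.Unary.Any.Properties using (any⁺; any⁻)
open import Data.List.Relation.Unary.All as All using (All; []; _∷_)
import Data.List.Relation.Unary.All.Properties as Allₚ
open import Data.List.Relation.Unary.AllPairs as AllPairs using (AllPairs; []; _∷_)
open import Data.List.Relation.Unary.Unique.Propositional using (Unique)
open import Data.List.Relation.Unary.Unique.Propositional.Properties as Uniqueₚ using () renaming (Unique[x∷xs]⇒x∉xs to Unique-∉)
open import Data.List.Relation.Binary.Permutation.Propositional using (_↭_; prep; swap; ↭-refl; ↭-sym; ↭-trans; ↭-reflexive; ↭⇒↭ₛ)
open import Data.List.Relation.Binary.Permutation.Propositional.Properties as ↭ₚ using (All-resp-↭; ∈-resp-↭; shift; ∷↭∷ʳ)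
import Data.List.Relation.Binary.Permutation.Setoid.Properties as ↭ₛₚ
open import Data.Product as Product using (Σ; ∃; ∃₂; _×_; _,_; proj₁; proj₂)
open import Data.Sum as Sum using (_⊎_; inj₁; inj₂)
open import Data.Unit using (⊤)
open import Data.Empty using (⊥; ⊥-elim)
open import Function using (_∘_; id)
open import Function.Bundles using (_⇔_; mk⇔; Equivalence)
open import Relation.Nullary using (¬_; Dec; yes; no)
open import Relation.Nullary.Decidable using (⌊_⌋; toWitness; fromWitness; _×-dec_; _⊎-dec_; ¬?; decidable-stable)
open import Relation.Binary.PropositionalEquality using (_≡_; _≢_; refl; sym; trans; cong; cong₂; subst; resp₂; setoid; module ≡-Reasoning)

-- Subdivision is the delicate step. Subdividing the common edge of two triangles gives the complete
-- bipartite graph on 2 + 3 vertices, whose three induced 4-cycles sum to zero, so a polygonal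
-- 2-tree need not survive the subdivision of an edge. The edge to be subdivided therefore carries
-- the condition `AtMostOne`, which is handed down along the construction of the polygonal 2-tree.
-- That G - w + ab inherits independence is linear algebra over GF(2). Its induced cycles go to
-- induced cycles of G, either unchanged or with ab replaced by a w b, and this correspondence is
-- the restriction of a linear map of matrices in which every entry copies one entry or is zero.
-- Being injective on induced cycles, it carries a dependence in the smaller graph to a dependence
-- in G.

private variable
  n m : ℕ
  A B : Set

-- Booleans as propositions

T-ext : ∀ {a b} → (T a → T b) → (T b → T a) → a ≡ b
T-ext {true}  {true}  f g = refl
T-ext {true}  {false} f g = ⊥-elim (f _)
T-ext {false} {true}  f g = ⊥-elim (g _)
T-ext {false} {false} f g = refl

¬T⇒false : ∀ {a} → ¬ T a → a ≡ false
¬T⇒false {true}  f = ⊥-elim (f _)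
¬T⇒false {false} f = refl

T⇒true : ∀ {a} → T a → a ≡ true
T⇒true {true} _ = refl

T-≡ : ∀ {a b} → a ≡ b → T a → T b
T-≡ refl t = t

-- Matrices over GF(2)

fromFun : (Fin m → Fin n → Bool) → Vec (Vec Bool n) m
fromFun f = V.tabulate λ u → V.tabulate (f u)

at-fromFun : ∀ (f : Fin n → Fin n → Bool) u v → at (fromFun f) u v ≡ f u v
at-fromFun f u v = trans (cong (λ r → lookup r v) (lookup∘tabulate _ u)) (lookup∘tabulate (f u) v)

Vec-ext : {xs ys : Vec A n} → (∀ i → lookup xs i ≡ lookup ys i) → xs ≡ ys
Vec-ext {xs = xs} {ys} eq =
  trans (sym (tabulate∘lookup xs)) (trans (tabulate-cong eq) (tabulate∘lookup ys))

Mat-ext : {M N : Mat n} → (∀ u v → at M u v ≡ at N u v) → M ≡ N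
Mat-ext eq = Vec-ext λ u → Vec-ext (eq u)

Mat-≟ : (M N : Mat n) → Dec (M ≡ N)
Mat-≟ = Vₚ.≡-dec (Vₚ.≡-dec Bool._≟_)

at-⊕ : ∀ (M N : Mat n) u v → at (M ⊕ N) u v ≡ at M u v xor at N u v
at-⊕ M N u v = trans (cong (λ r → lookup r v) (lookup-zipWith _ u M N)) (lookup-zipWith _xor_ v (lookup M u) (lookup N u))

at-empty : ∀ (u v : Fin n) → at emptyM u v ≡ false
at-empty u v = trans (cong (λ r → lookup r v) (lookup-replicate u _)) (lookup-replicate v _)

⊕-assoc : (M N K : Mat n) → (M ⊕ N) ⊕ K ≡ M ⊕ (N ⊕ K)
⊕-assoc M N K = Mat-ext λ u v → begin
  at ((M ⊕ N) ⊕ K) u v                      ≡⟨ at-⊕ (M ⊕ N) K u v ⟩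
  at (M ⊕ N) u v xor at K u v               ≡⟨ cong (_xor at K u v) (at-⊕ M N u v) ⟩
  (at M u v xor at N u v) xor at K u v      ≡⟨ xor-assoc (at M u v) _ _ ⟩
  at M u v xor (at N u v xor at K u v)      ≡⟨ cong (at M u v xor_) (at-⊕ N K u v) ⟨
  at M u v xor at (N ⊕ K) u v               ≡⟨ at-⊕ M (N ⊕ K) u v ⟨
  at (M ⊕ (N ⊕ K)) u v                      ∎
  where open ≡-Reasoning

⊕-comm : (M N : Mat n) → M ⊕ N ≡ N ⊕ M
⊕-comm M N = Mat-ext λ u v →
  trans (at-⊕ M N u v) (trans (xor-comm (at M u v) _) (sym (at-⊕ N M u v)))

⊕-self : (M : Mat n) → M ⊕ M ≡ emptyM
⊕-self M = Mat-ext λ u v →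
  trans (at-⊕ M M u v) (trans (xor-same (at M u v)) (sym (at-empty u v)))

⊕-identityʳ : (M : Mat n) → M ⊕ emptyM ≡ M
⊕-identityʳ M = Mat-ext λ u v →
  trans (at-⊕ M emptyM u v) (trans (cong (at M u v xor_) (at-empty u v)) (xor-identityʳ _))

⊕-identityˡ : (M : Mat n) → emptyM ⊕ M ≡ M
⊕-identityˡ M = trans (⊕-comm emptyM M) (⊕-identityʳ M)

⊕-cancel : (M N : Mat n) → M ⊕ (M ⊕ N) ≡ N
⊕-cancel M N = trans (sym (⊕-assoc M M N)) (trans (cong (_⊕ N) (⊕-self M)) (⊕-identityˡ N))

⊕-swap : (M N K : Mat n) → M ⊕ (N ⊕ K) ≡ N ⊕ (M ⊕ K)
⊕-swap M N K = trans (sym (⊕-assoc M N K)) (trans (cong (_⊕ K) (⊕-comm M N)) (⊕-assoc N M K))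

⊕Σ-++ : (L L′ : List (Mat n)) → ⊕Σ (L ++ L′) ≡ ⊕Σ L ⊕ ⊕Σ L′
⊕Σ-++ []      L′ = sym (⊕-identityˡ _)
⊕Σ-++ (K ∷ L) L′ = trans (cong (K ⊕_) (⊕Σ-++ L L′)) (sym (⊕-assoc K _ _))

⊕Σ-↭ : {L L′ : List (Mat n)} → L ↭ L′ → ⊕Σ L ≡ ⊕Σ L′
⊕Σ-↭ _↭_.refl = refl
⊕Σ-↭ (prep K p) = cong (K ⊕_) (⊕Σ-↭ p)
⊕Σ-↭ (swap K K′ p) = trans (⊕-swap K K′ _) (cong (λ N → K′ ⊕ (K ⊕ N)) (⊕Σ-↭ p))
⊕Σ-↭ (_↭_.trans p q) = trans (⊕Σ-↭ p) (⊕Σ-↭ q)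

AllPairs-resp-↭ : {R : A → A → Set} → (∀ {x y} → R x y → R y x) →
                  {xs ys : List A} → xs ↭ ys → AllPairs R xs → AllPairs R ys
AllPairs-resp-↭ {R = R} R-sym xs↭ys = ↭ₛₚ.AllPairs-resp-↭ (setoid _) R-sym (resp₂ R) (↭⇒↭ₛ xs↭ys)

Unique-resp-↭ : {xs ys : List A} → xs ↭ ys → Unique xs → Unique ys
Unique-resp-↭ = AllPairs-resp-↭ (λ x≢y y≡x → x≢y (sym y≡x))

∉-Unique : {x : A} {xs : List A} → x ∉ xs → Unique xs → Unique (x ∷ xs)
∉-Unique x∉ u = All.tabulate (λ { y∈ refl → x∉ y∈ }) ∷ u

map² : (A → B) → A × A → B × B
map² f (a , b) = f a , f b

-- Paths and edges

Edge : List (Fin n × Fin n) → Fin n → Fin n → Set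
Edge ps u v = (u , v) ∈ ps ⊎ (v , u) ∈ ps

both⁻ : ∀ {P Q R S : Set} (p : Dec P) (q : Dec Q) (r : Dec R) (s : Dec S) →
  T ((⌊ p ⌋ ∧ ⌊ q ⌋) ∨ (⌊ r ⌋ ∧ ⌊ s ⌋)) → (P × Q) ⊎ (R × S)
both⁻ (yes p) (yes q) r s t = inj₁ (p , q)
both⁻ (yes p) (no _) (yes r) (yes s) t = inj₂ (r , s)
both⁻ (no _) q (yes r) (yes s) t = inj₂ (r , s)

both⁺ : ∀ {P Q R S : Set} (p : Dec P) (q : Dec Q) (r : Dec R) (s : Dec S) →
  (P × Q) ⊎ (R × S) → T ((⌊ p ⌋ ∧ ⌊ q ⌋) ∨ (⌊ r ⌋ ∧ ⌊ s ⌋))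
both⁺ p q r s (inj₁ (x , y)) with p | q
... | yes _ | yes _ = _
... | no ¬x | _     = ⊥-elim (¬x x)
... | yes _ | no ¬y = ⊥-elim (¬y y)
both⁺ p q r s (inj₂ (x , y)) with p | q | r | s
... | yes _ | yes _ | _ | _ = _
... | yes _ | no _ | yes _ | yes _ = _
... | no _  | _    | yes _ | yes _ = _
... | _     | _    | no ¬x | _     = ⊥-elim (¬x x)
... | _     | _    | yes _ | no ¬y = ⊥-elim (¬y y)

edgesOf⁻ : ∀ (ps : List (Fin n × Fin n)) {u v} → T (at (edgesOf ps) u v) → Edge ps u v
edgesOf⁻ ps {u} {v} t = go (any⁻ _ ps (T-≡ (at-fromFun _ u v) t))
  where
  dec : ∀ p → T ((⌊ u ≟ proj₁ p ⌋ ∧ ⌊ v ≟ proj₂ p ⌋) ∨ (⌊ u ≟ proj₂ p ⌋ ∧ ⌊ v ≟ proj₁ p ⌋)) →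
        ((u , v) ≡ p) ⊎ ((v , u) ≡ p)
  dec (a , b) s = Sum.map (λ { (refl , refl) → refl }) (λ { (refl , refl) → refl })
    (both⁻ (u ≟ a) (v ≟ b) (u ≟ b) (v ≟ a) s)
  go : ∀ {ps} → Any _ ps → Edge ps u v
  go (here {x = p} s) = Sum.map here here (dec p s)
  go (there s) = Sum.map there there (go s)

edgesOf⁺ : ∀ (ps : List (Fin n × Fin n)) {u v} → Edge ps u v → T (at (edgesOf ps) u v)
edgesOf⁺ ps {u} {v} e = T-≡ (sym (at-fromFun _ u v)) (any⁺ _ (go e))
  where
  go : Edge ps u v → Any _ ps
  go (inj₁ x) = Any.map (λ { refl → both⁺ (u ≟ u) (v ≟ v) (u ≟ v) (v ≟ u) (inj₁ (refl , refl)) }) x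
  go (inj₂ x) = Any.map (λ { refl → both⁺ (u ≟ v) (v ≟ u) (u ≟ u) (v ≟ v) (inj₂ (refl , refl)) }) x

edgesOf-sym : (ps : List (Fin n × Fin n)) → ∀ u v → at (edgesOf ps) u v ≡ at (edgesOf ps) v u
edgesOf-sym ps u v = T-ext (edgesOf⁺ ps ∘ Sum.swap ∘ edgesOf⁻ ps) (edgesOf⁺ ps ∘ Sum.swap ∘ edgesOf⁻ ps)

edgesOf-cong : {ps qs : List (Fin n × Fin n)} → (∀ {u v} → Edge ps u v → Edge qs u v) →
               (∀ {u v} → Edge qs u v → Edge ps u v) → edgesOf ps ≡ edgesOf qs
edgesOf-cong {ps = ps} {qs} f g = Mat-ext λ u v → T-ext (edgesOf⁺ qs ∘ f ∘ edgesOf⁻ ps) (edgesOf⁺ ps ∘ g ∘ edgesOf⁻ qs)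

edgesOf-↭ : {ps qs : List (Fin n × Fin n)} → ps ↭ qs → edgesOf ps ≡ edgesOf qs
edgesOf-↭ p = edgesOf-cong (Sum.map (∈-resp-↭ p) (∈-resp-↭ p)) (Sum.map (∈-resp-↭ (↭-sym p)) (∈-resp-↭ (↭-sym p)))

Same : {A : Set} → A × A → A × A → Set
Same p q = q ≡ p ⊎ q ≡ Product.swap p

-- No undirected edge is listed twice, in either orientation. Under this condition the union and the
-- GF(2) sum of the listed edges agree.
Distinct : List (A × A) → Set
Distinct = AllPairs (λ p q → ¬ Same p q)

Distinct-resp-↭ : {ps qs : List (A × A)} → ps ↭ qs → Distinct ps → Distinct qs
Distinct-resp-↭ = AllPairs-resp-↭ λ ¬s → λ { (inj₁ refl) → ¬s (inj₁ refl) ; (inj₂ refl) → ¬s (inj₂ refl) }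

Distinct-fresh : {p : Fin n × Fin n} {ps : List (Fin n × Fin n)} → Distinct (p ∷ ps) → ¬ Edge ps (proj₁ p) (proj₂ p)
Distinct-fresh (a ∷ _) (inj₁ e) = All.lookup a e (inj₁ refl)
Distinct-fresh (a ∷ _) (inj₂ e) = All.lookup a e (inj₂ refl)

-- The GF(2) counterpart of `edgesOf`: an edge traversed twice cancels here, while `edgesOf` keeps
-- it. Closed walks with repetitions are measured in this way.
wsum : List (Fin n × Fin n) → Mat n
wsum ps = ⊕Σ (map (λ p → edgesOf [ p ]) ps)

wsum-++ : (ps qs : List (Fin n × Fin n)) → wsum (ps ++ qs) ≡ wsum ps ⊕ wsum qs
wsum-++ ps qs = trans (cong ⊕Σ (map-++ _ ps qs)) (⊕Σ-++ (map _ ps) (map _ qs))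

wsum-↭ : {ps qs : List (Fin n × Fin n)} → ps ↭ qs → wsum ps ≡ wsum qs
wsum-↭ p = ⊕Σ-↭ (↭ₚ.map⁺ _ p)

edge-swap : (u v : Fin n) → edgesOf [ (u , v) ] ≡ edgesOf [ (v , u) ]
edge-swap u v = edgesOf-cong f f
  where
  f : ∀ {x y u v} → Edge [ (u , v) ] x y → Edge [ (v , u) ] x y
  f (inj₁ (here refl)) = inj₂ (here refl)
  f (inj₂ (here refl)) = inj₁ (here refl)

xor-disjoint : ∀ {a b c} → (T c → T a ⊎ T b) → (T a ⊎ T b → T c) → ¬ (T a × T b) → c ≡ a xor b
xor-disjoint {true}  {true}  f g h = ⊥-elim (h _)
xor-disjoint {true}  {false} f g h = T⇒true (g (inj₁ _))
xor-disjoint {false} {true}  f g h = T⇒true (g (inj₂ _))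
xor-disjoint {false} {false} f g h = ¬T⇒false λ c → Sum.[ id , id ] (f c)

-- Each pair is disjoint from the later ones, and on disjoint edge sets union and exclusive or
-- coincide.
edgesOf-wsum : {ps : List (Fin n × Fin n)} → Distinct ps → edgesOf ps ≡ wsum ps
edgesOf-wsum {ps = []} [] = Mat-ext λ u v → trans (at-fromFun _ u v) (sym (at-empty u v))
edgesOf-wsum {ps = p ∷ ps} d@(_ ∷ d′) = trans (Mat-ext λ u v →
    trans (xor-disjoint (f u v) (g u v) (h u v)) (sym (at-⊕ (edgesOf [ p ]) (edgesOf ps) u v)))
  (cong (edgesOf [ p ] ⊕_) (edgesOf-wsum d′))
  where
  f : ∀ u v → T (at (edgesOf (p ∷ ps)) u v) → T (at (edgesOf [ p ]) u v) ⊎ T (at (edgesOf ps) u v)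
  f u v t with edgesOf⁻ (p ∷ ps) t
  ... | inj₁ (here e) = inj₁ (edgesOf⁺ [ p ] (inj₁ (here e)))
  ... | inj₁ (there e) = inj₂ (edgesOf⁺ ps (inj₁ e))
  ... | inj₂ (here e) = inj₁ (edgesOf⁺ [ p ] (inj₂ (here e)))
  ... | inj₂ (there e) = inj₂ (edgesOf⁺ ps (inj₂ e))
  g : ∀ u v → T (at (edgesOf [ p ]) u v) ⊎ T (at (edgesOf ps) u v) → T (at (edgesOf (p ∷ ps)) u v)
  g u v (inj₁ t) with edgesOf⁻ [ p ] t
  ... | inj₁ (here e) = edgesOf⁺ (p ∷ ps) (inj₁ (here e))
  ... | inj₂ (here e) = edgesOf⁺ (p ∷ ps) (inj₂ (here e))
  g u v (inj₂ t) = edgesOf⁺ (p ∷ ps) (Sum.map there there (edgesOf⁻ ps t))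
  h : ∀ u v → ¬ (T (at (edgesOf [ p ]) u v) × T (at (edgesOf ps) u v))
  h u v (s , t) with edgesOf⁻ [ p ] s
  ... | inj₁ (here refl) = Distinct-fresh d (edgesOf⁻ ps t)
  ... | inj₂ (here refl) = Distinct-fresh d (Sum.swap (edgesOf⁻ ps t))

pathPairs-++ : (xs : List (Fin n)) (y : Fin n) (ys : List (Fin n)) →
  pathPairs (xs ++ y ∷ ys) ≡ pathPairs (xs ++ [ y ]) ++ pathPairs (y ∷ ys)
pathPairs-++ [] y ys = refl
pathPairs-++ (x ∷ []) y ys = refl
pathPairs-++ (x ∷ x′ ∷ xs) y ys = cong ((x , x′) ∷_) (pathPairs-++ (x′ ∷ xs) y ys)

pathPairs-map : (f : Fin n → Fin m) (xs : List (Fin n)) → pathPairs (map f xs) ≡ map (map² f) (pathPairs xs)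
pathPairs-map f [] = refl
pathPairs-map f (x ∷ []) = refl
pathPairs-map f (x ∷ y ∷ xs) = cong (_ ∷_) (pathPairs-map f (y ∷ xs))

pathPairs-∈ : (l : List (Fin n)) → ∀ {u v} → (u , v) ∈ pathPairs l → u ∈ l × v ∈ l
pathPairs-∈ (x ∷ y ∷ l) (here refl) = here refl , there (here refl)
pathPairs-∈ (x ∷ y ∷ l) (there e) = Product.map there there (pathPairs-∈ (y ∷ l) e)

pathPairs-reverse : (l : List (Fin n)) → pathPairs (reverse l) ↭ map Product.swap (pathPairs l)
pathPairs-reverse [] = ↭-refl
pathPairs-reverse (x ∷ []) = ↭-refl
pathPairs-reverse (x ∷ y ∷ l) = ↭-trans (↭-reflexive (begin
    pathPairs (reverse (x ∷ y ∷ l))                          ≡⟨ cong pathPairs (unfold-reverse x (y ∷ l)) ⟩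
    pathPairs (reverse (y ∷ l) ++ [ x ])                     ≡⟨ cong (λ z → pathPairs (z ++ [ x ])) (unfold-reverse y l) ⟩
    pathPairs ((reverse l ++ [ y ]) ++ [ x ])                ≡⟨ cong pathPairs (++-assoc (reverse l) _ _) ⟩
    pathPairs (reverse l ++ y ∷ [ x ])                       ≡⟨ pathPairs-++ (reverse l) y [ x ] ⟩
    pathPairs (reverse l ++ [ y ]) ++ [ (y , x) ]            ≡⟨ cong (λ z → pathPairs z ++ [ (y , x) ]) (unfold-reverse y l) ⟨
    pathPairs (reverse (y ∷ l)) ++ [ (y , x) ]               ∎))
  (↭-trans (↭-sym (∷↭∷ʳ _ _)) (prep _ (pathPairs-reverse (y ∷ l))))
  where open ≡-Reasoning

-- Cut open at its first vertex, a cycle becomes a path with equal ends, to which the lemmas on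
-- `pathPairs` apply.
cycPairs-path : (x : Fin n) (xs : List (Fin n)) → cycPairs (x ∷ xs) ≡ pathPairs (x ∷ xs ++ [ x ])
cycPairs-path x xs = go x xs
  where
  go : ∀ z xs → zip (z ∷ xs) (xs ++ [ x ]) ≡ zip (z ∷ xs ++ [ x ]) (xs ++ [ x ])
  go z [] = refl
  go z (x ∷ xs) = cong (_ ∷_) (go x xs)

cycPairs-∈ : (l : List (Fin n)) → ∀ {u v} → (u , v) ∈ cycPairs l → u ∈ l × v ∈ l
cycPairs-∈ (x ∷ xs) e = Product.map f f (pathPairs-∈ (x ∷ xs ++ [ x ]) (subst (_ ∈_) (cycPairs-path x xs) e))
  where
  f : ∀ {u} → u ∈ x ∷ xs ++ [ x ] → u ∈ x ∷ xs
  f (here e) = here e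
  f (there e) with ∈-++⁻ xs e
  ... | inj₁ e′ = there e′
  ... | inj₂ (here e′) = here e′

cycPairs-map : (f : Fin n → Fin m) (xs : List (Fin n)) → cycPairs (map f xs) ≡ map (map² f) (cycPairs xs)
cycPairs-map f [] = refl
cycPairs-map f (x ∷ xs) = begin
  cycPairs (map f (x ∷ xs))             ≡⟨ cycPairs-path (f x) (map f xs) ⟩
  pathPairs (f x ∷ map f xs ++ [ f x ]) ≡⟨ cong (λ z → pathPairs (f x ∷ z)) (map-++ f xs [ x ]) ⟨
  pathPairs (map f (x ∷ xs ++ [ x ]))   ≡⟨ pathPairs-map f (x ∷ xs ++ [ x ]) ⟩
  map (map² f) (pathPairs (x ∷ xs ++ [ x ])) ≡⟨ cong (map (map² f)) (cycPairs-path x xs) ⟨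
  map (map² f) (cycPairs (x ∷ xs))      ∎
  where open ≡-Reasoning

-- Two positions cut a cycle into two arcs. Rotation, pinching at a repeated vertex and splitting
-- along a chord all reduce to this.
cycPairs-split : (x : Fin n) (xs : List (Fin n)) (y : Fin n) (ys : List (Fin n)) →
  cycPairs (x ∷ xs ++ y ∷ ys) ≡ pathPairs (x ∷ xs ++ [ y ]) ++ pathPairs (y ∷ ys ++ [ x ])
cycPairs-split x xs y ys = begin
  cycPairs (x ∷ xs ++ y ∷ ys)               ≡⟨ cycPairs-path x (xs ++ y ∷ ys) ⟩
  pathPairs (x ∷ (xs ++ y ∷ ys) ++ [ x ])   ≡⟨ cong (λ z → pathPairs (x ∷ z)) (++-assoc xs (y ∷ ys) [ x ]) ⟩
  pathPairs ((x ∷ xs) ++ y ∷ ys ++ [ x ])   ≡⟨ pathPairs-++ (x ∷ xs) y (ys ++ [ x ]) ⟩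
  pathPairs (x ∷ xs ++ [ y ]) ++ pathPairs (y ∷ ys ++ [ x ]) ∎
  where open ≡-Reasoning

cycPairs-rotate : (xs ys : List (Fin n)) → cycPairs (xs ++ ys) ↭ cycPairs (ys ++ xs)
cycPairs-rotate [] ys = ↭-reflexive (cong cycPairs (sym (++-identityʳ ys)))
cycPairs-rotate (x ∷ xs) [] = ↭-reflexive (cong cycPairs (++-identityʳ (x ∷ xs)))
cycPairs-rotate (x ∷ xs) (y ∷ ys) = ↭-trans (↭-reflexive (cycPairs-split x xs y ys))
  (↭-trans (↭ₚ.++-comm (pathPairs (x ∷ xs ++ [ y ])) _) (↭-reflexive (sym (cycPairs-split y ys x xs))))

rotateTo : {q : Fin n} {vs : List (Fin n)} → q ∈ vs → ∃ λ us → vs ↭ q ∷ us × cycPairs vs ↭ cycPairs (q ∷ us)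
rotateTo q∈ with xs , ys , refl ← ∈-∃++ q∈ = ys ++ xs , ↭ₚ.++-comm xs (_ ∷ ys) , cycPairs-rotate xs (_ ∷ ys)

Distinct-path : (l : List (Fin n)) → Unique l → Distinct (pathPairs l)
Distinct-path [] u = []
Distinct-path (x ∷ []) u = []
Distinct-path (x ∷ y ∷ l) u@(_ ∷ u′) =
  All.tabulate (λ { q∈ (inj₁ refl) → Unique-∉ u (proj₁ (pathPairs-∈ (y ∷ l) q∈))
                  ; q∈ (inj₂ refl) → Unique-∉ u (proj₂ (pathPairs-∈ (y ∷ l) q∈)) })
  ∷ Distinct-path (y ∷ l) u′

-- After its first edge the cycle continues as a path `y , z , … , x` without repeated vertices; the
-- first edge is compared with it separately. The bound 3 is essential, since a 2-cycle runs through
-- one edge in both directions.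
Distinct-cycle : (l : List (Fin n)) → 3 ≤ length l → Unique l → Distinct (cycPairs l)
Distinct-cycle (x ∷ []) (s≤s ()) u
Distinct-cycle (x ∷ y ∷ []) (s≤s (s≤s ())) u
Distinct-cycle (x ∷ y ∷ z ∷ r) _ u@((x≢y ∷ x≢z ∷ x≢r) ∷ _) = subst Distinct (sym (cycPairs-path x (y ∷ z ∷ r)))
  (((λ { (inj₁ refl) → x≢y refl ; (inj₂ refl) → x≢z refl }) ∷
   All.tabulate (λ { q∈ (inj₁ refl) → y∉ (proj₂ (pathPairs-∈ (z ∷ r ++ [ x ]) q∈))
                  ; q∈ (inj₂ refl) → y∉ (proj₁ (pathPairs-∈ (z ∷ r ++ [ x ]) q∈)) }))
  ∷ Distinct-path _ u′)
  where
  u′ : Unique (y ∷ z ∷ r ++ [ x ])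
  u′ = Unique-resp-↭ (∷↭∷ʳ x (y ∷ z ∷ r)) u
  y∉ : y ∉ z ∷ r ++ [ x ]
  y∉ = Unique-∉ u′

cycPairs-around : (q r : Fin n) (mid : List (Fin n)) (p : Fin n) →
  cycPairs (q ∷ r ∷ mid ++ [ p ]) ≡ (q , r) ∷ pathPairs (r ∷ mid ++ [ p ]) ++ [ (p , q) ]
cycPairs-around q r mid p = cycPairs-split q (r ∷ mid) p []

cycle-degree : {q r p : Fin n} (mid : List (Fin n)) → Unique (q ∷ r ∷ mid ++ [ p ]) → ∀ {y} →
  Edge (cycPairs (q ∷ r ∷ mid ++ [ p ])) q y → y ≡ r ⊎ y ≡ p
cycle-degree {q = q} {r} {p} mid u {y} e rewrite cycPairs-around q r mid p = go e
  where
  q∉ : q ∉ r ∷ mid ++ [ p ]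
  q∉ = Unique-∉ u
  go : Edge ((q , r) ∷ pathPairs (r ∷ mid ++ [ p ]) ++ [ (p , q) ]) q y → y ≡ r ⊎ y ≡ p
  go (inj₁ (here refl)) = inj₁ refl
  go (inj₂ (here refl)) = ⊥-elim (q∉ (here refl))
  go (inj₁ (there e)) with ∈-++⁻ (pathPairs (r ∷ mid ++ [ p ])) e
  ... | inj₁ e′ = ⊥-elim (q∉ (proj₁ (pathPairs-∈ _ e′)))
  ... | inj₂ (here refl) = inj₂ refl
  go (inj₂ (there e)) with ∈-++⁻ (pathPairs (r ∷ mid ++ [ p ])) e
  ... | inj₁ e′ = ⊥-elim (q∉ (proj₂ (pathPairs-∈ _ e′)))
  ... | inj₂ (here refl) = inj₂ refl

-- A view of the vertices that follow `q` on a cycle: the two neighbours `r` and `p` of `q` are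
-- exposed as first and last entry, which are different positions once the cycle has three vertices.
data Around {n} (q : Fin n) : List (Fin n) → Set where
  around : ∀ r mid p → Around q (r ∷ mid ++ [ p ])

around? : (q : Fin n) (us : List (Fin n)) → 3 ≤ length (q ∷ us) → Around q us
around? q [] (s≤s ())
around? q (r ∷ us) 3≤ with initLast us
around? q (r ∷ .[]) (s≤s (s≤s ())) | []
... | mid ∷ʳ′ p = around r mid p

-- Parity of rows

par : Vec Bool n → Bool
par V.[] = false
par (b V.∷ bs) = b xor par bs

-- The odd half is there for the induction: a leading one exchanges the two claims.
par⇒∣ : (bs : Vec Bool n) → (par bs ≡ false → 2 ∣ ones bs) × (par bs ≡ true → 2 ∣ suc (ones bs))
par⇒∣ V.[] = (λ _ → 2 ∣0) , λ ()
par⇒∣ (false V.∷ bs) = par⇒∣ bs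
par⇒∣ (true V.∷ bs) with par bs | par⇒∣ bs
... | true | _ , odd = (λ _ → odd refl) , λ ()
... | false | even , _ = (λ ()) , λ _ → ∣m∣n⇒∣m+n (∣-refl {2}) (even refl)

par-none : (bs : Vec Bool n) → (∀ y → ¬ T (lookup bs y)) → par bs ≡ false
par-none V.[] h = refl
par-none (true V.∷ bs) h = ⊥-elim (h zero _)
par-none (false V.∷ bs) h = par-none bs (h ∘ suc)

par-one : (bs : Vec Bool n) (p : Fin n) → (∀ y → T (lookup bs y) → y ≡ p) → par bs ≡ lookup bs p
par-one (b V.∷ bs) zero h = trans (cong (b xor_) (par-none bs λ y t → 0≢1+n (sym (h (suc y) t)))) (xor-identityʳ b)
par-one (true V.∷ bs) (suc p) h with () ← h zero _
par-one (false V.∷ bs) (suc p) h = par-one bs p λ y t → suc-injective (h (suc y) t)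

par-two : (bs : Vec Bool n) (p r : Fin n) → p ≢ r → (∀ y → T (lookup bs y) → y ≡ p ⊎ y ≡ r) →
          par bs ≡ lookup bs p xor lookup bs r
par-two (b V.∷ bs) zero zero p≢r h = ⊥-elim (p≢r refl)
par-two (b V.∷ bs) zero (suc r) p≢r h = cong (b xor_) (par-one bs r λ y t → f (h (suc y) t))
  where
  f : ∀ {y z : Fin n} → Fin.suc y ≡ zero ⊎ Fin.suc y ≡ suc z → y ≡ z
  f (inj₂ refl) = refl
par-two (b V.∷ bs) (suc p) zero p≢r h = trans (cong (b xor_) (par-one bs p λ y t → f (h (suc y) t))) (xor-comm b _)
  where
  f : ∀ {y z : Fin n} → Fin.suc y ≡ suc z ⊎ Fin.suc y ≡ zero → y ≡ z
  f (inj₁ refl) = refl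
par-two (true V.∷ bs) (suc p) (suc r) p≢r h with h zero _
... | inj₁ ()
... | inj₂ ()
par-two (false V.∷ bs) (suc p) (suc r) p≢r h =
  par-two bs p r (p≢r ∘ cong suc) λ y t → Sum.map suc-injective suc-injective (h (suc y) t)

-- The form of `Eulerian` that computes: in a row supported on two positions it becomes an equation
-- between two entries.
Even : Mat n → Set
Even K = ∀ x → par (lookup K x) ≡ false

-- Cycles

cycEdges-∈ : (vs : List (Fin n)) → ∀ {u v} → T (at (cycEdges vs) u v) → u ∈ vs × v ∈ vs
cycEdges-∈ vs t with edgesOf⁻ (cycPairs vs) t
... | inj₁ e = cycPairs-∈ vs e
... | inj₂ e = Product.swap (cycPairs-∈ vs e)

two-nbrs : (vs : List (Fin n)) → 3 ≤ length vs → Unique vs → ∀ {q} → q ∈ vs →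
  ∃₂ λ r p → r ≢ p × T (at (cycEdges vs) q r) × T (at (cycEdges vs) q p) ×
             (∀ y → T (at (cycEdges vs) q y) → y ≡ r ⊎ y ≡ p)
two-nbrs vs 3≤ u {q} q∈ with rotateTo q∈
... | us , vs↭ , ps↭ with around? q us (subst (3 ≤_) (↭ₚ.↭-length vs↭) 3≤)
... | around r mid p = r , p , r≢p , edge (inj₁ (here refl)) , edge (inj₂ (there (∈-++⁺ʳ _ (here refl)))) ,
      λ y t → cycle-degree mid u′ (edgesOf⁻ (cycPairs (q ∷ us)) (subst (λ M → T (at M q y)) (edgesOf-↭ ps↭) t))
  where
  u′ = Unique-resp-↭ vs↭ u
  edge : ∀ {y} → Edge ((q , r) ∷ pathPairs (r ∷ mid ++ [ p ]) ++ [ (p , q) ]) q y → T (at (cycEdges vs) q y)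
  edge {y} e = subst (λ M → T (at M q y)) (sym (trans (edgesOf-↭ ps↭) (cong edgesOf (cycPairs-around q r mid p)))) (edgesOf⁺ _ e)
  r≢p : r ≢ p
  r≢p refl = Unique-∉ (AllPairs.tail u′) (∈-++⁺ʳ mid (here refl))

cycle-nbr : (vs : List (Fin n)) → 3 ≤ length vs → Unique vs → ∀ {q} → q ∈ vs → ∃ λ y → T (at (cycEdges vs) q y)
cycle-nbr vs 3≤ u q∈ with r , _ , _ , t , _ ← two-nbrs vs 3≤ u q∈ = r , t

cycle-even : (vs : List (Fin n)) → 3 ≤ length vs → Unique vs → Even (cycEdges vs)
cycle-even vs 3≤ u x with _∈?_ _≟_ x vs
... | no x∉ = par-none (lookup (cycEdges vs) x) λ y t → x∉ (proj₁ (cycEdges-∈ vs t))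
... | yes x∈ with two-nbrs vs 3≤ u x∈
... | r , p , r≢p , tr , tp , nb = trans (par-two (lookup (cycEdges vs) x) r p r≢p nb) (cong₂ _xor_ (T⇒true tr) (T⇒true tp))

xor-false : ∀ a b → a xor b ≡ false → a ≡ b
xor-false true true _ = refl
xor-false false false _ = refl

-- The row of `q` in `K` is supported on the two cycle neighbours of `q`, and even parity forces
-- these two entries to agree.
local-const : (vs : List (Fin n)) → 3 ≤ length vs → Unique vs → (K : Mat n) → Even K → ∀ {q} → q ∈ vs →
  (∀ y → T (at K q y) → T (at (cycEdges vs) q y)) →
  ∀ {y y′} → T (at (cycEdges vs) q y) → T (at (cycEdges vs) q y′) → at K q y ≡ at K q y′
local-const vs 3≤ u K ev {q} q∈ sub {y} {y′} t t′ with two-nbrs vs 3≤ u q∈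
... | r , p , r≢p , _ , _ , nb = trans (f (nb y t)) (sym (f (nb y′ t′)))
  where
  r≡p : at K q r ≡ at K q p
  r≡p = xor-false _ _ (trans (sym (par-two (lookup K q) r p r≢p λ z s → nb z (sub z s))) (ev q))
  f : ∀ {z} → z ≡ r ⊎ z ≡ p → at K q z ≡ at K q r
  f (inj₁ refl) = refl
  f (inj₂ refl) = sym r≡p

pathPairs-first : (q : Fin n) (m : List (Fin n)) (t : Fin n) → ∃ λ z → (q , z) ∈ pathPairs (q ∷ m ++ [ t ])
pathPairs-first q [] t = t , here refl
pathPairs-first q (z ∷ m) t = z , here refl

-- Equality of the entries at each inner vertex propagates along the path. The condition concerns
-- inner vertices only, so the lemma serves both a cycle cut open at one vertex and a path attached
-- to a graph.
path-const : (K : Mat n) → (∀ u v → at K u v ≡ at K v u) → (R : Fin n → Fin n → Set) → (∀ {u v} → R u v → R v u) →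
  ∀ h m t → (∀ {u v} → (u , v) ∈ pathPairs (h ∷ m ++ [ t ]) → R u v) →
  (∀ {q} → q ∈ m → ∀ {y y′} → R q y → R q y′ → at K q y ≡ at K q y′) →
  ∃ λ c → ∀ {u v} → (u , v) ∈ pathPairs (h ∷ m ++ [ t ]) → at K u v ≡ c
path-const K K-sym R R-sym h [] t on loc = at K h t , λ { (here refl) → refl }
path-const K K-sym R R-sym h (q ∷ m) t on loc with path-const K K-sym R R-sym q m t (on ∘ there) (loc ∘ there)
... | c , f = c , λ { (here refl) → head ; (there e) → f e }
  where
  z∈ = proj₂ (pathPairs-first q m t)
  head : at K h q ≡ c
  head = trans (K-sym h q) (trans (loc (here refl) (R-sym (on (here refl))) (on (there z∈))) (f z∈))

-- Even parity makes `K` constant along the cycle, and the edge `a b` shows that the constant is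
-- `true`.
cycle-minimal : (vs : List (Fin n)) → 3 ≤ length vs → Unique vs → (K : Mat n) → Even K →
  (∀ u v → at K u v ≡ at K v u) → (∀ u v → T (at K u v) → T (at (cycEdges vs) u v)) →
  ∀ {a b} → T (at K a b) → K ≡ cycEdges vs
cycle-minimal vs@(x ∷ xs) 3≤ u K ev K-sym sub {a} {b} tab
  with path-const K K-sym (λ u v → T (at (cycEdges vs) u v)) (λ {u} {v} → T-≡ (edgesOf-sym (cycPairs vs) u v)) x xs x
         (λ e → edgesOf⁺ (cycPairs vs) (inj₁ (subst (_ ∈_) (sym (cycPairs-path x xs)) e)))
         (λ q∈ → local-const vs 3≤ u K ev (there q∈) (sub _))
... | c , f = Mat-ext λ v w → T-ext (sub v w) λ t → T-≡ (trans (const (sub a b tab)) (sym (const t))) tab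
  where
  const : ∀ {v w} → T (at (cycEdges vs) v w) → at K v w ≡ c
  const {v} {w} t with edgesOf⁻ (cycPairs vs) t
  ... | inj₁ e = f (subst (_ ∈_) (cycPairs-path x xs) e)
  ... | inj₂ e = trans (K-sym v w) (f (subst (_ ∈_) (cycPairs-path x xs) e))

AdjP : Graph n → Fin n × Fin n → Set
AdjP G p = Adj G (proj₁ p) (proj₂ p)

Adj-sym : (G : Graph n) → ∀ {u v} → Adj G u v → Adj G v u
Adj-sym G {u} {v} = T-≡ (adj-sym G u v)

Adj-irr : (G : Graph n) → ∀ {u v} → Adj G u v → u ≢ v
Adj-irr G {u} t refl = subst T (irr G u) t

cycle-Adj : (G : Graph n) {vs : List (Fin n)} → IsCycleIn G vs → ∀ {u v} → T (at (cycEdges vs) u v) → Adj G u v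
cycle-Adj G {vs} (_ , _ , a) t with edgesOf⁻ (cycPairs vs) t
... | inj₁ e = All.lookup a e
... | inj₂ e = Adj-sym G (All.lookup a e)

cycle-resp : (G : Graph n) {vs us : List (Fin n)} → vs ↭ us → cycPairs vs ↭ cycPairs us → IsCycleIn G vs → IsCycleIn G us
cycle-resp G p q (l , u , a) = subst (3 ≤_) (↭ₚ.↭-length p) l , Unique-resp-↭ p u , All-resp-↭ q a

induced⇒cycle : (G : Graph n) {H : Mat n} → InducedCycles G H → Cycles G H
induced⇒cycle G (vs , (c , _) , e) = vs , c , e

cycle-Eulerian : (G : Graph n) {H : Mat n} → Cycles G H → EulerianSubgraph G H
cycle-Eulerian G (vs , c@(l , u , _) , refl) =
  (edgesOf-sym (cycPairs vs) , λ _ _ → cycle-Adj G c) , λ v → proj₁ (par⇒∣ (lookup (cycEdges vs) v)) (cycle-even vs l u v)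

-- Spans and sums of subsets

Span : SubgraphSet n → Mat n → Set
Span B H = Σ (List _) λ L → All B L × ⊕Σ L ≡ H

span-gen : {B : SubgraphSet n} {H : Mat n} → B H → Span B H
span-gen {H = H} b = [ H ] , b ∷ [] , ⊕-identityʳ H

span-⊕ : {B : SubgraphSet n} {H K : Mat n} → Span B H → Span B K → Span B (H ⊕ K)
span-⊕ (L , a , refl) (L′ , a′ , refl) = L ++ L′ , Allₚ.++⁺ a a′ , ⊕Σ-++ L L′

span-bind : {B B′ : SubgraphSet n} → (∀ {K} → B K → Span B′ K) → ∀ {H} → Span B H → Span B′ H
span-bind f ([] , [] , refl) = [] , [] , refl
span-bind f (K ∷ L , b ∷ a , refl) = span-⊕ (f b) (span-bind f (L , a , refl))

-- `Span` allows repeated terms, so that sums can simply be concatenated. A term that is already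
-- present cancels against its other copy, and removing both gives a sum over an actual subset.
span-dedup : {B : SubgraphSet n} {H : Mat n} → Span B H → SumOfSubset B H
span-dedup ([] , [] , refl) = [] , [] , [] , refl
span-dedup (K ∷ L , b ∷ a , refl) with span-dedup (L , a , refl)
... | L′ , u , a′ , eq with _∈?_ Mat-≟ K L′
... | no K∉ = K ∷ L′ , ∉-Unique K∉ u , b ∷ a′ , cong (K ⊕_) eq
... | yes K∈ with xs , ys , refl ← ∈-∃++ K∈ with _ ∷ u′ ← Unique-resp-↭ (shift K xs ys) u with _ ∷ a″ ← All-resp-↭ (shift K xs ys) a′ =
  xs ++ ys , u′ , a″ , trans (sym (⊕-cancel K _)) (cong (K ⊕_) (trans (sym (⊕Σ-↭ (shift K xs ys))) eq))

-- Closed walks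

-- The vertex predicate confines a decomposition to part of the graph; later it says that the cycles
-- avoid a vertex of degree two.
InducedIn : Graph n → (Fin n → Set) → SubgraphSet n
InducedIn G P K = Σ (List _) λ us → IsInducedCycleIn G us × All P us × cycEdges us ≡ K

dup? : (vs : List (Fin n)) → Unique vs ⊎ (∃ λ x → ∃₂ λ xs us → vs ≡ xs ++ x ∷ us × x ∈ us)
dup? [] = inj₁ []
dup? (v ∷ vs) with _∈?_ _≟_ v vs
... | yes v∈ = inj₂ (v , [] , vs , refl , v∈)
... | no v∉ with dup? vs
... | inj₁ u = inj₁ (∉-Unique v∉ u)
... | inj₂ (x , xs , us , refl , x∈) = inj₂ (x , v ∷ xs , us , refl , x∈)

chord? : (G : Graph n) (vs : List (Fin n)) →
  (∀ u v → u ∈ vs → v ∈ vs → Adj G u v → T (at (cycEdges vs) u v)) ⊎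
  (∃₂ λ u v → u ∈ vs × v ∈ vs × Adj G u v × ¬ T (at (cycEdges vs) u v))
chord? G vs with any? (λ u → any? (λ v → _∈?_ _≟_ u vs ×-dec (_∈?_ _≟_ v vs ×-dec (T? (at (adj G) u v) ×-dec ¬? (T? (at (cycEdges vs) u v))))))
... | yes (u , v , h) = inj₂ (u , v , h)
... | no ¬h = inj₁ λ u v u∈ v∈ a → decidable-stable (T? _) λ ¬t → ¬h (u , v , u∈ , v∈ , a , ¬t)

-- Induction on the length of the walk. Pinching and cutting along a chord only reuse vertices of
-- the walk, so `P` is kept; a chordless walk with at least three vertices, all distinct, is itself
-- an induced cycle.
closed-walk-span : (G : Graph n) (P : Fin n → Set) (vs : List (Fin n)) → All P vs → All (AdjP G) (cycPairs vs) →
  Span (InducedIn G P) (wsum (cycPairs vs))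
closed-walk-span {n = n} G P vs₀ = go (length vs₀) vs₀ ≤-refl
  where
  Goal : List (Fin n) → Set
  Goal vs = All P vs → All (AdjP G) (cycPairs vs) → Span (InducedIn G P) (wsum (cycPairs vs))

  module _ (k : ℕ) (rec : ∀ us → length us ≤ k → Goal us) where
    pinch : ∀ x ys zs → length (x ∷ ys ++ x ∷ zs) ≤ suc k → Goal (x ∷ ys ++ x ∷ zs)
    pinch x ys zs le pv adjs = subst (Span _) eq
        (span-⊕ (rec (x ∷ ys) le₁ (px ∷ py) (subst (All (AdjP G)) (sym (cycPairs-path x ys)) a₁))
                (rec (x ∷ zs) le₂ pz (subst (All (AdjP G)) (sym (cycPairs-path x zs)) a₂)))
      where
      p′ = Allₚ.++⁻ (x ∷ ys) pv
      px = All.head (proj₁ p′)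
      py = All.tail (proj₁ p′)
      pz = proj₂ p′
      a′ = Allₚ.++⁻ (pathPairs (x ∷ ys ++ [ x ])) (subst (All (AdjP G)) (cycPairs-split x ys x zs) adjs)
      a₁ = proj₁ a′
      a₂ = proj₂ a′
      len : length (x ∷ ys ++ x ∷ zs) ≡ suc (suc (length ys + length zs))
      len = trans (cong suc (length-++ ys)) (cong suc (+-suc (length ys) (length zs)))
      le′ : suc (length ys + length zs) ≤ k
      le′ = s≤s⁻¹ (subst (_≤ suc k) len le)
      le₁ = ≤-trans (s≤s (m≤m+n (length ys) (length zs))) le′
      le₂ = ≤-trans (s≤s (m≤n+m (length zs) (length ys))) le′
      eq : wsum (cycPairs (x ∷ ys)) ⊕ wsum (cycPairs (x ∷ zs)) ≡ wsum (cycPairs (x ∷ ys ++ x ∷ zs))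
      eq = trans (sym (wsum-++ (cycPairs (x ∷ ys)) (cycPairs (x ∷ zs))))
        (cong wsum (trans (cong₂ _++_ (cycPairs-path x ys) (cycPairs-path x zs)) (sym (cycPairs-split x ys x zs))))

    chord : ∀ x y ys zs → Adj G x y → ys ≢ [] → zs ≢ [] → length (x ∷ ys ++ y ∷ zs) ≤ suc k → Goal (x ∷ ys ++ y ∷ zs)
    chord x y [] zs _ ys≢ _ = ⊥-elim (ys≢ refl)
    chord x y (_ ∷ _) [] _ _ zs≢ = ⊥-elim (zs≢ refl)
    chord x y ys@(y′ ∷ ys′) zs@(z′ ∷ zs′) xy _ _ le pv adjs = subst (Span _) eq
        (span-⊕ (rec (x ∷ ys ++ [ y ]) le₁ (px ∷ Allₚ.++⁺ py (p-y ∷ [])) (subst (All (AdjP G)) (sym (cycPairs-split x ys y [])) (Allₚ.++⁺ a₁ (Adj-sym G xy ∷ []))))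
                (rec (y ∷ zs ++ [ x ]) le₂ (p-y ∷ Allₚ.++⁺ pz (px ∷ [])) (subst (All (AdjP G)) (sym (cycPairs-split y zs x [])) (Allₚ.++⁺ a₂ (xy ∷ [])))))
      where
      p′ = Allₚ.++⁻ (x ∷ ys) pv
      px = All.head (proj₁ p′)
      py = All.tail (proj₁ p′)
      p-y = All.head (proj₂ p′)
      pz = All.tail (proj₂ p′)
      a′ = Allₚ.++⁻ (pathPairs (x ∷ ys ++ [ y ])) (subst (All (AdjP G)) (cycPairs-split x ys y zs) adjs)
      a₁ = proj₁ a′
      a₂ = proj₂ a′
      len : length (x ∷ ys ++ y ∷ zs) ≡ suc (suc (length ys + length zs))
      len = trans (cong suc (length-++ ys)) (cong suc (+-suc (length ys) (length zs)))
      len′ : ∀ (u v : Fin n) ws → length (u ∷ ws ++ [ v ]) ≡ suc (suc (length ws))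
      len′ u v ws = cong suc (sym (↭ₚ.↭-length (∷↭∷ʳ v ws)))
      le′ : suc (length ys + length zs) ≤ k
      le′ = s≤s⁻¹ (subst (_≤ suc k) len le)
      -- Each half contains both ends of the chord, and is shorter than the whole because the other
      -- half has at least one inner vertex.
      le₁ : length (x ∷ ys ++ [ y ]) ≤ k
      le₁ = ≤-trans (≤-trans (≤-reflexive (len′ x y ys)) (s≤s (≤-trans (s≤s (m≤m+n (length ys) (length zs′))) (≤-reflexive (sym (+-suc (length ys) (length zs′))))))) le′
      le₂ : length (y ∷ zs ++ [ x ]) ≤ k
      le₂ = ≤-trans (≤-trans (≤-reflexive (len′ y x zs)) (s≤s (s≤s (m≤n+m (length zs) (length ys′))))) le′
      P₁ = pathPairs (x ∷ ys ++ [ y ])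
      P₂ = pathPairs (y ∷ zs ++ [ x ])
      E = edgesOf [ (x , y) ]
      -- The chord occurs once in each half, in opposite directions, and cancels.
      eq : wsum (cycPairs (x ∷ ys ++ [ y ])) ⊕ wsum (cycPairs (y ∷ zs ++ [ x ])) ≡ wsum (cycPairs (x ∷ ys ++ y ∷ zs))
      eq = begin
        wsum (cycPairs (x ∷ ys ++ [ y ])) ⊕ wsum (cycPairs (y ∷ zs ++ [ x ]))
          ≡⟨ cong₂ (λ p q → wsum p ⊕ wsum q) (cycPairs-split x ys y []) (cycPairs-split y zs x []) ⟩
        wsum (P₁ ++ [ (y , x) ]) ⊕ wsum (P₂ ++ [ (x , y) ])
          ≡⟨ cong₂ _⊕_ (wsum-↭ (↭-sym (∷↭∷ʳ (y , x) P₁))) (wsum-↭ (↭-sym (∷↭∷ʳ (x , y) P₂))) ⟩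
        (edgesOf [ (y , x) ] ⊕ wsum P₁) ⊕ (E ⊕ wsum P₂)
          ≡⟨ cong (λ e → (e ⊕ wsum P₁) ⊕ (E ⊕ wsum P₂)) (edge-swap y x) ⟩
        (E ⊕ wsum P₁) ⊕ (E ⊕ wsum P₂)   ≡⟨ ⊕-swap (E ⊕ wsum P₁) E (wsum P₂) ⟩
        E ⊕ ((E ⊕ wsum P₁) ⊕ wsum P₂)   ≡⟨ cong (E ⊕_) (⊕-assoc E (wsum P₁) (wsum P₂)) ⟩
        E ⊕ (E ⊕ (wsum P₁ ⊕ wsum P₂))   ≡⟨ ⊕-cancel E _ ⟩
        wsum P₁ ⊕ wsum P₂               ≡⟨ wsum-++ P₁ P₂ ⟨
        wsum (P₁ ++ P₂)                 ≡⟨ cong wsum (cycPairs-split x ys y zs) ⟨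
        wsum (cycPairs (x ∷ ys ++ y ∷ zs)) ∎
        where open ≡-Reasoning

    transport : ∀ {vs us} → vs ↭ us → cycPairs vs ↭ cycPairs us → (length us ≤ suc k → Goal us) → length vs ≤ suc k → Goal vs
    transport p q g le pv a = subst (Span _) (sym (wsum-↭ q)) (g (subst (_≤ suc k) (↭ₚ.↭-length p) le) (All-resp-↭ p pv) (All-resp-↭ q a))

    unique-walk : ∀ vs → 3 ≤ length vs → Unique vs → length vs ≤ suc k → Goal vs
    unique-walk vs 3≤ u le pv a with chord? G vs
    ... | inj₁ ind = span-gen (vs , ((3≤ , u , a) , ind) , pv , edgesOf-wsum (Distinct-cycle vs 3≤ u))
    ... | inj₂ (x , y , x∈ , y∈ , xy , ¬xy) with rotateTo x∈
    ... | us , p , q with ∈-resp-↭ p y∈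
    ... | here refl = ⊥-elim (Adj-irr G xy refl)
    ... | there y∈us with ys , zs , refl ← ∈-∃++ y∈us =
      transport p q (chord x y ys zs xy ys≢ zs≢) le pv a
      where
      -- If one of the two arcs had no inner vertex, `x y` would be an edge of the walk and not a
      -- chord.
      ¬e : ¬ Edge (pathPairs (x ∷ ys ++ [ y ]) ++ pathPairs (y ∷ zs ++ [ x ])) x y
      ¬e e = ¬xy (subst (λ M → T (at M x y)) (sym (trans (edgesOf-↭ q) (cong edgesOf (cycPairs-split x ys y zs)))) (edgesOf⁺ _ e))
      ys≢ : ys ≢ []
      ys≢ refl = ¬e (inj₁ (here refl))
      zs≢ : zs ≢ []
      zs≢ refl = ¬e (inj₂ (∈-++⁺ʳ (pathPairs (x ∷ ys ++ [ y ])) (here refl)))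

    walk : ∀ vs → length vs ≤ suc k → Goal vs
    walk vs le with dup? vs
    walk .(xs ++ x ∷ us) le | inj₂ (x , xs , us , refl , x∈) with ys , zs , refl ← ∈-∃++ x∈ =
      transport (↭-trans (↭ₚ.++-comm xs (x ∷ ys ++ x ∷ zs)) (↭-reflexive assoc))
        (↭-trans (cycPairs-rotate xs (x ∷ ys ++ x ∷ zs)) (↭-reflexive (cong cycPairs assoc))) (pinch x ys (zs ++ xs)) le
      where
      assoc : (x ∷ ys ++ x ∷ zs) ++ xs ≡ x ∷ ys ++ x ∷ zs ++ xs
      assoc = ++-assoc (x ∷ ys) (x ∷ zs) xs
    walk [] le | inj₁ u = λ _ _ → [] , [] , refl
    walk (x ∷ []) le | inj₁ u = λ _ → λ { (xx ∷ []) → ⊥-elim (Adj-irr G xx refl) }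
    -- A closed walk of length 2 runs through one edge twice, so its sum is zero.
    walk (x ∷ y ∷ []) le | inj₁ u = λ _ _ → [] , [] ,
      sym (trans (cong (edgesOf [ (x , y) ] ⊕_) (trans (⊕-identityʳ _) (edge-swap y x))) (⊕-self _))
    walk vs@(x ∷ y ∷ z ∷ r) le | inj₁ u = unique-walk vs (s≤s (s≤s (s≤s z≤n))) u le

  go : ∀ k vs → length vs ≤ k → Goal vs
  go zero [] z≤n _ _ = [] , [] , refl
  go (suc k) vs le = walk k (go k) vs le

-- Independence

-- The comparison is between edge sets, so different vertex lists of one cycle are identified.
Others : SubgraphSet n → Mat n → SubgraphSet n
Others B H K = B K × K ≢ H

Indep : Graph n → Set
Indep G = ∀ {H} → InducedCycles G H → ¬ Span (Others (InducedCycles G) H) H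

cycle-span : (G : Graph n) → ∀ {H} → Cycles G H → Span (InducedCycles G) H
cycle-span G (vs , (3≤ , u , a) , refl) = subst (Span _) (sym (edgesOf-wsum (Distinct-cycle vs 3≤ u)))
  (span-bind (λ { (us , i , _ , e) → span-gen (us , i , e) })
    (closed-walk-span G (λ _ → ⊤) vs (All.tabulate _) a))

-- A generating subset that omits `H` would express the cycle `H` by other induced cycles.
Indep⇒CycleBasis : (G : Graph n) → Indep G → CycleBasis G (InducedCycles G)
Indep⇒CycleBasis G ind = (λ H → cycle-Eulerian G ∘ induced⇒cycle G) , (λ H → span-dedup ∘ cycle-span G) ,
  λ (B′ , B′⊆B , gen , H , BH , ¬B′H) → let L , _ , a , eq = gen H (induced⇒cycle G BH) in
    ind BH (L , All.map (λ {K} b → B′⊆B K b , λ { refl → ¬B′H b }) a , eq)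

-- If `H` were a sum of other induced cycles, substituting this sum for `H` everywhere would leave a
-- smaller generating set, against minimality.
CycleBasis⇒Indep : (G : Graph n) → CycleBasis G (InducedCycles G) → Indep G
CycleBasis⇒Indep G (_ , gen , min) {H} BH sp = min (Others (InducedCycles G) H , (λ _ → proj₁) , gen′ , H , BH , λ o → proj₂ o refl)
  where
  repl : ∀ {K} → InducedCycles G K → Span (Others (InducedCycles G) H) K
  repl {K} b with Mat-≟ K H
  ... | yes refl = sp
  ... | no K≢H = span-gen (b , K≢H)
  gen′ : Generates G (Others (InducedCycles G) H)
  gen′ K c = span-dedup (span-bind repl (cycle-span G c))

-- Injections of graphs

Edge-map⁺ : (f : Fin n → Fin m) {ps : List (Fin n × Fin n)} → ∀ {a b} → Edge ps a b → Edge (map (map² f) ps) (f a) (f b)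
Edge-map⁺ f = Sum.map (∈-map⁺ (map² f)) (∈-map⁺ (map² f))

Edge-map⁻ : (f : Fin n → Fin m) {ps : List (Fin n × Fin n)} → ∀ {x y} → Edge (map (map² f) ps) x y →
            ∃₂ λ a b → Edge ps a b × x ≡ f a × y ≡ f b
Edge-map⁻ f (inj₁ e) with (a , b) , e′ , refl ← ∈-map⁻ (map² f) e = a , b , inj₁ e′ , refl , refl
Edge-map⁻ f (inj₂ e) with (a , b) , e′ , refl ← ∈-map⁻ (map² f) e = b , a , inj₂ e′ , refl , refl

cycEdges-map⁺ : (f : Fin n → Fin m) (ws : List (Fin n)) → ∀ {a b} → T (at (cycEdges ws) a b) → T (at (cycEdges (map f ws)) (f a) (f b))
cycEdges-map⁺ f ws t rewrite cycPairs-map f ws = edgesOf⁺ _ (Edge-map⁺ f (edgesOf⁻ (cycPairs ws) t))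

cycEdges-map⁻ : (f : Fin n → Fin m) (ws : List (Fin n)) → ∀ {x y} → T (at (cycEdges (map f ws)) x y) →
  ∃₂ λ a b → T (at (cycEdges ws) a b) × x ≡ f a × y ≡ f b
cycEdges-map⁻ f ws t rewrite cycPairs-map f ws with a , b , e , eq ← Edge-map⁻ f (edgesOf⁻ (map (map² f) (cycPairs ws)) t) =
  a , b , edgesOf⁺ (cycPairs ws) e , eq

cycEdges-map-cong : (f : Fin n → Fin m) (ws ws′ : List (Fin n)) → cycEdges ws ≡ cycEdges ws′ → cycEdges (map f ws) ≡ cycEdges (map f ws′)
cycEdges-map-cong f ws ws′ eq = Mat-ext λ x y → T-ext (go ws ws′ eq) (go ws′ ws (sym eq))
  where
  go : ∀ ws ws′ → cycEdges ws ≡ cycEdges ws′ → ∀ {x y} → T (at (cycEdges (map f ws)) x y) → T (at (cycEdges (map f ws′)) x y)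
  go ws ws′ eq t with a , b , t′ , refl , refl ← cycEdges-map⁻ f ws t = cycEdges-map⁺ f ws′ (subst (λ M → T (at M a b)) eq t′)

-- Since `old` is an equality of entries, the image is an induced subgraph, and being chordless
-- transfers in both directions.
record Embeds (G : Graph n) (G′ : Graph m) (ι : Fin n → Fin m) : Set where
  field
    inj : ∀ {a b} → ι a ≡ ι b → a ≡ b
    old : ∀ a b → at (adj G′) (ι a) (ι b) ≡ at (adj G) a b

  cycEdges-map : ∀ ws a b → at (cycEdges (map ι ws)) (ι a) (ι b) ≡ at (cycEdges ws) a b
  cycEdges-map ws a b = T-ext f (cycEdges-map⁺ ι ws)
    where
    f : T (at (cycEdges (map ι ws)) (ι a) (ι b)) → T (at (cycEdges ws) a b)
    f t with a′ , b′ , t′ , e , e′ ← cycEdges-map⁻ ι ws t rewrite inj e | inj e′ = t′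

  induced-map : ∀ {ws} → IsInducedCycleIn G ws → IsInducedCycleIn G′ (map ι ws)
  induced-map {ws} ((l , u , a) , ind) = (subst (3 ≤_) (sym (length-map ι ws)) l , Uniqueₚ.map⁺ inj u , adjs) , ind′
    where
    adjs : All (AdjP G′) (cycPairs (map ι ws))
    adjs = subst (All (AdjP G′)) (sym (cycPairs-map ι ws)) (Allₚ.map⁺ (All.map (λ {p} t → T-≡ (sym (old (proj₁ p) (proj₂ p))) t) a))
    ind′ : ∀ x y → x ∈ map ι ws → y ∈ map ι ws → Adj G′ x y → T (at (cycEdges (map ι ws)) x y)
    ind′ x y x∈ y∈ t with a , a∈ , refl ← ∈-map⁻ ι x∈ with b , b∈ , refl ← ∈-map⁻ ι y∈ =
      cycEdges-map⁺ ι ws (ind a b a∈ b∈ (T-≡ (old a b) t))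

  induced-unmap : ∀ {ws} → IsInducedCycleIn G′ (map ι ws) → IsInducedCycleIn G ws
  induced-unmap {ws} ((l , u , a) , ind) = (subst (3 ≤_) (length-map ι ws) l , Uniqueₚ.map⁻ u , adjs) ,
      λ a b a∈ b∈ t → T-≡ (cycEdges-map ws a b) (ind (ι a) (ι b) (∈-map⁺ ι a∈) (∈-map⁺ ι b∈) (T-≡ (sym (old a b)) t))
    where
    adjs : All (AdjP G) (cycPairs ws)
    adjs = All.map (λ {p} t → T-≡ (old (proj₁ p) (proj₂ p)) t) (Allₚ.map⁻ (subst (All (AdjP G′)) (cycPairs-map ι ws) a))

unmap-list : (f : A → B) (vs : List B) → (∀ {x} → x ∈ vs → ∃ λ a → f a ≡ x) → ∃ λ ws → vs ≡ map f ws
unmap-list f [] h = [] , refl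
unmap-list f (v ∷ vs) h with a , refl ← h (here refl) with ws , refl ← unmap-list f vs (h ∘ there) = a ∷ ws , refl

-- Linear maps that copy entries

entry : Mat n → Maybe (Fin n × Fin n) → Bool
entry M = maybe′ (λ p → at M (proj₁ p) (proj₂ p)) false

-- Linear over GF(2) for every choice of `sel`, because each entry of the result is one entry of the
-- argument or zero. Only the effect on cycles remains to be checked for a particular `sel`.
select : (Fin m → Fin m → Maybe (Fin n × Fin n)) → Mat n → Mat m
select sel M = fromFun λ x y → entry M (sel x y)

at-select : (sel : Fin m → Fin m → Maybe (Fin n × Fin n)) (M : Mat n) → ∀ x y →
  at (select sel M) x y ≡ entry M (sel x y)
at-select sel M = at-fromFun _

select-⊕ : (sel : Fin m → Fin m → Maybe (Fin n × Fin n)) (M N : Mat n) → select sel (M ⊕ N) ≡ select sel M ⊕ select sel N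
select-⊕ sel M N = Mat-ext λ x y → begin
  at (select sel (M ⊕ N)) x y                        ≡⟨ at-select sel (M ⊕ N) x y ⟩
  entry (M ⊕ N) (sel x y)                            ≡⟨ go (sel x y) ⟩
  entry M (sel x y) xor entry N (sel x y)            ≡⟨ cong₂ _xor_ (at-select sel M x y) (at-select sel N x y) ⟨
  at (select sel M) x y xor at (select sel N) x y    ≡⟨ at-⊕ (select sel M) (select sel N) x y ⟨
  at (select sel M ⊕ select sel N) x y               ∎
  where
  open ≡-Reasoning
  go : ∀ s → entry (M ⊕ N) s ≡ entry M s xor entry N s
  go nothing = refl
  go (just (a , b)) = at-⊕ M N a b

select-empty : (sel : Fin m → Fin m → Maybe (Fin n × Fin n)) → select sel emptyM ≡ emptyM
select-empty sel = Mat-ext λ x y → trans (at-select sel emptyM x y) (trans (go (sel x y)) (sym (at-empty x y)))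
  where
  go : ∀ s → entry emptyM s ≡ false
  go nothing = refl
  go (just (a , b)) = at-empty a b

select-⊕Σ : (sel : Fin m → Fin m → Maybe (Fin n × Fin n)) (L : List (Mat n)) → select sel (⊕Σ L) ≡ ⊕Σ (map (select sel) L)
select-⊕Σ sel [] = select-empty sel
select-⊕Σ sel (K ∷ L) = trans (select-⊕ sel K (⊕Σ L)) (cong (select sel K ⊕_) (select-⊕Σ sel L))

-- Linearity carries a dependence in `G` to `G′`; injectivity on induced cycles keeps the other
-- terms different from the image of `H`.
Indep-select : {G : Graph n} {G′ : Graph m} (sel : Fin m → Fin m → Maybe (Fin n × Fin n)) →
  (∀ {K} → InducedCycles G K → InducedCycles G′ (select sel K)) →
  (∀ {K K′} → InducedCycles G K → InducedCycles G K′ → select sel K ≡ select sel K′ → K ≡ K′) →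
  Indep G′ → Indep G
Indep-select {G = G} {G′} sel pres inj ind {H} h (L , a , refl) =
  ind (pres h) (map (select sel) L , Allₚ.map⁺ (All.map (λ (k , k≢) → pres k , λ e → k≢ (inj k h e)) a) , sym (select-⊕Σ sel L))

-- Attaching a path

pathPairs-hits′ : (q : Fin n) (m : List (Fin n)) (t : Fin n) → ∀ {x y} → (x , y) ∈ pathPairs (q ∷ m ++ [ t ]) → x ∈ q ∷ m
pathPairs-hits′ q [] t (here refl) = here refl
pathPairs-hits′ q (q′ ∷ m) t (here refl) = here refl
pathPairs-hits′ q (q′ ∷ m) t (there e) = there (pathPairs-hits′ q′ m t e)

-- As the path has an inner vertex, no edge of it joins its two ends. Hence attaching it creates no
-- edge between old vertices.
pathPairs-hits : (h : Fin n) (m : List (Fin n)) (t : Fin n) → m ≢ [] → ∀ {x y} → Edge (pathPairs (h ∷ m ++ [ t ])) x y → x ∈ m ⊎ y ∈ m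
pathPairs-hits h [] t m≢ e = ⊥-elim (m≢ refl)
pathPairs-hits h (q ∷ m) t _ (inj₁ (here refl)) = inj₂ (here refl)
pathPairs-hits h (q ∷ m) t _ (inj₁ (there e)) = inj₁ (pathPairs-hits′ q m t e)
pathPairs-hits h (q ∷ m) t _ (inj₂ (here refl)) = inj₁ (here refl)
pathPairs-hits h (q ∷ m) t _ (inj₂ (there e)) = inj₂ (pathPairs-hits′ q m t e)

∈-ends : (h : Fin n) (m : List (Fin n)) (t : Fin n) → ∀ {x} → x ∈ h ∷ m ++ [ t ] → x ≡ h ⊎ x ∈ m ⊎ x ≡ t
∈-ends h m t (here e) = inj₁ e
∈-ends h m t (there e) with ∈-++⁻ m e
... | inj₁ e′ = inj₂ (inj₁ e′)
... | inj₂ (here e′) = inj₂ (inj₂ e′)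

pathPairs-last : (h : Fin n) (m : List (Fin n)) (t : Fin n) → ∃ λ z → (z , t) ∈ pathPairs (h ∷ m ++ [ t ])
pathPairs-last h [] t = h , here refl
pathPairs-last h (q ∷ m) t = Product.map₂ there (pathPairs-last q m t)

-- `AddsPath` unfolded into the facts that are used: the old vertices induce `G`, and every edge at
-- an inner vertex of the path is a path edge.
record Ear (G : Graph n) (G′ : Graph m) (ι : Fin n → Fin m) (u v : Fin n) (int : List (Fin m)) : Set where
  field
    embeds : Embeds G G′ ι
    uv     : Adj G u v
    int≢   : int ≢ []
    int-u  : Unique int
    disj   : ∀ {x} → x ∈ int → ∀ a → ι a ≢ x
    cover  : ∀ x → (∃ λ a → ι a ≡ x) ⊎ x ∈ int
    path   : ∀ {x y} → Edge (pathPairs (ι u ∷ int ++ [ ι v ])) x y → Adj G′ x y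
    new    : ∀ {x y} → x ∈ int → Adj G′ x y → Edge (pathPairs (ι u ∷ int ++ [ ι v ])) x y
  open Embeds embeds public

module _ (G : Graph n) (ι : Fin n → Fin m) where
  image : Fin m → Fin m → Bool
  image x y = any (λ a → any (λ b → ⌊ ι a ≟ x ⌋ ∧ ⌊ ι b ≟ y ⌋ ∧ at (adj G) a b) (allFin n)) (allFin n)

  image⁻ : ∀ {x y} → T (image x y) → ∃₂ λ a b → ι a ≡ x × ι b ≡ y × Adj G a b
  image⁻ {x} {y} t with Any.satisfied (any⁻ _ (allFin n) t)
  ... | a , t′ with Any.satisfied (any⁻ _ (allFin n) t′)
  ... | b , t″ = a , b , go (ι a ≟ x) (ι b ≟ y) t″
    where
    go : ∀ {P Q : Set} {c} (p : Dec P) (q : Dec Q) → T (⌊ p ⌋ ∧ ⌊ q ⌋ ∧ c) → P × Q × T c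
    go (yes p) (yes q) t = p , q , t

  image⁺ : ∀ {a b} → Adj G a b → T (image (ι a) (ι b))
  image⁺ {a} {b} t = any⁺ _ (lose (∈-allFin a) (any⁺ _ (lose (∈-allFin b) (go (ι a ≟ ι a) (ι b ≟ ι b) refl refl t))))
    where
    go : ∀ {P Q : Set} {c} (p : Dec P) (q : Dec Q) → P → Q → T c → T (⌊ p ⌋ ∧ ⌊ q ⌋ ∧ c)
    go (yes _) (yes _) _ _ t = t
    go (no ¬p) _ p _ _ = ⊥-elim (¬p p)
    go (yes _) (no ¬q) _ q _ = ⊥-elim (¬q q)

module _ (G : Graph n) (G′ : Graph m) {ι : Fin n → Fin m} {u v : Fin n} {int : List (Fin m)} where
  private
    pp : List (Fin m)
    pp = ι u ∷ int ++ [ ι v ]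

  AddsPath⇒Ear : AddsPath G G′ ι u v int → Ear G G′ ι u v int
  AddsPath⇒Ear (inj , uv , int≢ , int-u , disj , cover , eq) = record
    { embeds = record { inj = inj ; old = λ a b → T-ext (old⁻ a b) (λ t → T-≡ (sym (eq (ι a) (ι b))) (Equivalence.from T-∨ (inj₁ (image⁺ G ι t)))) }
    ; uv = uv ; int≢ = int≢ ; int-u = int-u ; disj = λ {x} x∈ a → disj x x∈ a ; cover = cover
    ; path = λ {x} {y} e → T-≡ (sym (eq x y)) (Equivalence.from T-∨ (inj₂ (edgesOf⁺ (pathPairs pp) e)))
    ; new = new }
    where
    old⁻ : ∀ a b → Adj G′ (ι a) (ι b) → Adj G a b
    old⁻ a b t with Equivalence.to (T-∨ {image G ι (ι a) (ι b)}) (T-≡ (eq (ι a) (ι b)) t)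
    ... | inj₁ i with a′ , b′ , e , e′ , t′ ← image⁻ G ι i rewrite inj e | inj e′ = t′
    ... | inj₂ p with pathPairs-hits (ι u) int (ι v) int≢ (edgesOf⁻ (pathPairs pp) p)
    ... | inj₁ x∈ = ⊥-elim (disj _ x∈ a refl)
    ... | inj₂ x∈ = ⊥-elim (disj _ x∈ b refl)
    new : ∀ {x y} → x ∈ int → Adj G′ x y → Edge (pathPairs pp) x y
    new {x} {y} x∈ t with Equivalence.to (T-∨ {image G ι x y}) (T-≡ (eq x y) t)
    ... | inj₁ i with a , _ , e , _ ← image⁻ G ι i = ⊥-elim (disj x x∈ a e)
    ... | inj₂ p = edgesOf⁻ (pathPairs pp) p

  Ear⇒AddsPath : Ear G G′ ι u v int → AddsPath G G′ ι u v int
  Ear⇒AddsPath E = inj , uv , int≢ , int-u , (λ x x∈ a → disj x∈ a) , cover , λ x y → T-ext (to x y) (from x y)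
    where
    open Ear E
    to : ∀ x y → Adj G′ x y → T (image G ι x y ∨ at (pathEdges pp) x y)
    to x y t with cover x | cover y
    ... | inj₂ x∈ | _ = Equivalence.from T-∨ (inj₂ (edgesOf⁺ (pathPairs pp) (new x∈ t)))
    ... | inj₁ _ | inj₂ y∈ = Equivalence.from T-∨ (inj₂ (edgesOf⁺ (pathPairs pp) (Sum.swap (new y∈ (Adj-sym G′ t)))))
    ... | inj₁ (a , refl) | inj₁ (b , refl) = Equivalence.from T-∨ (inj₁ (image⁺ G ι (T-≡ (old a b) t)))
    from : ∀ x y → T (image G ι x y ∨ at (pathEdges pp) x y) → Adj G′ x y
    from x y t with Equivalence.to (T-∨ {image G ι x y}) t
    ... | inj₁ i with a , b , refl , refl , t′ ← image⁻ G ι i = T-≡ (sym (old a b)) t′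
    ... | inj₂ p = path (edgesOf⁻ (pathPairs pp) p)

module EarCycle {G : Graph n} {G′ : Graph m} {ι : Fin n → Fin m} {u v : Fin n} {int : List (Fin m)} (E : Ear G G′ ι u v int) where
  open Ear E

  ear : List (Fin m)
  ear = ι u ∷ int ++ [ ι v ]

  ear-unique : Unique ear
  ear-unique = ∉-Unique f (Unique-resp-↭ (∷↭∷ʳ (ι v) int) (∉-Unique (λ e → disj e v refl) int-u))
    where
    f : ι u ∉ int ++ [ ι v ]
    f e with ∈-++⁻ int e
    ... | inj₁ e′ = disj e′ u refl
    ... | inj₂ (here e′) = Adj-irr G uv (inj e′)

  ear-length : 3 ≤ length ear
  ear-length = s≤s (go int int≢)
    where
    go : ∀ l → l ≢ [] → 2 ≤ length (l ++ [ ι v ])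
    go [] l≢ = ⊥-elim (l≢ refl)
    go (_ ∷ l) _ = s≤s (subst (1 ≤_) (↭ₚ.↭-length (∷↭∷ʳ (ι v) l)) (s≤s z≤n))

  ear-pairs : cycPairs ear ≡ pathPairs ear ++ [ (ι v , ι u) ]
  ear-pairs = cycPairs-split (ι u) int (ι v) []

  ear-path⊆ : ∀ {x y} → Edge (pathPairs ear) x y → T (at (cycEdges ear) x y)
  ear-path⊆ e = edgesOf⁺ (cycPairs ear) (subst (λ ps → Edge ps _ _) (sym ear-pairs) (Sum.map ∈-++⁺ˡ ∈-++⁺ˡ e))

  ear-base : T (at (cycEdges ear) (ι u) (ι v))
  ear-base = edgesOf⁺ (cycPairs ear) (subst (λ ps → Edge ps _ _) (sym ear-pairs) (inj₂ (∈-++⁺ʳ (pathPairs ear) (here refl))))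

  base-Adj : Adj G′ (ι u) (ι v)
  base-Adj = T-≡ (sym (old u v)) uv

  ear-edge⁻ : ∀ {x y} → T (at (cycEdges ear) x y) → Edge (pathPairs ear) x y ⊎ ((x ≡ ι u × y ≡ ι v) ⊎ (x ≡ ι v × y ≡ ι u))
  ear-edge⁻ {x} {y} t = go (subst (λ ps → Edge ps x y) ear-pairs (edgesOf⁻ (cycPairs ear) t))
    where
    go : Edge (pathPairs ear ++ [ (ι v , ι u) ]) x y → _
    go (inj₁ e) with ∈-++⁻ (pathPairs ear) e
    ... | inj₁ e′ = inj₁ (inj₁ e′)
    ... | inj₂ (here refl) = inj₂ (inj₂ (refl , refl))
    go (inj₂ e) with ∈-++⁻ (pathPairs ear) e
    ... | inj₁ e′ = inj₁ (inj₂ e′)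
    ... | inj₂ (here refl) = inj₂ (inj₁ (refl , refl))

  ear-induced : IsInducedCycleIn G′ ear
  ear-induced = (ear-length , ear-unique , subst (All (AdjP G′)) (sym ear-pairs)
      (Allₚ.++⁺ (All.tabulate (λ e → path (inj₁ e))) (Adj-sym G′ base-Adj ∷ []))) , ind
    where
    ind : ∀ x y → x ∈ ear → y ∈ ear → Adj G′ x y → T (at (cycEdges ear) x y)
    ind x y x∈ y∈ t with ∈-ends (ι u) int (ι v) x∈ | ∈-ends (ι u) int (ι v) y∈
    ... | inj₂ (inj₁ x∈′) | _ = ear-path⊆ (new x∈′ t)
    ... | inj₁ _ | inj₂ (inj₁ y∈′) = ear-path⊆ (Sum.swap (new y∈′ (Adj-sym G′ t)))
    ... | inj₂ (inj₂ _) | inj₂ (inj₁ y∈′) = ear-path⊆ (Sum.swap (new y∈′ (Adj-sym G′ t)))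
    ... | inj₁ refl | inj₁ refl = ⊥-elim (Adj-irr G′ t refl)
    ... | inj₁ refl | inj₂ (inj₂ refl) = ear-base
    ... | inj₂ (inj₂ refl) | inj₁ refl = T-≡ (edgesOf-sym (cycPairs ear) (ι u) (ι v)) ear-base
    ... | inj₂ (inj₂ refl) | inj₂ (inj₂ refl) = ⊥-elim (Adj-irr G′ t refl)

  -- The edge from `ι u` to `first` is a marker: among all induced cycles only the ear contains it.
  first : Fin m
  first = proj₁ (pathPairs-first (ι u) int (ι v))

  first∈ : (ι u , first) ∈ pathPairs ear
  first∈ = proj₂ (pathPairs-first (ι u) int (ι v))

  FromOld : Mat m → Set
  FromOld K = ∃ λ ws → IsInducedCycleIn G ws × cycEdges (map ι ws) ≡ K

  -- An induced cycle meeting the path runs through all of it, hence also through the chord uv.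
  dichotomy : ∀ {K} → InducedCycles G′ K → (at K (ι u) first ≡ true × K ≡ cycEdges ear) ⊎ (at K (ι u) first ≡ false × FromOld K)
  dichotomy (vs , i@(c@(l , uq , _) , ind) , refl)
    with path-const K (edgesOf-sym (cycPairs vs)) (λ x y → T (at (cycEdges ear) x y)) (λ {x} {y} → T-≡ (edgesOf-sym (cycPairs ear) x y))
           (ι u) int (ι v) (ear-path⊆ ∘ inj₁)
           (λ q∈ → local-const ear ear-length ear-unique K (cycle-even vs l uq) (there (∈-++⁺ˡ q∈)) (λ y t → ear-path⊆ (new q∈ (cycle-Adj G′ c t))))
    where K = cycEdges vs
  -- Minimality is applied to the unknown cycle `vs`, with the ear as its even subset.
  ... | true , on-path = inj₁ (on-path first∈ , sym (cycle-minimal vs l uq (cycEdges ear) (cycle-even ear ear-length ear-unique)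
          (edgesOf-sym (cycPairs ear)) sub (ear-path⊆ (inj₁ first∈))))
    where
    K = cycEdges vs
    on-path′ : ∀ {x y} → Edge (pathPairs ear) x y → T (at K x y)
    on-path′ (inj₁ e) = T-≡ (sym (on-path e)) _
    on-path′ {x} {y} (inj₂ e) = T-≡ (trans (sym (on-path e)) (edgesOf-sym (cycPairs vs) y x)) _
    u∈ : ι u ∈ vs
    u∈ = proj₁ (cycEdges-∈ vs (on-path′ (inj₁ first∈)))
    v∈ : ι v ∈ vs
    v∈ = proj₂ (cycEdges-∈ vs (on-path′ (inj₁ (proj₂ (pathPairs-last (ι u) int (ι v))))))
    base : T (at K (ι u) (ι v))
    base = ind (ι u) (ι v) u∈ v∈ base-Adj
    sub : ∀ x y → T (at (cycEdges ear) x y) → T (at K x y)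
    sub x y t with ear-edge⁻ t
    ... | inj₁ e = on-path′ e
    ... | inj₂ (inj₁ (refl , refl)) = base
    ... | inj₂ (inj₂ (refl , refl)) = T-≡ (edgesOf-sym (cycPairs vs) (ι u) (ι v)) base
  ... | false , off-path = inj₂ (off-path first∈ , old-list (unmap-list ι vs in-image))
    where
    K = cycEdges vs
    off-path′ : ∀ {x y} → Edge (pathPairs ear) x y → ¬ T (at K x y)
    off-path′ (inj₁ e) t = T-≡ (off-path e) t
    off-path′ {x} {y} (inj₂ e) t = T-≡ (trans (edgesOf-sym (cycPairs vs) x y) (off-path e)) t
    in-image : ∀ {x} → x ∈ vs → ∃ λ a → ι a ≡ x
    in-image {x} x∈ with cover x
    ... | inj₁ h = h
    ... | inj₂ x∈′ with y , t ← cycle-nbr vs l uq x∈ = ⊥-elim (off-path′ (new x∈′ (cycle-Adj G′ c t)) t)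
    old-list : (∃ λ ws → vs ≡ map ι ws) → FromOld K
    old-list (ws , refl) = ws , induced-unmap i , refl

  restricted : Fin n → Fin n → Maybe (Fin m × Fin m)
  restricted a b = just (ι a , ι b)

  restrict : Mat m → Mat n
  restrict = select restricted


  restrict-map : ∀ ws → restrict (cycEdges (map ι ws)) ≡ cycEdges ws
  restrict-map ws = Mat-ext λ a b → trans (at-select restricted (cycEdges (map ι ws)) a b) (cycEdges-map ws a b)

  -- The marker entry of a sum counts the occurrences of the ear modulo 2. If `H` is the ear, no sum
  -- of other induced cycles has the marker. If `H` is an old cycle, the ears in the sum cancel, and
  -- what remains restricts to a dependence in `G`.
  Indep-ear : Indep G → Indep G′
  Indep-ear indep {H} h (L , a , eq) with dichotomy h
  ... | inj₁ (on , refl) = true≢false (trans (sym on) (trans (cong (λ M → at M (ι u) first) (sym eq)) (go L a)))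
    where
    true≢false : true ≢ false
    true≢false ()
    go : ∀ L → All (Others (InducedCycles G′) (cycEdges ear)) L → at (⊕Σ L) (ι u) first ≡ false
    go [] [] = at-empty (ι u) first
    go (K ∷ L) ((k , k≢) ∷ a) with dichotomy k
    ... | inj₁ (_ , k≡) = ⊥-elim (k≢ k≡)
    ... | inj₂ (off , _) = trans (at-⊕ K (⊕Σ L) (ι u) first) (cong₂ _xor_ off (go L a))
  ... | inj₂ (off , ws , i , refl) with go L a
    where
    Old : SubgraphSet n
    Old = Others (InducedCycles G) (cycEdges ws)
    -- On the old vertices the ear leaves only the edge `uv`, which is no cycle of `G`. It is
    -- therefore kept apart and governed by the marker entry.
    correction : Bool → Mat n
    correction c = if c then restrict (cycEdges ear) else emptyM
    go : ∀ L → All (Others (InducedCycles G′) (cycEdges (map ι ws))) L →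
         ∃ λ L₀ → All Old L₀ × restrict (⊕Σ L) ≡ correction (at (⊕Σ L) (ι u) first) ⊕ ⊕Σ L₀
    go [] [] = [] , [] , trans (select-empty restricted) (sym (trans (cong (λ c → correction c ⊕ emptyM) (at-empty (ι u) first)) (⊕-self emptyM)))
    go (K ∷ L) ((k , k≢) ∷ a) with go L a | dichotomy k
    ... | L₀ , a₀ , eq₀ | inj₁ (on , refl) = L₀ , a₀ , (begin
        restrict (K ⊕ S)                                     ≡⟨ select-⊕ restricted K S ⟩
        restrict K ⊕ restrict S                              ≡⟨ cong (restrict K ⊕_) eq₀ ⟩
        restrict K ⊕ (correction (at S (ι u) first) ⊕ ⊕Σ L₀) ≡⟨ flip (at S (ι u) first) ⟩
        correction (true xor at S (ι u) first) ⊕ ⊕Σ L₀       ≡⟨ cong (λ c → correction c ⊕ ⊕Σ L₀) (trans (cong (_xor at S (ι u) first) (sym on)) (sym (at-⊕ K S (ι u) first))) ⟩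
        correction (at (K ⊕ S) (ι u) first) ⊕ ⊕Σ L₀          ∎)
      where
      open ≡-Reasoning
      S = ⊕Σ L
      flip : ∀ c → restrict K ⊕ (correction c ⊕ ⊕Σ L₀) ≡ correction (true xor c) ⊕ ⊕Σ L₀
      flip true = trans (⊕-cancel (restrict K) (⊕Σ L₀)) (sym (⊕-identityˡ _))
      flip false = cong (restrict K ⊕_) (⊕-identityˡ _)
    ... | L₀ , a₀ , eq₀ | inj₂ (off , ws′ , i′ , refl) = cycEdges ws′ ∷ L₀ , ((ws′ , i′ , refl) , λ e → k≢ (cycEdges-map-cong ι ws′ ws e)) ∷ a₀ , (begin
        restrict (K ⊕ S)                                        ≡⟨ select-⊕ restricted K S ⟩
        restrict K ⊕ restrict S                                 ≡⟨ cong₂ _⊕_ (restrict-map ws′) eq₀ ⟩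
        cycEdges ws′ ⊕ (correction (at S (ι u) first) ⊕ ⊕Σ L₀)  ≡⟨ ⊕-swap (cycEdges ws′) _ (⊕Σ L₀) ⟩
        correction (at S (ι u) first) ⊕ (cycEdges ws′ ⊕ ⊕Σ L₀)  ≡⟨ cong (λ c → correction c ⊕ (cycEdges ws′ ⊕ ⊕Σ L₀)) (trans (cong (_xor at S (ι u) first) (sym off)) (sym (at-⊕ K S (ι u) first))) ⟩
        correction (at (K ⊕ S) (ι u) first) ⊕ (cycEdges ws′ ⊕ ⊕Σ L₀) ∎)
      where
      open ≡-Reasoning
      S = ⊕Σ L
  ... | L₀ , a₀ , eq₀ = indep (ws , i , refl) (L₀ , a₀ , (begin
      ⊕Σ L₀                                           ≡⟨ ⊕-identityˡ _ ⟨
      emptyM ⊕ ⊕Σ L₀                                  ≡⟨ cong (λ c → (if c then restrict (cycEdges ear) else emptyM) ⊕ ⊕Σ L₀) (trans (cong (λ M → at M (ι u) first) eq) off) ⟨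
      (if at (⊕Σ L) (ι u) first then restrict (cycEdges ear) else emptyM) ⊕ ⊕Σ L₀ ≡⟨ eq₀ ⟨
      restrict (⊕Σ L)                                 ≡⟨ cong restrict eq ⟩
      restrict (cycEdges (map ι ws))                  ≡⟨ restrict-map ws ⟩
      cycEdges ws                                     ∎))
    where open ≡-Reasoning

-- By minimality every cycle in a cycle graph is the whole graph. So no other induced cycle is
-- available, and the empty sum is not a cycle.
Indep-cycle : (G : Graph n) → IsCycleGraph G → Indep G
Indep-cycle G (vs , l , uq , _ , eq) {H} h (L , a , sum) = nonempty h (trans (sym sum) (cong ⊕Σ (empty L a)))
  where
  whole : ∀ {K} → InducedCycles G K → K ≡ cycEdges vs
  whole (us@(x ∷ _) , (c@(l′ , u′ , _) , _) , refl) = cycle-minimal vs l uq (cycEdges us) (cycle-even us l′ u′) (edgesOf-sym (cycPairs us))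
    (λ x y t → subst (λ M → T (at M x y)) eq (cycle-Adj G c t)) (proj₂ (cycle-nbr us l′ u′ (here refl)))
  nonempty : ∀ {K} → InducedCycles G K → K ≢ emptyM
  nonempty (us@(x ∷ _) , ((l′ , u′ , _) , _) , refl) e with y , t ← cycle-nbr us l′ u′ (here refl) =
    subst T (at-empty x y) (subst (λ M → T (at M x y)) e t)
  empty : ∀ L → All (Others (InducedCycles G) H) L → L ≡ []
  empty [] [] = refl
  empty (K ∷ L) ((k , k≢) ∷ _) = ⊥-elim (k≢ (trans (whole k) (sym (whole h))))

Polygonal⇒Indep : {G : Graph n} → Polygonal2Tree G → Indep G
Polygonal⇒Indep {G = G} (cycle c) = Indep-cycle G c
Polygonal⇒Indep {G = G′} (addPath {G = G} ι u v int p a) = EarCycle.Indep-ear (AddsPath⇒Ear G G′ a) (Polygonal⇒Indep p)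

-- Connectivity

module _ {G : Graph n} {ok : Fin n → Set} where
  reach-trans : ∀ {x y z} → Reach G ok x y → Reach G ok y z → Reach G ok x z
  reach-trans stop r = r
  reach-trans (move a o r′) r = move a o (reach-trans r′ r)

  reach-sym : ∀ {x y} → ok x → Reach G ok x y → Reach G ok y x
  reach-sym ox stop = stop
  reach-sym ox (move a o r) = reach-trans (reach-sym o r) (move (Adj-sym G a) ox stop)

  path-reach : ∀ h l → All ok (h ∷ l) → All (AdjP G) (pathPairs (h ∷ l)) → ∀ {y} → y ∈ h ∷ l → Reach G ok h y × ok y
  path-reach h l (o ∷ _) a (here refl) = stop , o
  path-reach h (q ∷ l) (_ ∷ os) (hq ∷ a) (there y∈) = Product.map₁ (move hq (All.head os)) (path-reach q l os a y∈)

  path-reach₂ : ∀ l → All ok l → All (AdjP G) (pathPairs l) → ∀ {x y} → x ∈ l → y ∈ l → Reach G ok x y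
  path-reach₂ (h ∷ l) os a x∈ y∈ = reach-trans (reach-sym (All.head os) (proj₁ (path-reach h l os a x∈))) (proj₁ (path-reach h l os a y∈))

reach-map : {G : Graph n} {G′ : Graph m} {ok : Fin n → Set} {ok′ : Fin m → Set} (ι : Fin n → Fin m) →
  (∀ {a b} → Adj G a b → Adj G′ (ι a) (ι b)) → (∀ {a} → ok a → ok′ (ι a)) →
  ∀ {x y} → Reach G ok x y → Reach G′ ok′ (ι x) (ι y)
reach-map ι f g stop = stop
reach-map ι f g (move a o r) = move (f a) (g o) (reach-map ι f g r)

pathPairs-prefix : (l : List (Fin n)) {t : Fin n} → ∀ {p} → p ∈ pathPairs l → p ∈ pathPairs (l ++ [ t ])
pathPairs-prefix (x ∷ y ∷ l) (here refl) = here refl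
pathPairs-prefix (x ∷ y ∷ l) (there e) = there (pathPairs-prefix (y ∷ l) e)

-- A cycle without `z` is still joined by a path through all remaining vertices; if `z` lies on the
-- cycle, rotating it to the front makes this path the tail.
cycle-reach : (G : Graph n) (vs : List (Fin n)) → IsCycleIn G vs → ∀ {x y z} → x ∈ vs → y ∈ vs → x ≢ z → y ≢ z → Reach G (_≢ z) x y
cycle-reach G vs@(h ∷ t) (l , uq , a) {x} {y} {z} x∈ y∈ x≢ y≢ with _∈?_ _≟_ z vs
... | no z∉ = path-reach₂ vs (All.tabulate (λ { w∈ refl → z∉ w∈ }))
  (All.tabulate (λ e → All.lookup a (subst (_ ∈_) (sym (cycPairs-path h t)) (pathPairs-prefix vs e)))) x∈ y∈
... | yes z∈ with rotateTo z∈
... | us , p , q with around? z us (subst (3 ≤_) (↭ₚ.↭-length p) l)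
... | around r mid s = path-reach₂ us (All.tabulate (λ { w∈ refl → Unique-∉ (Unique-resp-↭ p uq) w∈ }))
  (Allₚ.++⁻ˡ (pathPairs us) (All.tail (subst (All (AdjP G)) (cycPairs-around z r mid s) (All-resp-↭ q a)))) (tail x≢ x∈) (tail y≢ y∈)
  where
  tail : ∀ {w} → w ≢ z → w ∈ vs → w ∈ us
  tail w≢ w∈ with ∈-resp-↭ p w∈
  ... | here e = ⊥-elim (w≢ e)
  ... | there e = e

lookup-injective : {xs : List A} → Unique xs → ∀ {i j} → L.lookup xs i ≡ L.lookup xs j → i ≡ j
lookup-injective {xs = x ∷ xs} u {zero} {zero} e = refl
lookup-injective {xs = x ∷ xs} u {zero} {suc j} e = ⊥-elim (Unique-∉ u (subst (_∈ xs) (sym e) (∈-lookup j)))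
lookup-injective {xs = x ∷ xs} u {suc i} {zero} e = ⊥-elim (Unique-∉ u (subst (_∈ xs) e (∈-lookup i)))
lookup-injective {xs = x ∷ xs} (_ ∷ u) {suc i} {suc j} e = cong suc (lookup-injective u e)

Unique-length : {xs : List (Fin n)} → Unique xs → length xs ≤ n
Unique-length u = injective⇒≤ (lookup-injective u)

third : 3 ≤ n → (x y : Fin n) → ∃ λ z → x ≢ z × y ≢ z
third (s≤s (s≤s (s≤s _))) zero zero = suc zero , (λ ()) , λ ()
third (s≤s (s≤s (s≤s _))) zero (suc zero) = suc (suc zero) , (λ ()) , λ ()
third (s≤s (s≤s (s≤s _))) zero (suc (suc y)) = suc zero , (λ ()) , λ ()
third (s≤s (s≤s (s≤s _))) (suc zero) zero = suc (suc zero) , (λ ()) , λ ()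
third (s≤s (s≤s (s≤s _))) (suc (suc x)) zero = suc zero , (λ ()) , λ ()
third (s≤s (s≤s (s≤s _))) (suc x) (suc y) = zero , (λ ()) , λ ()

-- Plain connectivity comes for free: with three vertices some `z` differs from both ends, and a
-- walk avoiding `z` is in particular a walk.
two-connected : {G : Graph n} → 3 ≤ n → (∀ z x y → x ≢ z → y ≢ z → Reach G (_≢ z) x y) → TwoConnected G
two-connected {G = G} 3≤n r = 3≤n ,
  (λ x y → let z , x≢ , y≢ = third 3≤n x y in reach-map {G = G} {G′ = G} id id _ (r z x y x≢ y≢)) , r

cycleGraph-isCycle : (G : Graph n) → ∀ {vs} → 3 ≤ length vs → Unique vs → adj G ≡ cycEdges vs → IsCycleIn G vs
cycleGraph-isCycle G {vs} l u eq = l , u , All.tabulate λ {p} e → subst (λ M → T (at M (proj₁ p) (proj₂ p))) (sym eq) (edgesOf⁺ (cycPairs vs) (inj₁ e))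

Polygonal⇒TwoConnected : {G : Graph n} → Polygonal2Tree G → TwoConnected G
Polygonal⇒TwoConnected {G = G} (cycle (vs , l , u , cov , eq)) =
  two-connected {G = G} (≤-trans l (Unique-length u)) λ z x y → cycle-reach G vs (cycleGraph-isCycle G l u eq) (cov x) (cov y)
Polygonal⇒TwoConnected {n = n′} {G = G′} (addPath {n = n} {G = G} ι u v int p a) with Polygonal⇒TwoConnected p
... | 3≤n , conn , 2conn = two-connected {G = G′} (≤-trans 3≤n (injective⇒≤ inj)) go
  where
  E = AddsPath⇒Ear G G′ a
  open Ear E
  open EarCycle E
  lift : ∀ {x y} → Adj G x y → Adj G′ (ι x) (ι y)
  lift {x} {y} = T-≡ (sym (old x y))
  old-reach : ∀ z a b → ι a ≢ z → ι b ≢ z → Reach G′ (_≢ z) (ι a) (ι b)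
  old-reach z a b a≢ b≢ with cover z
  ... | inj₁ (c , refl) = reach-map {G = G} {G′ = G′} ι lift (λ o e → o (inj e)) (2conn c a b (a≢ ∘ cong ι) (b≢ ∘ cong ι))
  ... | inj₂ z∈ = reach-map {G = G} {G′ = G′} ι lift (λ {w} _ → disj z∈ w) (conn a b)
  -- The ear cycle without `z` still joins an inner vertex of the path to `ι u` or to `ι v`.
  to-old : ∀ z x → x ≢ z → ∃ λ a → ι a ≢ z × Reach G′ (_≢ z) x (ι a)
  to-old z x x≢ with cover x
  ... | inj₁ (a , refl) = a , x≢ , stop
  ... | inj₂ x∈ with ι u ≟ z
  ... | no u≢ = u , u≢ , cycle-reach G′ ear (proj₁ ear-induced) (there (∈-++⁺ˡ x∈)) (here refl) x≢ u≢
  ... | yes refl = v , v≢ , cycle-reach G′ ear (proj₁ ear-induced) (there (∈-++⁺ˡ x∈)) (there (∈-++⁺ʳ int (here refl))) x≢ v≢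
    where
    v≢ : ι v ≢ ι u
    v≢ e = Adj-irr G uv (sym (inj e))
  go : ∀ z x y → x ≢ z → y ≢ z → Reach G′ (_≢ z) x y
  go z x y x≢ y≢ with to-old z x x≢ | to-old z y y≢
  ... | a , a≢ , r | b , b≢ , r′ = reach-trans r (reach-trans (old-reach z a b a≢ b≢) (reach-sym y≢ r′))

-- Two-trees

mkGraph : (f : Fin n → Fin n → Bool) → (∀ u v → f u v ≡ f v u) → (∀ u → f u u ≡ false) → Graph n
mkGraph f s i = record
  { adj = fromFun f
  ; sym = λ u v → trans (at-fromFun f u v) (trans (s u v) (sym (at-fromFun f v u)))
  ; irr = λ u → trans (at-fromFun f u u) (i u) }

module _ (G : Graph n) (a b : Fin n) where
  private
    f : Fin (suc n) → Fin (suc n) → Bool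
    f zero zero = false
    f zero (suc y) = ⌊ y ≟ a ⌋ ∨ ⌊ y ≟ b ⌋
    f (suc x) zero = ⌊ x ≟ a ⌋ ∨ ⌊ x ≟ b ⌋
    f (suc x) (suc y) = at (adj G) x y

    f-sym : ∀ x y → f x y ≡ f y x
    f-sym zero zero = refl
    f-sym zero (suc y) = refl
    f-sym (suc x) zero = refl
    f-sym (suc x) (suc y) = adj-sym G x y

    f-irr : ∀ x → f x x ≡ false
    f-irr zero = refl
    f-irr (suc x) = irr G x

    dec⁻ : ∀ {y} → T (⌊ y ≟ a ⌋ ∨ ⌊ y ≟ b ⌋) → y ≡ a ⊎ y ≡ b
    dec⁻ {y} t with y ≟ a | y ≟ b
    ... | yes e | _ = inj₁ e
    ... | no _ | yes e = inj₂ e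

    dec⁺ : ∀ {y} → y ≡ a ⊎ y ≡ b → T (⌊ y ≟ a ⌋ ∨ ⌊ y ≟ b ⌋)
    dec⁺ {y} h with y ≟ a | y ≟ b | h
    ... | yes _ | _ | _ = _
    ... | no _ | yes _ | _ = _
    ... | no ¬e | no _ | inj₁ e = ⊥-elim (¬e e)
    ... | no _ | no ¬e | inj₂ e = ⊥-elim (¬e e)

  addV : Graph (suc n)
  addV = mkGraph f f-sym f-irr

  addV-old : ∀ {x y} → Adj G x y → Adj addV (suc x) (suc y)
  addV-old {x} {y} = T-≡ (sym (at-fromFun f (suc x) (suc y)))

  addV-new : ∀ {y} → y ≡ a ⊎ y ≡ b → Adj addV zero (suc y)
  addV-new {y} h = T-≡ (sym (at-fromFun f zero (suc y))) (dec⁺ h)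

  addV-new′ : ∀ {y} → y ≡ a ⊎ y ≡ b → Adj addV (suc y) zero
  addV-new′ {y} h = T-≡ (sym (at-fromFun f (suc y) zero)) (dec⁺ h)

  addV-ear : Adj G a b → Ear G addV suc a b [ zero ]
  addV-ear ab = record
    { embeds = record { inj = suc-injective ; old = λ x y → at-fromFun f (suc x) (suc y) }
    ; uv = ab ; int≢ = λ () ; int-u = [] ∷ []
    ; disj = λ { (here refl) _ () } ; cover = λ { zero → inj₂ (here refl) ; (suc x) → inj₁ (x , refl) }
    ; path = path ; new = new }
    where
    path : ∀ {x y} → Edge ((suc a , zero) ∷ (zero , suc b) ∷ []) x y → Adj addV x y
    path (inj₁ (here refl)) = addV-new′ (inj₁ refl)
    path (inj₁ (there (here refl))) = addV-new (inj₂ refl)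
    path (inj₂ (here refl)) = addV-new (inj₁ refl)
    path (inj₂ (there (here refl))) = addV-new′ (inj₂ refl)
    new : ∀ {x y} → x ∈ [ zero ] → Adj addV x y → Edge ((suc a , zero) ∷ (zero , suc b) ∷ []) x y
    new {y = zero} (here refl) t = ⊥-elim (T-≡ (at-fromFun f zero zero) t)
    new {y = suc y} (here refl) t with dec⁻ {y} (T-≡ (at-fromFun f zero (suc y)) t)
    ... | inj₁ refl = inj₂ (here refl)
    ... | inj₂ refl = inj₁ (there (here refl))

  addV-TwoTree : Adj G a b → TwoTree G → TwoTree addV
  addV-TwoTree ab t = addVertex suc a b zero t (Ear⇒AddsPath G addV (addV-ear ab))

-- A stage in building an embedding into a 2-tree: the edges `E` are placed, the vertices in `rem`
-- are still to come, and the values of `f` matter only outside `rem`.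
record Partial (E : Fin n → Fin n → Set) (rem : List (Fin n)) : Set where
  constructor partial
  field
    {size} : ℕ
    tree   : Graph size
    is-tree : TwoTree tree
    f      : Fin n → Fin size
    f-inj  : ∀ {x y} → x ∉ rem → y ∉ rem → f x ≡ f y → x ≡ y
    f-adj  : ∀ {x y} → E x y → Adj tree (f x) (f y)

-- The vertices of a path are added one at a time, each adjacent to its predecessor and to the far end of the path.
grow : (E : Fin n → Fin n → Set) (p q : Fin n) (rem : List (Fin n)) → Unique rem → p ∉ rem → q ∉ rem →
  (∀ {x y} → E x y → x ∉ rem × y ∉ rem) → (P : Partial E rem) → Adj (Partial.tree P) (Partial.f P p) (Partial.f P q) →
  Partial (λ x y → E x y ⊎ (x , y) ∈ pathPairs (p ∷ rem ++ [ q ])) []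
grow E p q [] u p∉ q∉ E∉ (partial T₂ t f f-inj f-adj) pq =
  partial T₂ t f f-inj λ { (inj₁ e) → f-adj e ; (inj₂ (here refl)) → pq }
grow {n = n} E p q (y ∷ ys) u@(_ ∷ u′) p∉ q∉ E∉ (partial T₂ t f f-inj f-adj) pq =
  repack (grow E′ y q ys u′ (Unique-∉ u) (q∉ ∘ there) E′∉ (partial T′ (addV-TwoTree T₂ (f p) (f q) pq t) f′ f′-inj f′-adj) yq)
  where
  E′ : Fin n → Fin n → Set
  E′ a b = E a b ⊎ (a ≡ p × b ≡ y)
  T′ = addV T₂ (f p) (f q)
  f′ : Fin n → Fin _
  f′ x with x ≟ y
  ... | yes _ = zero
  ... | no _ = suc (f x)
  f′-y : f′ y ≡ zero
  f′-y with y ≟ y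
  ... | yes _ = refl
  ... | no ¬e = ⊥-elim (¬e refl)
  f′-o : ∀ {x} → x ≢ y → f′ x ≡ suc (f x)
  f′-o {x} x≢ with x ≟ y
  ... | yes e = ⊥-elim (x≢ e)
  ... | no _ = refl
  ∉-∷ : ∀ {x} → x ≢ y → x ∉ ys → x ∉ y ∷ ys
  ∉-∷ x≢ x∉ (here e) = x≢ e
  ∉-∷ x≢ x∉ (there e) = x∉ e
  f′-inj : ∀ {a b} → a ∉ ys → b ∉ ys → f′ a ≡ f′ b → a ≡ b
  f′-inj {a} {b} a∉ b∉ e with a ≟ y | b ≟ y
  ... | yes refl | yes refl = refl
  ... | no a≢ | no b≢ = f-inj (∉-∷ a≢ a∉) (∉-∷ b≢ b∉) (suc-injective e)
  p≢y : p ≢ y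
  p≢y refl = p∉ (here refl)
  q≢y : q ≢ y
  q≢y refl = q∉ (here refl)
  f′-adj : ∀ {a b} → E′ a b → Adj T′ (f′ a) (f′ b)
  f′-adj {a} {b} (inj₁ e) with E∉ e
  ... | a∉ , b∉ rewrite f′-o {a} (λ { refl → a∉ (here refl) }) | f′-o {b} (λ { refl → b∉ (here refl) }) = addV-old T₂ (f p) (f q) (f-adj e)
  f′-adj (inj₂ (refl , refl)) rewrite f′-y | f′-o p≢y = addV-new′ T₂ (f p) (f q) (inj₁ refl)
  -- The edge from the new vertex to the far end is the base of the next triangle.
  yq : Adj T′ (f′ y) (f′ q)
  yq rewrite f′-y | f′-o q≢y = addV-new T₂ (f p) (f q) (inj₂ refl)
  E′∉ : ∀ {a b} → E′ a b → a ∉ ys × b ∉ ys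
  E′∉ (inj₁ e) = (proj₁ (E∉ e) ∘ there) , (proj₂ (E∉ e) ∘ there)
  E′∉ (inj₂ (refl , refl)) = (p∉ ∘ there) , Unique-∉ u
  repack : Partial (λ a b → E′ a b ⊎ (a , b) ∈ pathPairs (y ∷ ys ++ [ q ])) [] → Partial (λ a b → E a b ⊎ (a , b) ∈ pathPairs (p ∷ y ∷ ys ++ [ q ])) []
  repack (partial T₂ t f i j) = partial T₂ t f i λ
    { (inj₁ e) → j (inj₁ (inj₁ e)) ; (inj₂ (here refl)) → j (inj₁ (inj₂ (refl , refl))) ; (inj₂ (there e)) → j (inj₂ e) }

Partial⇒PartialTwoTree : (G : Graph n) {E : Fin n → Fin n → Set} → (∀ {a b} → Adj G a b → E a b ⊎ E b a) → Partial E [] → PartialTwoTree G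
Partial⇒PartialTwoTree G sub (partial T₂ t f i j) = _ , T₂ , t , f , i (λ ()) (λ ()) ,
  λ a b ab → Sum.[ j , Adj-sym T₂ ∘ j ] (sub ab)

K₃ : Graph 3
K₃ = mkGraph (λ u v → at (cycEdges triangle₃) u v) (edgesOf-sym (cycPairs triangle₃)) (λ { zero → refl ; (suc zero) → refl ; (suc (suc zero)) → refl })
  where
  triangle₃ : List (Fin 3)
  triangle₃ = zero ∷ suc zero ∷ suc (suc zero) ∷ []

K₃-TwoTree : TwoTree K₃
K₃-TwoTree = triangle (zero ∷ suc zero ∷ suc (suc zero) ∷ [] , s≤s (s≤s (s≤s z≤n)) ,
  ((λ ()) ∷ (λ ()) ∷ []) ∷ ((λ ()) ∷ []) ∷ [] ∷ [] ,
  (λ { zero → here refl ; (suc zero) → there (here refl) ; (suc (suc zero)) → there (there (here refl)) }) , refl)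

-- A fan with centre `x`: the triangle `x y z` comes first, and the other vertices form a path from
-- `z` back to `x`, grown on the edge `z x` of the triangle.
cycle⇒PartialTwoTree : (G : Graph n) → IsCycleGraph G → PartialTwoTree G
cycle⇒PartialTwoTree G (x ∷ [] , s≤s () , _)
cycle⇒PartialTwoTree G (x ∷ y ∷ [] , s≤s (s≤s ()) , _)
cycle⇒PartialTwoTree {n = n} G (x ∷ y ∷ z ∷ r , l , u@((x≢y ∷ x≢z ∷ _) ∷ u′@((y≢z ∷ _) ∷ u″@(_ ∷ u-r))) , cov , eq) =
  Partial⇒PartialTwoTree G sub (grow E z x r u-r z∉ x∉ E∉ (partial K₃ K₃-TwoTree f f-inj f-adj) zx)
  where
  E : Fin n → Fin n → Set
  E a b = (a ≡ x × b ≡ y) ⊎ (a ≡ y × b ≡ z)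
  x∉ : x ∉ r
  x∉ = Unique-∉ u ∘ there ∘ there
  y∉ : y ∉ r
  y∉ = Unique-∉ u′ ∘ there
  z∉ : z ∉ r
  z∉ = Unique-∉ u″
  E∉ : ∀ {a b} → E a b → a ∉ r × b ∉ r
  E∉ (inj₁ (refl , refl)) = x∉ , y∉
  E∉ (inj₂ (refl , refl)) = y∉ , z∉
  f : Fin n → Fin 3
  f w with w ≟ x | w ≟ y
  ... | yes _ | _ = zero
  ... | no _ | yes _ = suc zero
  ... | no _ | no _ = suc (suc zero)
  fx : f x ≡ zero
  fx with x ≟ x
  ... | yes _ = refl
  ... | no ¬e = ⊥-elim (¬e refl)
  fy : f y ≡ suc zero
  fy with y ≟ x | y ≟ y
  ... | yes e | _ = ⊥-elim (x≢y (sym e))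
  ... | no _ | yes _ = refl
  ... | no _ | no ¬e = ⊥-elim (¬e refl)
  fz : f z ≡ suc (suc zero)
  fz with z ≟ x | z ≟ y
  ... | yes e | _ = ⊥-elim (x≢z (sym e))
  ... | no _ | yes e = ⊥-elim (y≢z (sym e))
  ... | no _ | no _ = refl
  which : ∀ {w} → w ∉ r → w ≡ x ⊎ w ≡ y ⊎ w ≡ z
  which {w} w∉ with cov w
  ... | here e = inj₁ e
  ... | there (here e) = inj₂ (inj₁ e)
  ... | there (there (here e)) = inj₂ (inj₂ e)
  ... | there (there (there e)) = ⊥-elim (w∉ e)
  f-inj : ∀ {a b} → a ∉ r → b ∉ r → f a ≡ f b → a ≡ b
  f-inj a∉ b∉ e with which a∉ | which b∉
  ... | inj₁ refl | inj₁ refl = refl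
  ... | inj₁ refl | inj₂ (inj₁ refl) with () ← trans (sym fx) (trans e fy)
  ... | inj₁ refl | inj₂ (inj₂ refl) with () ← trans (sym fx) (trans e fz)
  ... | inj₂ (inj₁ refl) | inj₁ refl with () ← trans (sym fy) (trans e fx)
  ... | inj₂ (inj₁ refl) | inj₂ (inj₁ refl) = refl
  ... | inj₂ (inj₁ refl) | inj₂ (inj₂ refl) with () ← trans (sym fy) (trans e fz)
  ... | inj₂ (inj₂ refl) | inj₁ refl with () ← trans (sym fz) (trans e fx)
  ... | inj₂ (inj₂ refl) | inj₂ (inj₁ refl) with () ← trans (sym fz) (trans e fy)
  ... | inj₂ (inj₂ refl) | inj₂ (inj₂ refl) = refl
  f-adj : ∀ {a b} → E a b → Adj K₃ (f a) (f b)
  f-adj (inj₁ (refl , refl)) rewrite fx | fy = _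
  f-adj (inj₂ (refl , refl)) rewrite fy | fz = _
  zx : Adj K₃ (f z) (f x)
  zx rewrite fz | fx = _
  sub₁ : ∀ {a b} → (a , b) ∈ cycPairs (x ∷ y ∷ z ∷ r) → E a b ⊎ (a , b) ∈ pathPairs (z ∷ r ++ [ x ])
  sub₁ {a} {b} e with subst ((a , b) ∈_) (cycPairs-path x (y ∷ z ∷ r)) e
  ... | here refl = inj₁ (inj₁ (refl , refl))
  ... | there (here refl) = inj₁ (inj₂ (refl , refl))
  ... | there (there e′) = inj₂ e′
  sub : ∀ {a b} → Adj G a b → (E a b ⊎ (a , b) ∈ pathPairs (z ∷ r ++ [ x ])) ⊎ (E b a ⊎ (b , a) ∈ pathPairs (z ∷ r ++ [ x ]))
  sub {a} {b} ab = Sum.map sub₁ sub₁ (edgesOf⁻ (cycPairs (x ∷ y ∷ z ∷ r)) (subst (λ M → T (at M a b)) eq ab))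

-- The edge `uv` of `G` is also an edge of the 2-tree, so the path can be grown on it.
Ear⇒PartialTwoTree : {G : Graph n} {G′ : Graph m} {ι : Fin n → Fin m} {u v : Fin n} {int : List (Fin m)} →
  Ear G G′ ι u v int → PartialTwoTree G → PartialTwoTree G′
Ear⇒PartialTwoTree {n = n} {m = m} {G = G} {G′} {ι} {u} {v} {int} ear (k , T₂ , t , g , g-inj , g-adj) =
  Partial⇒PartialTwoTree G′ sub (grow E (ι u) (ι v) int int-u (λ e → disj e u refl) (λ e → disj e v refl) E∉
    (partial T₂ t f f-inj f-adj) (T-uv))
  where
  open Ear ear
  E : Fin m → Fin m → Set
  E x y = ∃₂ λ a b → ι a ≡ x × ι b ≡ y × Adj G a b
  E∉ : ∀ {x y} → E x y → x ∉ int × y ∉ int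
  E∉ (a , b , refl , refl , _) = (λ e → disj e a refl) , (λ e → disj e b refl)
  f : Fin m → Fin k
  f x with cover x
  ... | inj₁ (a , _) = g a
  -- A default value: the inner vertices of the path receive their true images from `grow`.
  ... | inj₂ _ = g u
  f-ι : ∀ a → f (ι a) ≡ g a
  f-ι a with cover (ι a)
  ... | inj₁ (a′ , e) = cong g (inj e)
  ... | inj₂ x∈ = ⊥-elim (disj x∈ a refl)
  pre : ∀ {x} → x ∉ int → ∃ λ a → ι a ≡ x
  pre {x} x∉ with cover x
  ... | inj₁ h = h
  ... | inj₂ x∈ = ⊥-elim (x∉ x∈)
  f-inj : ∀ {x y} → x ∉ int → y ∉ int → f x ≡ f y → x ≡ y
  f-inj x∉ y∉ e with pre x∉ | pre y∉
  ... | a , refl | b , refl = cong ι (g-inj (trans (sym (f-ι a)) (trans e (f-ι b))))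
  f-adj : ∀ {x y} → E x y → Adj T₂ (f x) (f y)
  f-adj (a , b , refl , refl , ab) rewrite f-ι a | f-ι b = g-adj a b ab
  T-uv : Adj T₂ (f (ι u)) (f (ι v))
  T-uv = f-adj (u , v , refl , refl , uv)
  sub : ∀ {x y} → Adj G′ x y → (E x y ⊎ (x , y) ∈ pathPairs (ι u ∷ int ++ [ ι v ])) ⊎ (E y x ⊎ (y , x) ∈ pathPairs (ι u ∷ int ++ [ ι v ]))
  sub {x} {y} xy with cover x | cover y
  ... | inj₁ (a , refl) | inj₁ (b , refl) = inj₁ (inj₁ (a , b , refl , refl , T-≡ (old a b) xy))
  ... | inj₂ x∈ | _ = Sum.map inj₂ inj₂ (new x∈ xy)
  ... | inj₁ _ | inj₂ y∈ = Sum.map inj₂ inj₂ (Sum.swap (new y∈ (Adj-sym G′ xy)))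

Polygonal⇒PartialTwoTree : {G : Graph n} → Polygonal2Tree G → PartialTwoTree G
Polygonal⇒PartialTwoTree {G = G} (cycle c) = cycle⇒PartialTwoTree G c
Polygonal⇒PartialTwoTree {G = G′} (addPath {G = G} ι u v int p a) = Ear⇒PartialTwoTree (AddsPath⇒Ear G G′ a) (Polygonal⇒PartialTwoTree p)

-- Graphs from decidable relations

graphOf : {R : Fin n → Fin n → Set} → (∀ x y → Dec (R x y)) → (∀ {x y} → R x y → R y x) → (∀ {x} → ¬ R x x) → Graph n
graphOf R? s i = mkGraph (λ x y → ⌊ R? x y ⌋)
  (λ x y → T-ext (λ t → fromWitness (s (toWitness {a? = R? x y} t))) (λ t → fromWitness (s (toWitness {a? = R? y x} t))))
  (λ x → ¬T⇒false (λ t → i (toWitness {a? = R? x x} t)))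

module _ {R : Fin n → Fin n → Set} (R? : ∀ x y → Dec (R x y)) (s : ∀ {x y} → R x y → R y x) (i : ∀ {x} → ¬ R x x) where
  graphOf⁻ : ∀ {x y} → Adj (graphOf R? s i) x y → R x y
  graphOf⁻ {x} {y} t = toWitness {a? = R? x y} (T-≡ (at-fromFun _ x y) t)

  graphOf⁺ : ∀ {x y} → R x y → Adj (graphOf R? s i) x y
  graphOf⁺ {x} {y} r = T-≡ (sym (at-fromFun _ x y)) (fromWitness r)

-- Subdividing an edge

SameEdge : (a b x y : Fin n) → Set
SameEdge a b x y = (x ≡ a × y ≡ b) ⊎ (x ≡ b × y ≡ a)

SameEdge? : (a b x y : Fin n) → Dec (SameEdge a b x y)
SameEdge? a b x y = ((x ≟ a) ×-dec (y ≟ b)) ⊎-dec ((x ≟ b) ×-dec (y ≟ a))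

SameEdge-sym : ∀ {a b x y : Fin n} → SameEdge a b x y → SameEdge a b y x
SameEdge-sym (inj₁ (p , q)) = inj₂ (q , p)
SameEdge-sym (inj₂ (p , q)) = inj₁ (q , p)

module Subdivision (a b : Fin n) (κ : Fin n → Fin m) (w : Fin m) where

  Kept New : (Fin n → Fin n → Set) → Fin m → Fin m → Set
  Kept E x y = ∃₂ λ p q → E p q × ¬ SameEdge a b p q × x ≡ κ p × y ≡ κ q
  New E x y = E a b × ((x ≡ w × (y ≡ κ a ⊎ y ≡ κ b)) ⊎ (y ≡ w × (x ≡ κ a ⊎ x ≡ κ b)))

  -- Stated for an arbitrary relation, so that graphs, cycles, paths and matrices are subdivided by
  -- one formula. If `E` does not contain `ab`, no edge at `w` arises.
  Subd : (Fin n → Fin n → Set) → Fin m → Fin m → Set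
  Subd E x y = Kept E x y ⊎ New E x y

  Subd-mono : {E F : Fin n → Fin n → Set} → (∀ {p q} → E p q → F p q) → ∀ {x y} → Subd E x y → Subd F x y
  Subd-mono f (inj₁ (p , q , e , h)) = inj₁ (p , q , f e , h)
  Subd-mono f (inj₂ (e , h)) = inj₂ (f e , h)

  Subd-sym : {E : Fin n → Fin n → Set} → (∀ {p q} → E p q → E q p) → ∀ {x y} → Subd E x y → Subd E y x
  Subd-sym s (inj₁ (p , q , e , ¬e , x≡ , y≡)) = inj₁ (q , p , s e , (λ h → ¬e (SameEdge-sym h)) , y≡ , x≡)
  Subd-sym s (inj₂ (e , h)) = inj₂ (e , Sum.swap h)

  Subd? : {E : Fin n → Fin n → Set} → (∀ p q → Dec (E p q)) → ∀ x y → Dec (Subd E x y)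
  Subd? E? x y =
    any? (λ p → any? (λ q → E? p q ×-dec (¬? (SameEdge? a b p q) ×-dec ((x ≟ κ p) ×-dec (y ≟ κ q)))))
    ⊎-dec (E? a b ×-dec (((x ≟ w) ×-dec ((y ≟ κ a) ⊎-dec (y ≟ κ b))) ⊎-dec ((y ≟ w) ×-dec ((x ≟ κ a) ⊎-dec (x ≟ κ b)))))

-- Only the sets of vertices and edges matter later, so the insertion of `w` between `a` and `b` is
-- recorded up to permutation.
insert : (κ : Fin n → Fin m) (w : Fin m) (h : Fin n) (l : List (Fin n)) (t : Fin n) → ∀ {a b} → (a , b) ∈ pathPairs (h ∷ l ++ [ t ]) →
  ∃₂ λ int rest → int ↭ w ∷ map κ l × pathPairs (h ∷ l ++ [ t ]) ↭ (a , b) ∷ rest ×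
    pathPairs (κ h ∷ int ++ [ κ t ]) ↭ (κ a , w) ∷ (w , κ b) ∷ map (map² κ) rest
insert κ w h [] t (here refl) = [ w ] , [] , ↭-refl , ↭-refl , ↭-refl
insert κ w h (y ∷ l) t (here refl) = w ∷ κ y ∷ map κ l , pathPairs (y ∷ l ++ [ t ]) , ↭-refl , ↭-refl ,
  prep _ (prep _ (↭-reflexive (trans (cong (λ z → pathPairs (κ y ∷ z)) (sym (map-++ κ l [ t ]))) (pathPairs-map κ (y ∷ l ++ [ t ])))))
insert κ w h (y ∷ l) t (there e) with insert κ w y l t e
... | int , rest , p , q , r = κ y ∷ int , (h , y) ∷ rest ,
  ↭-trans (prep _ p) (swap _ _ ↭-refl) , ↭-trans (prep _ q) (swap _ _ ↭-refl) ,
  ↭-trans (prep _ r) (↭-trans (swap _ _ ↭-refl) (prep _ (swap _ _ ↭-refl)))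

module _ (a b : Fin n) (κ : Fin n → Fin m) (w : Fin m) where
  open Subdivision a b κ w

  -- By `Distinct`, the edge `ab` does not recur in `rest`, so the edges in `rest` are exactly the
  -- kept ones.
  insert-edges : {ps rest : List (Fin n × Fin n)} {qs : List (Fin m × Fin m)} {a′ b′ : Fin n} → SameEdge a b a′ b′ →
    Distinct ps → ps ↭ (a′ , b′) ∷ rest → qs ↭ (κ a′ , w) ∷ (w , κ b′) ∷ map (map² κ) rest →
    ∀ {x y} → (Edge qs x y → Subd (Edge ps) x y) × (Subd (Edge ps) x y → Edge qs x y)
  insert-edges {ps} {rest} {qs} {a′} {b′} se d p q {x} {y} = to , from
    where
    E↭ : ∀ {k} {ps qs : List (Fin k × Fin k)} → ps ↭ qs → ∀ {x y} → Edge ps x y → Edge qs x y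
    E↭ p = Sum.map (∈-resp-↭ p) (∈-resp-↭ p)
    fresh : ¬ Edge rest a′ b′
    fresh = Distinct-fresh (Distinct-resp-↭ p d)
    ab′ : SameEdge a b a′ b′ → Edge ps a b
    ab′ (inj₁ (refl , refl)) = E↭ (↭-sym p) (inj₁ (here refl))
    ab′ (inj₂ (refl , refl)) = E↭ (↭-sym p) (inj₂ (here refl))
    ab : Edge ps a b
    ab = ab′ se
    a∈ : a′ ≡ a ⊎ a′ ≡ b
    a∈ = Sum.map proj₁ proj₁ se
    b∈ : b′ ≡ a ⊎ b′ ≡ b
    b∈ = Sum.swap (Sum.map proj₂ proj₂ se)
    κ∈ : ∀ {z} → z ≡ a ⊎ z ≡ b → κ z ≡ κ a ⊎ κ z ≡ κ b
    κ∈ = Sum.map (cong κ) (cong κ)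
    notSame′ : SameEdge a b a′ b′ → ∀ {p q} → Edge rest p q → ¬ SameEdge a b p q
    notSame′ (inj₁ (refl , refl)) e (inj₁ (refl , refl)) = fresh e
    notSame′ (inj₁ (refl , refl)) e (inj₂ (refl , refl)) = fresh (Sum.swap e)
    notSame′ (inj₂ (refl , refl)) e (inj₁ (refl , refl)) = fresh (Sum.swap e)
    notSame′ (inj₂ (refl , refl)) e (inj₂ (refl , refl)) = fresh e
    notSame : ∀ {p q} → Edge rest p q → ¬ SameEdge a b p q
    notSame = notSame′ se
    kept : ∀ {x y} → Edge (map (map² κ) rest) x y → Subd (Edge ps) x y
    kept e with p′ , q′ , e′ , refl , refl ← Edge-map⁻ κ e = inj₁ (p′ , q′ , E↭ (↭-sym p) (Sum.map there there e′) , notSame e′ , refl , refl)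
    to′ : Edge ((κ a′ , w) ∷ (w , κ b′) ∷ map (map² κ) rest) x y → Subd (Edge ps) x y
    to′ (inj₁ (here refl)) = inj₂ (ab , inj₂ (refl , κ∈ a∈))
    to′ (inj₁ (there (here refl))) = inj₂ (ab , inj₁ (refl , κ∈ b∈))
    to′ (inj₁ (there (there e))) = kept (inj₁ e)
    to′ (inj₂ (here refl)) = inj₂ (ab , inj₁ (refl , κ∈ a∈))
    to′ (inj₂ (there (here refl))) = inj₂ (ab , inj₂ (refl , κ∈ b∈))
    to′ (inj₂ (there (there e))) = kept (inj₂ e)
    to : Edge qs x y → Subd (Edge ps) x y
    to e = to′ (E↭ q e)
    W : SameEdge a b a′ b′ → ∀ {z} → z ≡ a ⊎ z ≡ b → Edge ((κ a′ , w) ∷ (w , κ b′) ∷ map (map² κ) rest) w (κ z)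
    W (inj₁ (refl , refl)) (inj₁ refl) = inj₂ (here refl)
    W (inj₁ (refl , refl)) (inj₂ refl) = inj₁ (there (here refl))
    W (inj₂ (refl , refl)) (inj₁ refl) = inj₁ (there (here refl))
    W (inj₂ (refl , refl)) (inj₂ refl) = inj₂ (here refl)
    W′ : ∀ {z} → z ≡ κ a ⊎ z ≡ κ b → Edge ((κ a′ , w) ∷ (w , κ b′) ∷ map (map² κ) rest) w z
    W′ (inj₁ refl) = W se (inj₁ refl)
    W′ (inj₂ refl) = W se (inj₂ refl)
    from′ : Subd (Edge ps) x y → Edge ((κ a′ , w) ∷ (w , κ b′) ∷ map (map² κ) rest) x y
    from′ (inj₂ (_ , inj₁ (refl , h))) = W′ h
    from′ (inj₂ (_ , inj₂ (refl , h))) = Sum.swap (W′ h)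
    from′ (inj₁ (p′ , q′ , e , ¬s , refl , refl)) with E↭ p e
    ... | inj₁ (here refl) = ⊥-elim (¬s se)
    ... | inj₂ (here refl) = ⊥-elim (¬s (SameEdge-sym se))
    ... | inj₁ (there e′) = Sum.map (there ∘ there) (there ∘ there) (Edge-map⁺ κ (inj₁ e′))
    ... | inj₂ (there e′) = Sum.map (there ∘ there) (there ∘ there) (Edge-map⁺ κ (inj₂ e′))
    from : Subd (Edge ps) x y → Edge qs x y
    from e = E↭ (↭-sym q) (from′ e)

record Subdivides (G : Graph n) (a b : Fin n) (G′ : Graph m) (κ : Fin n → Fin m) (w : Fin m) : Set where
  open Subdivision a b κ w
  field
    inj   : ∀ {x y} → κ x ≡ κ y → x ≡ y
    w∉    : ∀ x → κ x ≢ w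
    cover : ∀ x → (∃ λ p → κ p ≡ x) ⊎ x ≡ w
    ab    : Adj G a b
    to    : ∀ {x y} → Adj G′ x y → Subd (Adj G) x y
    from  : ∀ {x y} → Subd (Adj G) x y → Adj G′ x y

module Lift {G : Graph n} {a b : Fin n} {G′ : Graph m} {κ : Fin n → Fin m} {w : Fin m} (S : Subdivides G a b G′ κ w) where
  open Subdivides S
  open Subdivision a b κ w

  CycE : List (Fin n) → Fin n → Fin n → Set
  CycE vs x y = T (at (cycEdges vs) x y)

  -- The cycle of `G′` corresponding to `vs`, specified by its edges and vertices, so that what
  -- follows need not ask whether `vs` uses `ab`.
  record Lifted (vs : List (Fin n)) : Set where
    field
      us     : List (Fin m)
      us-len : 3 ≤ length us
      us-u   : Unique us
      edge⁻  : ∀ {x y} → T (at (cycEdges us) x y) → Subd (CycE vs) x y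
      edge⁺  : ∀ {x y} → Subd (CycE vs) x y → T (at (cycEdges us) x y)
      mem⁻   : ∀ {x} → x ∈ us → (∃ λ p → p ∈ vs × x ≡ κ p) ⊎ (x ≡ w × CycE vs a b)
      mem⁺   : ∀ {p} → p ∈ vs → κ p ∈ us
      mem-w  : CycE vs a b → w ∈ us

  Unique-w∷ : ∀ {l} → Unique l → Unique (w ∷ map κ l)
  Unique-w∷ {l} u = ∉-Unique (λ e → let p , _ , eq = ∈-map⁻ κ e in w∉ p (sym eq)) (Uniqueₚ.map⁺ inj u)

  lift-through : ∀ x xs → 3 ≤ length (x ∷ xs) → Unique (x ∷ xs) → ∀ {a′ b′} → SameEdge a b a′ b′ → (a′ , b′) ∈ cycPairs (x ∷ xs) → Lifted (x ∷ xs)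
  lift-through x xs l u {a′} {b′} se e with insert κ w x xs x (subst (_ ∈_) (cycPairs-path x xs) e)
  ... | int , rest , p , q , r = record
    { us = κ x ∷ int
    ; us-len = ≤-trans l (s≤s (subst (length xs ≤_) (sym len) (n≤1+n _)))
    ; us-u = Unique-resp-↭ (↭-sym perm) (Unique-w∷ u)
    ; edge⁻ = λ t → Subd-mono (edgesOf⁺ (cycPairs (x ∷ xs))) (proj₁ ie (edgesOf⁻ (cycPairs (κ x ∷ int)) t))
    ; edge⁺ = λ s → edgesOf⁺ (cycPairs (κ x ∷ int)) (proj₂ ie (Subd-mono (edgesOf⁻ (cycPairs (x ∷ xs))) s))
    ; mem⁻ = mem⁻
    ; mem⁺ = λ e → ∈-resp-↭ (↭-sym perm) (there (∈-map⁺ κ e))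
    ; mem-w = λ _ → ∈-resp-↭ (↭-sym perm) (here refl) }
    where
    len : length int ≡ suc (length xs)
    len = trans (↭ₚ.↭-length p) (cong suc (length-map κ xs))
    perm : κ x ∷ int ↭ w ∷ map κ (x ∷ xs)
    perm = ↭-trans (prep _ p) (swap _ _ ↭-refl)
    ie : ∀ {y z} → (Edge (cycPairs (κ x ∷ int)) y z → Subd (Edge (cycPairs (x ∷ xs))) y z) × (Subd (Edge (cycPairs (x ∷ xs))) y z → Edge (cycPairs (κ x ∷ int)) y z)
    ie = insert-edges a b κ w se (Distinct-cycle (x ∷ xs) l u) (↭-trans (↭-reflexive (cycPairs-path x xs)) q) (↭-trans (↭-reflexive (cycPairs-path (κ x) int)) r)
    ab∈ : SameEdge a b a′ b′ → CycE (x ∷ xs) a b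
    ab∈ (inj₁ (refl , refl)) = edgesOf⁺ (cycPairs (x ∷ xs)) (inj₁ e)
    ab∈ (inj₂ (refl , refl)) = edgesOf⁺ (cycPairs (x ∷ xs)) (inj₂ e)
    mem⁻ : ∀ {y} → y ∈ κ x ∷ int → (∃ λ p → p ∈ x ∷ xs × y ≡ κ p) ⊎ (y ≡ w × CycE (x ∷ xs) a b)
    mem⁻ y∈ with ∈-resp-↭ perm y∈
    ... | here e = inj₂ (e , ab∈ se)
    ... | there e = inj₁ (∈-map⁻ κ e)

  lift : ∀ vs → 3 ≤ length vs → Unique vs → Lifted vs
  lift vs@(x ∷ xs) l u with T? (at (cycEdges vs) a b)
  ... | no ¬ab = record
    { us = map κ vs ; us-len = subst (3 ≤_) (sym (length-map κ vs)) l ; us-u = Uniqueₚ.map⁺ inj u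
    ; edge⁻ = λ t → let p , q , t′ , e , e′ = cycEdges-map⁻ κ vs t in inj₁ (p , q , t′ , notSame t′ , e , e′)
    ; edge⁺ = λ { (inj₁ (p , q , t , _ , refl , refl)) → cycEdges-map⁺ κ vs t ; (inj₂ (t , _)) → ⊥-elim (¬ab t) }
    ; mem⁻ = λ e → inj₁ (∈-map⁻ κ e) ; mem⁺ = ∈-map⁺ κ ; mem-w = λ t → ⊥-elim (¬ab t) }
    where
    notSame : ∀ {p q} → CycE vs p q → ¬ SameEdge a b p q
    notSame t (inj₁ (refl , refl)) = ¬ab t
    notSame t (inj₂ (refl , refl)) = ¬ab (T-≡ (edgesOf-sym (cycPairs vs) b a) t)
  ... | yes t with edgesOf⁻ (cycPairs vs) t
  ... | inj₁ e = lift-through x xs l u (inj₁ (refl , refl)) e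
  ... | inj₂ e = lift-through x xs l u (inj₂ (refl , refl)) e

  -- An edge between vertices of the lifted cycle is either kept, hence on the chordless `vs`, or it
  -- meets `w`. But `w` is on the lifted cycle only if `vs` uses `ab`, and then both edges at `w`
  -- belong to the cycle.
  lift-induced : ∀ {vs} → IsInducedCycleIn G vs → (L : Lifted vs) → IsInducedCycleIn G′ (Lifted.us L)
  lift-induced {vs} (c , ind) L = (us-len , us-u , All.tabulate (λ e → from (Subd-mono (cycle-Adj G c) (edge⁻ (edgesOf⁺ (cycPairs us) (inj₁ e)))))) , ind′
    where
    open Lifted L
    mem : ∀ {p} → κ p ∈ us → p ∈ vs
    mem {p} e with mem⁻ e
    ... | inj₁ (q , q∈ , eq) = subst (_∈ vs) (sym (inj eq)) q∈
    ... | inj₂ (eq , _) = ⊥-elim (w∉ p eq)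
    w-mem : w ∈ us → CycE vs a b
    w-mem e with mem⁻ e
    ... | inj₁ (q , _ , eq) = ⊥-elim (w∉ q (sym eq))
    ... | inj₂ (_ , t) = t
    ind′ : ∀ x y → x ∈ us → y ∈ us → Adj G′ x y → T (at (cycEdges us) x y)
    ind′ x y x∈ y∈ t with to t
    ... | inj₁ (p , q , pq , ¬s , refl , refl) = edge⁺ (inj₁ (p , q , ind p q (mem x∈) (mem y∈) pq , ¬s , refl , refl))
    ... | inj₂ (_ , h@(inj₁ (refl , _))) = edge⁺ (inj₂ (w-mem x∈ , h))
    ... | inj₂ (_ , h@(inj₂ (refl , _))) = edge⁺ (inj₂ (w-mem y∈ , h))

  KeptShape : Fin m → Fin m → Set
  KeptShape x y = ∃₂ λ p q → ¬ SameEdge a b p q × x ≡ κ p × y ≡ κ q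

  NewShape : Fin m → Fin m → Set
  NewShape x y = (x ≡ w × (y ≡ κ a ⊎ y ≡ κ b)) ⊎ (y ≡ w × (x ≡ κ a ⊎ x ≡ κ b))

  source : ∀ {x y} → Dec (KeptShape x y) → Dec (NewShape x y) → Maybe (Fin n × Fin n)
  source (yes (p , q , _)) _ = just (p , q)
  source (no _) (yes _) = just (a , b)
  source (no _) (no _) = nothing

  kept? : ∀ x y → Dec (KeptShape x y)
  kept? x y = any? (λ p → any? (λ q → ¬? (SameEdge? a b p q) ×-dec ((x ≟ κ p) ×-dec (y ≟ κ q))))

  new? : ∀ x y → Dec (NewShape x y)
  new? x y = ((x ≟ w) ×-dec ((y ≟ κ a) ⊎-dec (y ≟ κ b))) ⊎-dec ((y ≟ w) ×-dec ((x ≟ κ a) ⊎-dec (x ≟ κ b)))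

  sel : Fin m → Fin m → Maybe (Fin n × Fin n)
  sel x y = source (kept? x y) (new? x y)

  -- Subdivision as a linear map: a kept edge copies its own entry, and the two edges at `w` both
  -- copy the entry at `a b`.
  subd : Mat n → Mat m
  subd = select sel

  MatE : Mat n → Fin n → Fin n → Set
  MatE K p q = T (at K p q)

  w∉New : ∀ {p q} → ¬ NewShape (κ p) (κ q)
  w∉New (inj₁ (e , _)) = w∉ _ e
  w∉New (inj₂ (e , _)) = w∉ _ e

  source⁻ : ∀ K {x y} (k : Dec (KeptShape x y)) (n : Dec (NewShape x y)) → T (entry K (source k n)) → Subd (MatE K) x y
  source⁻ K (yes (p , q , h)) _ t = inj₁ (p , q , t , h)
  source⁻ K (no _) (yes h) t = inj₂ (t , h)

  source⁺ : ∀ K {x y} (k : Dec (KeptShape x y)) (n : Dec (NewShape x y)) → Subd (MatE K) x y → T (entry K (source k n))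
  source⁺ K (yes (p , q , _ , refl , refl)) _ (inj₁ (p′ , q′ , t , _ , e , e′)) rewrite inj e | inj e′ = t
  source⁺ K (yes (p , q , _ , refl , refl)) _ (inj₂ (_ , h)) = ⊥-elim (w∉New h)
  source⁺ K (no ¬k) _ (inj₁ (p , q , _ , h)) = ⊥-elim (¬k (p , q , h))
  source⁺ K (no _) (yes _) (inj₂ (t , _)) = t
  source⁺ K (no _) (no ¬n) (inj₂ (_ , h)) = ⊥-elim (¬n h)

  subd⁻ : ∀ K {x y} → T (at (subd K) x y) → Subd (MatE K) x y
  subd⁻ K {x} {y} t = source⁻ K (kept? x y) (new? x y) (T-≡ (at-select sel K x y) t)

  subd⁺ : ∀ K {x y} → Subd (MatE K) x y → T (at (subd K) x y)
  subd⁺ K {x} {y} s = T-≡ (sym (at-select sel K x y)) (source⁺ K (kept? x y) (new? x y) s)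

  subd-induced : ∀ {K} → InducedCycles G K → InducedCycles G′ (subd K)
  subd-induced (vs , i@((l , u , _) , _) , refl) = us , lift-induced i L , Mat-ext λ x y →
      T-ext (subd⁺ (cycEdges vs) ∘ edge⁻) (edge⁺ ∘ subd⁻ (cycEdges vs))
    where
    L = lift vs l u
    open Lifted L

  induced-sym : ∀ {K} → InducedCycles G K → ∀ x y → at K x y ≡ at K y x
  induced-sym (vs , _ , refl) = edgesOf-sym (cycPairs vs)

  -- Kept entries are read off directly, and the entry at `a b` survives at `w , κ a`. The reversed
  -- entry at `b a` is recovered by the symmetry of induced cycles.
  subd-reflects : ∀ {K K′} → InducedCycles G K → InducedCycles G K′ → subd K ≡ subd K′ → ∀ {p q} → MatE K p q → MatE K′ p q
  subd-reflects {K} {K′} k k′ eq {p} {q} t with SameEdge? a b p q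
  ... | no ¬s with subd⁻ K′ (subst (λ M → T (at M (κ p) (κ q))) eq (subd⁺ K (inj₁ (p , q , t , ¬s , refl , refl))))
  ... | inj₁ (p′ , q′ , t′ , _ , e , e′) rewrite inj e | inj e′ = t′
  ... | inj₂ (_ , h) = ⊥-elim (w∉New h)
  subd-reflects {K} {K′} k k′ eq {p} {q} t | yes s = at-ab k′ s (new-part (subd⁻ K′ (subst (λ M → T (at M w (κ a))) eq (subd⁺ K (inj₂ (ab-at k s t , inj₁ (refl , inj₁ refl)))))))
    where
    ab-at : ∀ {M} → InducedCycles G M → SameEdge a b p q → MatE M p q → MatE M a b
    ab-at k (inj₁ (refl , refl)) t = t
    ab-at k (inj₂ (refl , refl)) t = T-≡ (induced-sym k b a) t
    at-ab : ∀ {M} → InducedCycles G M → SameEdge a b p q → MatE M a b → MatE M p q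
    at-ab k (inj₁ (refl , refl)) t = t
    at-ab k (inj₂ (refl , refl)) t = T-≡ (induced-sym k a b) t
    new-part : Subd (MatE K′) w (κ a) → MatE K′ a b
    new-part (inj₁ (p′ , _ , _ , _ , e , _)) = ⊥-elim (w∉ p′ (sym e))
    new-part (inj₂ (t , _)) = t

  subd-injective : ∀ {K K′} → InducedCycles G K → InducedCycles G K′ → subd K ≡ subd K′ → K ≡ K′
  subd-injective k k′ eq = Mat-ext λ p q → T-ext (subd-reflects k k′ eq) (subd-reflects k′ k (sym eq))

  Indep-subdivided : Indep G′ → Indep G
  Indep-subdivided = Indep-select {G = G} {G′ = G′} sel subd-induced subd-injective

-- Subdivision of polygonal 2-trees

AtMostOne : Graph n → Fin n → Fin n → Set
AtMostOne G a b = ∀ {X Y} → InducedCycles G X → InducedCycles G Y → T (at X a b) → T (at Y a b) → X ≡ Y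

-- An edge at an inner vertex of the last path lies on the ear cycle; any other edge lies on an
-- induced cycle of the old graph, which stays induced.
edge-in-induced : {G : Graph n} → Polygonal2Tree G → ∀ {x y} → Adj G x y → ∃ λ K → InducedCycles G K × T (at K x y)
edge-in-induced {G = G} (cycle (vs , l , u , _ , eq)) {x} {y} t = cycEdges vs ,
  (vs , (cycleGraph-isCycle G l u eq , λ x y _ _ → subst (λ M → T (at M x y)) eq) , refl) , subst (λ M → T (at M x y)) eq t
edge-in-induced {G = G′} (addPath {G = G} ι u v int p A) {x} {y} t = go (cover x) (cover y)
  where
  E = AddsPath⇒Ear G G′ A
  open Ear E
  open EarCycle E
  go : (∃ λ a → ι a ≡ x) ⊎ x ∈ int → (∃ λ a → ι a ≡ y) ⊎ y ∈ int → ∃ λ K → InducedCycles G′ K × T (at K x y)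
  go (inj₂ x∈) _ = cycEdges ear , (ear , ear-induced , refl) , ear-path⊆ (new x∈ t)
  go (inj₁ _) (inj₂ y∈) = cycEdges ear , (ear , ear-induced , refl) , ear-path⊆ (Sum.swap (new y∈ (Adj-sym G′ t)))
  go (inj₁ (a , refl)) (inj₁ (b , refl)) with edge-in-induced p (T-≡ (old a b) t)
  ... | _ , (ws , i , refl) , t′ = cycEdges (map ι ws) , (map ι ws , induced-map i , refl) , cycEdges-map⁺ ι ws t′

-- A concrete subdivision, with new vertex `zero`. It provides the smaller graph to which a path is
-- reattached when an old edge is subdivided.
module Subdivided (G : Graph n) (a b : Fin n) (ab : Adj G a b) where
  open Subdivision a b suc zero

  Subd-irr : ∀ {x} → ¬ Subd (Adj G) x x
  Subd-irr (inj₁ (p , q , pq , _ , e , e′)) = Adj-irr G pq (suc-injective (trans (sym e) e′))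
  Subd-irr (inj₂ (_ , inj₁ (refl , inj₁ ())))
  Subd-irr (inj₂ (_ , inj₁ (refl , inj₂ ())))
  Subd-irr (inj₂ (_ , inj₂ (refl , inj₁ ())))
  Subd-irr (inj₂ (_ , inj₂ (refl , inj₂ ())))

  S? : ∀ x y → Dec (Subd (Adj G) x y)
  S? = Subd? (λ p q → T? (at (adj G) p q))

  S-sym : ∀ {x y} → Subd (Adj G) x y → Subd (Adj G) y x
  S-sym = Subd-sym (Adj-sym G)

  subdivided : Graph (suc n)
  subdivided = graphOf S? S-sym Subd-irr

  subdivides : Subdivides G a b subdivided suc zero
  subdivides = record
    { inj = suc-injective ; w∉ = λ x () ; cover = λ { zero → inj₂ refl ; (suc x) → inj₁ (x , refl) } ; ab = ab
    ; to = graphOf⁻ S? S-sym Subd-irr ; from = graphOf⁺ S? S-sym Subd-irr }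

subdivide-cycle : (G : Graph n) → IsCycleGraph G → ∀ {a b} {G′ : Graph m} {κ w} → Subdivides G a b G′ κ w → IsCycleGraph G′
subdivide-cycle G (vs , l , u , cov , eq) {a} {b} {G′} {κ} {w} S =
  us , us-len , us-u , (λ x → mem x (cover x)) ,
    Mat-ext λ x y → T-ext (λ t → edge⁺ (Subd-mono (λ {p} {q} → subst (λ M → T (at M p q)) eq) (to t)))
                          (λ t → from (Subd-mono (λ {p} {q} → subst (λ M → T (at M p q)) (sym eq)) (edge⁻ t)))
  where
  open Subdivides S
  open Subdivision a b κ w
  open Lift S
  open Lifted (lift vs l u)
  mem : ∀ x → (∃ λ p → κ p ≡ x) ⊎ x ≡ w → x ∈ us
  mem x (inj₁ (p , refl)) = mem⁺ (cov p)
  mem x (inj₂ refl) = mem-w (subst (λ M → T (at M a b)) eq ab)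

module SubdivideEar {k} {G₀ : Graph k} {G : Graph n} {ι : Fin k → Fin n} {u v : Fin k} {int : List (Fin n)} (E : Ear G₀ G ι u v int)
  {a b : Fin n} {G′ : Graph m} {κ : Fin n → Fin m} {w : Fin m} (S : Subdivides G a b G′ κ w) where
  open Ear E
  open EarCycle E
  private module S = Subdivides S
  open Subdivision a b κ w

  -- When `ab` lies on the attached path, the old graph and the base edge stay, and the path becomes
  -- longer by `w`.
  on-path : ∀ {a′ b′} → SameEdge a b a′ b′ → (a′ , b′) ∈ pathPairs ear → ∃ λ int′ → Ear G₀ G′ (κ ∘ ι) u v int′
  on-path {a′} {b′} se e with insert κ w (ι u) int (ι v) e
  ... | int′ , rest , p , q , r = int′ , record
    { embeds = record { inj = λ e → inj (S.inj e) ; old = λ x y → T-ext (old⁻ x y) (old⁺ x y) }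
    ; uv = uv ; int≢ = λ { refl → ⊥-elim (0≢ (↭ₚ.↭-length p)) }
    ; int-u = Unique-resp-↭ (↭-sym p) (Lift.Unique-w∷ S int-u)
    ; disj = disj′ ; cover = cover′
    ; path = λ e → S.from (Subd-mono path (proj₁ ie e)) ; new = new′ }
    where
    0≢ : ∀ {k} → 0 ≢ suc k
    0≢ ()
    ie : ∀ {y z} → (Edge (pathPairs (κ (ι u) ∷ int′ ++ [ κ (ι v) ])) y z → Subd (Edge (pathPairs ear)) y z) × (Subd (Edge (pathPairs ear)) y z → Edge (pathPairs (κ (ι u) ∷ int′ ++ [ κ (ι v) ])) y z)
    ie = insert-edges a b κ w se (Distinct-path ear ear-unique) q r
    ab-edge′ : SameEdge a b a′ b′ → Edge (pathPairs ear) a b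
    ab-edge′ (inj₁ (refl , refl)) = inj₁ e
    ab-edge′ (inj₂ (refl , refl)) = inj₂ e
    ab-edge : Edge (pathPairs ear) a b
    ab-edge = ab-edge′ se
    mem⁻ : ∀ {x} → x ∈ int′ → x ≡ w ⊎ (∃ λ p → p ∈ int × x ≡ κ p)
    mem⁻ x∈ with ∈-resp-↭ p x∈
    ... | here e = inj₁ e
    ... | there e = inj₂ (∈-map⁻ κ e)
    not-old : ∀ {x y} → ¬ SameEdge a b (ι x) (ι y)
    not-old {x} {y} s with s | pathPairs-hits (ι u) int (ι v) int≢ ab-edge
    ... | inj₁ (refl , refl) | inj₁ i = disj i x refl
    ... | inj₁ (refl , refl) | inj₂ i = disj i y refl
    ... | inj₂ (refl , refl) | inj₁ i = disj i y refl
    ... | inj₂ (refl , refl) | inj₂ i = disj i x refl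
    old⁻ : ∀ x y → Adj G′ (κ (ι x)) (κ (ι y)) → Adj G₀ x y
    old⁻ x y t with S.to t
    ... | inj₁ (p , q , pq , _ , e , e′) rewrite sym (S.inj e) | sym (S.inj e′) = T-≡ (old x y) pq
    ... | inj₂ (_ , h) = ⊥-elim (Lift.w∉New S h)
    old⁺ : ∀ x y → Adj G₀ x y → Adj G′ (κ (ι x)) (κ (ι y))
    old⁺ x y t = S.from (inj₁ (ι x , ι y , T-≡ (sym (old x y)) t , not-old , refl , refl))
    disj′ : ∀ {x} → x ∈ int′ → ∀ c → κ (ι c) ≢ x
    disj′ x∈ c e with mem⁻ x∈
    ... | inj₁ refl = S.w∉ _ e
    ... | inj₂ (p , p∈ , refl) = disj p∈ c (S.inj e)
    cover′ : ∀ x → (∃ λ c → κ (ι c) ≡ x) ⊎ x ∈ int′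
    cover′ x with S.cover x
    ... | inj₂ refl = inj₂ (∈-resp-↭ (↭-sym p) (here refl))
    ... | inj₁ (c , refl) with cover c
    ... | inj₁ (d , refl) = inj₁ (d , refl)
    ... | inj₂ c∈ = inj₂ (∈-resp-↭ (↭-sym p) (there (∈-map⁺ κ c∈)))
    new′ : ∀ {x y} → x ∈ int′ → Adj G′ x y → Edge (pathPairs (κ (ι u) ∷ int′ ++ [ κ (ι v) ])) x y
    new′ x∈ t with S.to t
    ... | inj₂ (_ , h) = proj₂ ie (inj₂ (ab-edge , h))
    ... | inj₁ (p , q , pq , ¬s , refl , refl) with mem⁻ x∈
    ... | inj₁ e = ⊥-elim (S.w∉ p e)
    ... | inj₂ (p′ , p∈ , e) rewrite S.inj e = proj₂ ie (inj₁ (p′ , q , new p∈ pq , ¬s , refl , refl))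

  -- When `ab` is an old edge other than the base, subdividing it in the old graph spares `uv`, so
  -- the same path can be attached afterwards.
  off-path : ∀ {a₀ b₀} → a ≡ ι a₀ → b ≡ ι b₀ → ¬ SameEdge a₀ b₀ u v → (ab₀ : Adj G₀ a₀ b₀) →
    ∃ λ ι′ → Ear (Subdivided.subdivided G₀ a₀ b₀ ab₀) G′ ι′ (suc u) (suc v) (map κ int)
  off-path {a₀} {b₀} refl refl ¬uv ab₀ = ι′ , record
    { embeds = record { inj = λ {x} {y} → inj′ x y ; old = λ x y → T-ext (λ t → S₀.from (old⁻ x y (S.to t))) (λ t → S.from (old⁺ x y (S₀.to t))) }
    ; uv = S₀.from (inj₁ (u , v , uv , ¬uv , refl , refl))
    ; int≢ = λ e → int≢ (map≡[] int e)
    ; int-u = Uniqueₚ.map⁺ S.inj int-u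
    ; disj = disj′ ; cover = cover′ ; path = path′ ; new = new′ }
    where
    module S₀ = Subdivides (Subdivided.subdivides G₀ a₀ b₀ ab₀)
    module D₀ = Subdivision a₀ b₀ suc zero
    map≡[] : ∀ l → map κ l ≡ [] → l ≡ []
    map≡[] [] _ = refl
    ι′ : Fin (suc k) → Fin m
    ι′ zero = w
    ι′ (suc x) = κ (ι x)
    inj′ : ∀ x y → ι′ x ≡ ι′ y → x ≡ y
    inj′ zero zero e = refl
    inj′ zero (suc y) e = ⊥-elim (S.w∉ _ (sym e))
    inj′ (suc x) zero e = ⊥-elim (S.w∉ _ e)
    inj′ (suc x) (suc y) e = cong suc (inj (S.inj e))
    same⁺ : ∀ {x y} → SameEdge a₀ b₀ x y → SameEdge (ι a₀) (ι b₀) (ι x) (ι y)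
    same⁺ = Sum.map (Product.map (cong ι) (cong ι)) (Product.map (cong ι) (cong ι))
    same⁻ : ∀ {x y} → SameEdge (ι a₀) (ι b₀) (ι x) (ι y) → SameEdge a₀ b₀ x y
    same⁻ = Sum.map (Product.map inj inj) (Product.map inj inj)
    ends⁻ : ∀ y → ι′ y ≡ κ (ι a₀) ⊎ ι′ y ≡ κ (ι b₀) → y ≡ suc a₀ ⊎ y ≡ suc b₀
    ends⁻ y = Sum.map (inj′ y (suc a₀)) (inj′ y (suc b₀))
    old⁻ : ∀ x y → Subd (Adj G) (ι′ x) (ι′ y) → D₀.Subd (Adj G₀) x y
    old⁻ zero y (inj₁ (p , _ , _ , _ , e , _)) = ⊥-elim (S.w∉ p (sym e))
    old⁻ (suc x) zero (inj₁ (_ , q , _ , _ , _ , e)) = ⊥-elim (S.w∉ q (sym e))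
    old⁻ (suc x) (suc y) (inj₁ (p , q , pq , ¬s , e , e′)) rewrite sym (S.inj e) | sym (S.inj e′) =
      inj₁ (x , y , T-≡ (old x y) pq , ¬s ∘ same⁺ , refl , refl)
    old⁻ x y (inj₂ (_ , h)) = inj₂ (ab₀ , Sum.map (λ (e , e′) → inj′ x zero e , ends⁻ y e′) (λ (e , e′) → inj′ y zero e , ends⁻ x e′) h)
    old⁺ : ∀ x y → D₀.Subd (Adj G₀) x y → Subd (Adj G) (ι′ x) (ι′ y)
    old⁺ x y (inj₁ (p , q , pq , ¬s , refl , refl)) = inj₁ (ι p , ι q , T-≡ (sym (old p q)) pq , ¬s ∘ same⁻ , refl , refl)
    old⁺ x y (inj₂ (_ , h)) = inj₂ (S.ab , Sum.map (Product.map (cong ι′) (Sum.map (cong ι′) (cong ι′))) (Product.map (cong ι′) (Sum.map (cong ι′) (cong ι′))) h)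
    disj′ : ∀ {x} → x ∈ map κ int → ∀ c → ι′ c ≢ x
    disj′ x∈ c e with p , p∈ , refl ← ∈-map⁻ κ x∈ with c
    ... | zero = S.w∉ p (sym e)
    ... | suc d = disj p∈ d (S.inj e)
    cover′ : ∀ x → (∃ λ c → ι′ c ≡ x) ⊎ x ∈ map κ int
    cover′ x with S.cover x
    ... | inj₂ refl = inj₁ (zero , refl)
    ... | inj₁ (c , refl) with cover c
    ... | inj₁ (d , refl) = inj₁ (suc d , refl)
    ... | inj₂ c∈ = inj₂ (∈-map⁺ κ c∈)
    pairs : pathPairs (κ (ι u) ∷ map κ int ++ [ κ (ι v) ]) ≡ map (map² κ) (pathPairs ear)
    pairs = trans (cong (λ z → pathPairs (κ (ι u) ∷ z)) (sym (map-++ κ int [ ι v ]))) (pathPairs-map κ ear)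
    not-ab : ∀ {p q} → p ∈ int ⊎ q ∈ int → ¬ SameEdge (ι a₀) (ι b₀) p q
    not-ab (inj₁ i) (inj₁ (refl , refl)) = disj i a₀ refl
    not-ab (inj₁ i) (inj₂ (refl , refl)) = disj i b₀ refl
    not-ab (inj₂ i) (inj₁ (refl , refl)) = disj i b₀ refl
    not-ab (inj₂ i) (inj₂ (refl , refl)) = disj i a₀ refl
    path′ : ∀ {x y} → Edge (pathPairs (κ (ι u) ∷ map κ int ++ [ κ (ι v) ])) x y → Adj G′ x y
    path′ e with p , q , e′ , refl , refl ← Edge-map⁻ κ (subst (λ ps → Edge ps _ _) pairs e) =
      S.from (inj₁ (p , q , path e′ , not-ab (pathPairs-hits (ι u) int (ι v) int≢ e′) , refl , refl))
    new′ : ∀ {x y} → x ∈ map κ int → Adj G′ x y → Edge (pathPairs (κ (ι u) ∷ map κ int ++ [ κ (ι v) ])) x y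
    new′ {y = y} x∈ t with p , p∈ , refl ← ∈-map⁻ κ x∈ with S.to t
    ... | inj₁ (p′ , q , pq , _ , e , refl) rewrite sym (S.inj e) = subst (λ ps → Edge ps (κ p) (κ q)) (sym pairs) (Edge-map⁺ κ (new p∈ pq))
    ... | inj₂ (_ , inj₁ (e , _)) = ⊥-elim (S.w∉ p e)
    ... | inj₂ (_ , inj₂ (_ , inj₁ e)) = ⊥-elim (disj p∈ a₀ (sym (S.inj e)))
    ... | inj₂ (_ , inj₂ (_ , inj₂ e)) = ⊥-elim (disj p∈ b₀ (sym (S.inj e)))

-- Induction on the construction. Only the subdivision of a base edge would destroy an attachment,
-- and this is what `AtMostOne` rules out.
subdivide-polygonal : {G : Graph n} → Polygonal2Tree G → ∀ {a b} {G′ : Graph m} {κ w} → Subdivides G a b G′ κ w → AtMostOne G a b → Polygonal2Tree G′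
subdivide-polygonal {G = G} (cycle c) S _ = cycle (subdivide-cycle G c S)
subdivide-polygonal {G = G} (addPath {n = k} {G = G₀} ι u v int p A) {a} {b} {G′} {κ} S one = go (T? (at (pathEdges ear) a b))
  where
  E = AddsPath⇒Ear G₀ G A
  open Ear E
  open EarCycle E
  module S = Subdivides S
  open SubdivideEar E S
  extend : (∃ λ int′ → Ear G₀ G′ (κ ∘ ι) u v int′) → Polygonal2Tree G′
  extend (int′ , E′) = addPath (κ ∘ ι) u v int′ p (Ear⇒AddsPath G₀ G′ E′)
  old-end : ¬ Edge (pathPairs ear) a b → ∀ {x y} → SameEdge a b x y → ∃ λ c → x ≡ ι c
  old-end ¬e {x} s with cover x
  ... | inj₁ (c , e) = c , sym e
  ... | inj₂ x∈ with s
  ... | inj₁ (refl , refl) = ⊥-elim (¬e (new x∈ S.ab))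
  ... | inj₂ (refl , refl) = ⊥-elim (¬e (Sum.swap (new x∈ (Adj-sym G S.ab))))
  -- Otherwise ab is the base edge of the path, which lies on the ear cycle and on a cycle of the old graph.
  base-case : ∀ {a₀ b₀} → a ≡ ι a₀ → b ≡ ι b₀ → ¬ SameEdge a₀ b₀ u v
  base-case {a₀} {b₀} refl refl s with edge-in-induced p (T-≡ (old a₀ b₀) S.ab)
  -- If the ear were equal to an old cycle, both ends of the marker edge would be old vertices.
  ... | _ , (ws , i , refl) , t = clash (pathPairs-hits (ι u) int (ι v) int≢ (inj₁ first∈))
      (cycEdges-map⁻ ι ws (subst (λ M → T (at M (ι u) first)) (one (ear , ear-induced , refl) (map ι ws , induced-map i , refl) (base s) (cycEdges-map⁺ ι ws t)) (ear-path⊆ (inj₁ first∈))))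
    where
    base : SameEdge a₀ b₀ u v → T (at (cycEdges ear) (ι a₀) (ι b₀))
    base (inj₁ (refl , refl)) = ear-base
    base (inj₂ (refl , refl)) = T-≡ (edgesOf-sym (cycPairs ear) (ι u) (ι v)) ear-base
    clash : ι u ∈ int ⊎ first ∈ int → (∃₂ λ c d → T (at (cycEdges ws) c d) × ι u ≡ ι c × first ≡ ι d) → ⊥
    clash (inj₁ i) _ = disj i u refl
    clash (inj₂ i) (_ , d , _ , _ , e) = disj i d (sym e)
  -- Induced cycles of the old graph stay induced, so the condition passes down to the recursive
  -- call.
  restrict-one : ∀ {a₀ b₀} → a ≡ ι a₀ → b ≡ ι b₀ → AtMostOne G₀ a₀ b₀
  restrict-one {a₀} {b₀} refl refl (ws , i , refl) (ws′ , i′ , refl) t t′ = Mat-ext λ x y → trans (sym (cycEdges-map ws x y))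
    (trans (cong (λ M → at M (ι x) (ι y)) (one (map ι ws , induced-map i , refl) (map ι ws′ , induced-map i′ , refl) (cycEdges-map⁺ ι ws t) (cycEdges-map⁺ ι ws′ t′)))
           (cycEdges-map ws′ x y))
  elsewhere : ∀ {a₀ b₀} → a ≡ ι a₀ → b ≡ ι b₀ → Polygonal2Tree G′
  elsewhere {a₀} {b₀} ea eb = addPath ι′ (suc u) (suc v) (map κ int)
      (subdivide-polygonal p (Subdivided.subdivides G₀ a₀ b₀ ab₀) (restrict-one ea eb)) (Ear⇒AddsPath _ G′ (proj₂ res))
    where
    ab₀ : Adj G₀ a₀ b₀
    ab₀ = T-≡ (trans (cong₂ (at (adj G)) ea eb) (old a₀ b₀)) S.ab
    res = off-path ea eb (base-case ea eb) ab₀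
    ι′ = proj₁ res
  go : Dec (T (at (pathEdges ear) a b)) → Polygonal2Tree G′
  go (yes t) with edgesOf⁻ (pathPairs ear) t
  ... | inj₁ e = extend (on-path (inj₁ (refl , refl)) e)
  ... | inj₂ e = extend (on-path (inj₂ (refl , refl)) e)
  go (no ¬t) = elsewhere (proj₂ (old-end ¬e (inj₁ (refl , refl)))) (proj₂ (old-end ¬e (inj₂ (refl , refl))))
    where
    ¬e : ¬ Edge (pathPairs ear) a b
    ¬e e = ¬t (edgesOf⁺ (pathPairs ear) e)

-- Cycles through a vertex of degree two

reverse-cycle : (G : Graph n) (w r : Fin n) (mid : List (Fin n)) (p : Fin n) → IsCycleIn G (w ∷ r ∷ mid ++ [ p ]) →
  ∃ λ mid′ → IsCycleIn G (w ∷ p ∷ mid′ ++ [ r ]) × cycEdges (w ∷ p ∷ mid′ ++ [ r ]) ≡ cycEdges (w ∷ r ∷ mid ++ [ p ])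
reverse-cycle G w r mid p c@(l , u , a) = reverse mid , (subst (3 ≤_) (↭ₚ.↭-length perm) l , Unique-resp-↭ perm u ,
    All.tabulate (λ e → cycle-Adj G c (subst (λ M → T (at M _ _)) edges (edgesOf⁺ (cycPairs vs′) (inj₁ e))))) , edges
  where
  vs vs′ : List (Fin _)
  vs = w ∷ r ∷ mid ++ [ p ]
  vs′ = w ∷ p ∷ reverse mid ++ [ r ]
  rev : ∀ x l (y : Fin _) → reverse (x ∷ l ++ [ y ]) ≡ y ∷ reverse l ++ [ x ]
  rev x l y = trans (unfold-reverse x (l ++ [ y ])) (cong (_++ [ x ]) (reverse-++ l [ y ]))
  perm : vs ↭ vs′
  perm = prep w (↭-trans (↭-sym (↭ₚ.↭-reverse (r ∷ mid ++ [ p ]))) (↭-reflexive (rev r mid p)))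
  pairs : cycPairs vs′ ↭ map Product.swap (cycPairs vs)
  pairs = ↭-trans (↭-reflexive (trans (cycPairs-path w (p ∷ reverse mid ++ [ r ])) (cong pathPairs
      (trans (cong (λ z → w ∷ z ++ [ w ]) (sym (rev r mid p))) (sym (rev w (r ∷ mid ++ [ p ]) w))))))
    (↭-trans (pathPairs-reverse (w ∷ (r ∷ mid ++ [ p ]) ++ [ w ])) (↭-reflexive (cong (map Product.swap) (sym (cycPairs-path w (r ∷ mid ++ [ p ]))))))
  unswap : ∀ {x y} → (x , y) ∈ map Product.swap (cycPairs vs) → (y , x) ∈ cycPairs vs
  unswap e with _ , e′ , refl ← ∈-map⁻ Product.swap e = e′
  edges : cycEdges vs′ ≡ cycEdges vs
  edges = edgesOf-cong
    (λ e → Sum.swap (Sum.map (unswap ∘ ∈-resp-↭ pairs) (unswap ∘ ∈-resp-↭ pairs) e))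
    (λ e → Sum.swap (Sum.map (∈-resp-↭ (↭-sym pairs) ∘ ∈-map⁺ Product.swap) (∈-resp-↭ (↭-sym pairs) ∘ ∈-map⁺ Product.swap) e))

-- The two cycle neighbours of `w` are distinct and lie among `a` and `b`, so they are `a` and `b`
-- in some order; reversing the cycle fixes the order.
orient : (G : Graph n) {w a b : Fin n} → (∀ {y} → Adj G w y → y ≡ a ⊎ y ≡ b) → ∀ {vs} → IsCycleIn G vs → w ∈ vs →
  ∃ λ mid → IsCycleIn G (w ∷ a ∷ mid ++ [ b ]) × cycEdges (w ∷ a ∷ mid ++ [ b ]) ≡ cycEdges vs
orient {n = n} G {w} {a} {b} only {vs} c@(l , _ , _) w∈ with rotateTo w∈
... | us , p , q with around? w us (subst (3 ≤_) (↭ₚ.↭-length p) l)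
... | around r mid s = go (only (cycle-Adj G c′ wr)) (only (cycle-Adj G c′ ws)) mid c′ (sym (edgesOf-↭ q))
  where
  c′ : IsCycleIn G (w ∷ r ∷ mid ++ [ s ])
  c′ = cycle-resp G p q c
  wr : T (at (cycEdges (w ∷ r ∷ mid ++ [ s ])) w r)
  wr = edgesOf⁺ (cycPairs (w ∷ r ∷ mid ++ [ s ])) (inj₁ (here refl))
  ws : T (at (cycEdges (w ∷ r ∷ mid ++ [ s ])) w s)
  ws = edgesOf⁺ (cycPairs (w ∷ r ∷ mid ++ [ s ])) (inj₂ (subst ((s , w) ∈_) (sym (cycPairs-around w r mid s)) (there (∈-++⁺ʳ (pathPairs (r ∷ mid ++ [ s ])) (here refl)))))
  go : ∀ {r s : Fin n} → r ≡ a ⊎ r ≡ b → s ≡ a ⊎ s ≡ b → ∀ mid → IsCycleIn G (w ∷ r ∷ mid ++ [ s ]) →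
       cycEdges (w ∷ r ∷ mid ++ [ s ]) ≡ cycEdges vs → ∃ λ mid → IsCycleIn G (w ∷ a ∷ mid ++ [ b ]) × cycEdges (w ∷ a ∷ mid ++ [ b ]) ≡ cycEdges vs
  go (inj₁ refl) (inj₂ refl) mid c eq = mid , c , eq
  go (inj₂ refl) (inj₁ refl) mid c eq with mid′ , c′ , eq′ ← reverse-cycle G w b mid a c = mid′ , c′ , trans eq′ eq
  go (inj₁ refl) (inj₁ refl) mid (_ , _ ∷ u , _) eq = ⊥-elim (Unique-∉ u (∈-++⁺ʳ mid (here refl)))
  go (inj₂ refl) (inj₂ refl) mid (_ , _ ∷ u , _) eq = ⊥-elim (Unique-∉ u (∈-++⁺ʳ mid (here refl)))

-- The sum of two cycles through w is a closed walk avoiding w, hence a sum of induced cycles avoiding w.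
unique-through : (G : Graph n) → Indep G → ∀ {w a b} → (∀ {y} → Adj G w y → y ≡ a ⊎ y ≡ b) →
  ∀ {X Y} → InducedCycles G X → InducedCycles G Y → T (at X w a) → T (at Y w a) → X ≡ Y
unique-through {n = n} G indep {w} {a} {b} only {X} {Y} ix@(vs , (cx , _) , refl) iy@(us , (cy , _) , refl) tx ty with Mat-≟ X Y
... | yes eq = eq
-- The second cycle is traversed the other way, so that an arc from `a` to `b` and an arc from `b`
-- to `a` join into a closed walk.
... | no X≢Y with orient G only cx (proj₁ (cycEdges-∈ vs tx)) | orient G (Sum.swap ∘ only) cy (proj₁ (cycEdges-∈ us ty))
... | mid , c₁@(l₁ , u₁ , a₁) , eq₁ | mid′ , c₂@(l₂ , u₂ , a₂) , eq₂ =
  -- `X` equals `Y ⊕ (Y ⊕ X)`. The terms for `Y ⊕ X` avoid `w` and hence differ from `X`, which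
  -- contains the edge `w a`.
  ⊥-elim (indep ix (subst (Span _) (⊕-cancel Y X) (span-⊕ (span-gen (iy , X≢Y ∘ sym)) (subst (Span _) sum (span-bind avoid walk)))))
  where
  P₁ P₂ : List (Fin n × Fin n)
  P₁ = pathPairs (a ∷ mid ++ [ b ])
  P₂ = pathPairs (b ∷ mid′ ++ [ a ])
  avoid : ∀ {K} → InducedIn G (_≢ w) K → Span (Others (InducedCycles G) X) K
  avoid (zs , i , ≢w , refl) = span-gen ((zs , i , refl) , λ eq → All.lookup ≢w (proj₁ (cycEdges-∈ zs (subst (λ M → T (at M w a)) (sym eq) tx))) refl)
  around₁ : cycPairs (w ∷ a ∷ mid ++ [ b ]) ≡ (w , a) ∷ P₁ ++ [ (b , w) ]
  around₁ = cycPairs-around w a mid b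
  around₂ : cycPairs (w ∷ b ∷ mid′ ++ [ a ]) ≡ (w , b) ∷ P₂ ++ [ (a , w) ]
  around₂ = cycPairs-around w b mid′ a
  A₁ : All (AdjP G) P₁
  A₁ = Allₚ.++⁻ˡ P₁ (All.tail (subst (All (AdjP G)) around₁ a₁))
  A₂ : All (AdjP G) P₂
  A₂ = Allₚ.++⁻ˡ P₂ (All.tail (subst (All (AdjP G)) around₂ a₂))
  in₁ : ∀ {x} → x ∈ a ∷ mid ++ [ b ] → x ≢ w
  in₁ x∈ refl = Unique-∉ u₁ x∈
  in₂ : ∀ {x} → x ∈ b ∷ mid′ ++ [ a ] → x ≢ w
  in₂ x∈ refl = Unique-∉ u₂ x∈
  split : cycPairs (a ∷ mid ++ b ∷ mid′) ≡ P₁ ++ P₂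
  split = cycPairs-split a mid b mid′
  walk : Span (InducedIn G (_≢ w)) (wsum (cycPairs (a ∷ mid ++ b ∷ mid′)))
  walk = closed-walk-span G (_≢ w) (a ∷ mid ++ b ∷ mid′)
    (Allₚ.++⁺ {xs = a ∷ mid} (All.tabulate (in₁ ∘ ∈-++⁺ˡ)) (All.tabulate (in₂ ∘ ∈-++⁺ˡ)))
    (subst (All (AdjP G)) (sym split) (Allₚ.++⁺ A₁ A₂))
  Ea Eb : Mat n
  Ea = edgesOf [ (w , a) ]
  Eb = edgesOf [ (w , b) ]
  X≡ : X ≡ Ea ⊕ (Eb ⊕ wsum P₁)
  X≡ = begin
    X                                       ≡⟨ eq₁ ⟨
    cycEdges (w ∷ a ∷ mid ++ [ b ])         ≡⟨ edgesOf-wsum (Distinct-cycle (w ∷ a ∷ mid ++ [ b ]) l₁ u₁) ⟩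
    wsum (cycPairs (w ∷ a ∷ mid ++ [ b ]))  ≡⟨ cong wsum around₁ ⟩
    wsum ((w , a) ∷ P₁ ++ [ (b , w) ])      ≡⟨ wsum-↭ (prep (w , a) (↭-sym (∷↭∷ʳ (b , w) P₁))) ⟩
    Ea ⊕ (edgesOf [ (b , w) ] ⊕ wsum P₁)    ≡⟨ cong (λ M → Ea ⊕ (M ⊕ wsum P₁)) (edge-swap b w) ⟩
    Ea ⊕ (Eb ⊕ wsum P₁)                     ∎
    where open ≡-Reasoning
  Y≡ : Y ≡ Ea ⊕ (Eb ⊕ wsum P₂)
  Y≡ = begin
    Y                                       ≡⟨ eq₂ ⟨
    cycEdges (w ∷ b ∷ mid′ ++ [ a ])        ≡⟨ edgesOf-wsum (Distinct-cycle (w ∷ b ∷ mid′ ++ [ a ]) l₂ u₂) ⟩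
    wsum (cycPairs (w ∷ b ∷ mid′ ++ [ a ])) ≡⟨ cong wsum around₂ ⟩
    wsum ((w , b) ∷ P₂ ++ [ (a , w) ])      ≡⟨ wsum-↭ (prep (w , b) (↭-sym (∷↭∷ʳ (a , w) P₂))) ⟩
    Eb ⊕ (edgesOf [ (a , w) ] ⊕ wsum P₂)    ≡⟨ cong (λ M → Eb ⊕ (M ⊕ wsum P₂)) (edge-swap a w) ⟩
    Eb ⊕ (Ea ⊕ wsum P₂)                     ≡⟨ ⊕-swap Eb Ea (wsum P₂) ⟩
    Ea ⊕ (Eb ⊕ wsum P₂)                     ∎
    where open ≡-Reasoning
  sum : wsum (cycPairs (a ∷ mid ++ b ∷ mid′)) ≡ Y ⊕ X
  sum = begin
    wsum (cycPairs (a ∷ mid ++ b ∷ mid′))          ≡⟨ cong wsum split ⟩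
    wsum (P₁ ++ P₂)                                ≡⟨ wsum-++ P₁ P₂ ⟩
    wsum P₁ ⊕ wsum P₂                              ≡⟨ ⊕-comm (wsum P₁) (wsum P₂) ⟩
    wsum P₂ ⊕ wsum P₁                              ≡⟨ cancel Eb (wsum P₂) (wsum P₁) ⟨
    (Eb ⊕ wsum P₂) ⊕ (Eb ⊕ wsum P₁)                ≡⟨ cancel Ea (Eb ⊕ wsum P₂) (Eb ⊕ wsum P₁) ⟨
    (Ea ⊕ (Eb ⊕ wsum P₂)) ⊕ (Ea ⊕ (Eb ⊕ wsum P₁))  ≡⟨ cong₂ _⊕_ Y≡ X≡ ⟨
    Y ⊕ X                                          ∎
    where
    open ≡-Reasoning
    cancel : ∀ E M N → (E ⊕ M) ⊕ (E ⊕ N) ≡ M ⊕ N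
    cancel E M N = trans (⊕-swap (E ⊕ M) E N) (trans (cong (E ⊕_) (⊕-assoc E M N)) (⊕-cancel E (M ⊕ N)))

-- Induced cycles through `ab` lift to induced cycles through `w`, a vertex of degree two. There
-- they coincide, and lifting is injective.
AtMostOne-subdivided : {G : Graph n} {a b : Fin n} {G′ : Graph m} {κ : Fin n → Fin m} {w : Fin m} → Subdivides G a b G′ κ w → Indep G′ → AtMostOne G a b
AtMostOne-subdivided {G = G} {a} {b} {G′} {κ} {w} S indep {X} {Y} ix iy tx ty =
  subd-injective ix iy (unique-through G′ indep only (subd-induced ix) (subd-induced iy) (through X tx) (through Y ty))
  where
  open Subdivides S
  open Lift S
  only : ∀ {y} → Adj G′ w y → y ≡ κ a ⊎ y ≡ κ b
  only t with to t
  ... | inj₁ (p , _ , _ , _ , e , _) = ⊥-elim (w∉ p (sym e))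
  ... | inj₂ (_ , inj₁ (_ , h)) = h
  ... | inj₂ (_ , inj₂ (_ , inj₁ e)) = ⊥-elim (w∉ a (sym e))
  ... | inj₂ (_ , inj₂ (_ , inj₂ e)) = ⊥-elim (w∉ b (sym e))
  through : ∀ Z → T (at Z a b) → T (at (subd Z) w (κ a))
  through Z t = subd⁺ Z (inj₂ (t , inj₁ (refl , inj₁ refl)))

-- Extension by zero outside the image of `ι` is linear, and on cycles it agrees with mapping the
-- vertex list.
Indep-embedded : {G : Graph n} {G′ : Graph m} {ι : Fin n → Fin m} → Embeds G G′ ι → Indep G′ → Indep G
Indep-embedded {n = n} {m = m} {G = G} {G′} {ι} emb = Indep-select {G = G} {G′ = G′} sel pres push-inj
  where
  open Embeds emb
  Pre : Fin m → Fin m → Set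
  Pre x y = ∃₂ λ p q → x ≡ ι p × y ≡ ι q
  pre? : ∀ x y → Dec (Pre x y)
  pre? x y = any? (λ p → any? (λ q → (x ≟ ι p) ×-dec (y ≟ ι q)))
  source′ : ∀ {x y} → Dec (Pre x y) → Maybe (Fin n × Fin n)
  source′ (yes (p , q , _)) = just (p , q)
  source′ (no _) = nothing
  sel : Fin m → Fin m → Maybe (Fin n × Fin n)
  sel x y = source′ (pre? x y)
  push : ∀ ws x y (d : Dec (Pre x y)) → at (cycEdges (map ι ws)) x y ≡ entry (cycEdges ws) (source′ d)
  push ws x y (yes (p , q , refl , refl)) = cycEdges-map ws p q
  push ws x y (no ¬p) = ¬T⇒false λ t → let p , q , _ , h = cycEdges-map⁻ ι ws t in ¬p (p , q , h)
  pushed : ∀ ws → cycEdges (map ι ws) ≡ select sel (cycEdges ws)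
  pushed ws = Mat-ext λ x y → trans (push ws x y (pre? x y)) (sym (at-select sel (cycEdges ws) x y))
  pres : ∀ {K} → InducedCycles G K → InducedCycles G′ (select sel K)
  pres (ws , i , refl) = map ι ws , induced-map i , pushed ws
  push-inj : ∀ {K K′} → InducedCycles G K → InducedCycles G K′ → select sel K ≡ select sel K′ → K ≡ K′
  push-inj (ws , _ , refl) (ws′ , _ , refl) eq = Mat-ext λ p q → trans (sym (cycEdges-map ws p q))
    (trans (cong (λ M → at M (ι p) (ι q)) (trans (pushed ws) (trans eq (sym (pushed ws′))))) (cycEdges-map ws′ p q))

-- Three vertices, and neighbours in a 2-connected graph

three-vertices : (G : Graph 3) → TwoConnected G → IsCycleGraph G
three-vertices G (_ , _ , 2conn) = zero ∷ suc zero ∷ suc (suc zero) ∷ [] , s≤s (s≤s (s≤s z≤n)) ,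
  ((λ ()) ∷ (λ ()) ∷ []) ∷ ((λ ()) ∷ []) ∷ [] ∷ [] ,
  (λ { zero → here refl ; (suc zero) → there (here refl) ; (suc (suc zero)) → there (there (here refl)) }) , Mat-ext eq
  where
  -- Without the third vertex `z`, the first step of a walk from `x` to `y` can only go to `y`.
  direct : ∀ {x y z} → (∀ w → w ≢ z → w ≡ x ⊎ w ≡ y) → x ≢ y → Reach G (_≢ z) x y → Adj G x y
  direct only x≢y stop = ⊥-elim (x≢y refl)
  direct only x≢y (move {y = w} xw w≢z r) with only w w≢z
  ... | inj₁ refl = ⊥-elim (Adj-irr G xw refl)
  ... | inj₂ refl = xw
  e01 : Adj G zero (suc zero)
  e01 = direct (λ { zero _ → inj₁ refl ; (suc zero) _ → inj₂ refl ; (suc (suc zero)) h → ⊥-elim (h refl) }) (λ ()) (2conn (suc (suc zero)) zero (suc zero) (λ ()) (λ ()))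
  e02 : Adj G zero (suc (suc zero))
  e02 = direct (λ { zero _ → inj₁ refl ; (suc zero) h → ⊥-elim (h refl) ; (suc (suc zero)) _ → inj₂ refl }) (λ ()) (2conn (suc zero) zero (suc (suc zero)) (λ ()) (λ ()))
  e12 : Adj G (suc zero) (suc (suc zero))
  e12 = direct (λ { zero h → ⊥-elim (h refl) ; (suc zero) _ → inj₁ refl ; (suc (suc zero)) _ → inj₂ refl }) (λ ()) (2conn zero (suc zero) (suc (suc zero)) (λ ()) (λ ()))
  eq : ∀ x y → at (adj G) x y ≡ at (cycEdges (zero ∷ suc zero ∷ suc (suc zero) ∷ [])) x y
  eq zero zero = irr G zero
  eq zero (suc zero) = T⇒true e01
  eq zero (suc (suc zero)) = T⇒true e02
  eq (suc zero) zero = T⇒true (Adj-sym G e01)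
  eq (suc zero) (suc zero) = irr G (suc zero)
  eq (suc zero) (suc (suc zero)) = T⇒true e12
  eq (suc (suc zero)) zero = T⇒true (Adj-sym G e02)
  eq (suc (suc zero)) (suc zero) = T⇒true (Adj-sym G e12)
  eq (suc (suc zero)) (suc (suc zero)) = irr G (suc (suc zero))

small : (G : Graph n) → n ≤ 3 → TwoConnected G → Polygonal2Tree G
small G n≤3 c@(3≤n , _) with refl ← ≤-antisym n≤3 3≤n = cycle (three-vertices G c)

-- A walk that leaves `w` starts with some neighbour `a`; a walk from `w` to a further vertex that
-- avoids `a` starts with another one.
two-neighbours : (G : Graph n) → TwoConnected G → ∀ w → ∃₂ λ a b → a ≢ b × Adj G w a × Adj G w b
two-neighbours G (3≤n , conn , 2conn) w with third 3≤n w w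
... | p , w≢p , _ with conn w p
... | stop = ⊥-elim (w≢p refl)
... | move {y = a} wa _ _ with third 3≤n w a
... | q , w≢q , a≢q with 2conn a w q (Adj-irr G wa) (λ e → a≢q (sym e))
... | stop = ⊥-elim (w≢q refl)
... | move {y = b} wb b≢a _ = a , b , (λ e → b≢a (sym e)) , wa , wb

-- Suppressing a vertex of degree two

module Suppress (G : Graph (suc n)) (w : Fin (suc n)) (a b : Fin n) (a≢b : a ≢ b)
  (wa : Adj G w (punchIn w a)) (wb : Adj G w (punchIn w b)) (only : ∀ {y} → Adj G w y → y ≡ punchIn w a ⊎ y ≡ punchIn w b) where

  κ : Fin n → Fin (suc n)
  κ = punchIn w

  κ-inj : ∀ {x y} → κ x ≡ κ y → x ≡ y
  κ-inj = punchIn-injective w _ _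

  cover : ∀ x → (∃ λ p → κ p ≡ x) ⊎ x ≡ w
  cover x with w ≟ x
  ... | yes e = inj₂ (sym e)
  ... | no w≢x = inj₁ (punchOut w≢x , punchIn-punchOut w≢x)

  -- The edge `ab` is added whether or not it is already present, so that one graph serves both
  -- cases of `restore`.
  R : Fin n → Fin n → Set
  R x y = Adj G (κ x) (κ y) ⊎ SameEdge a b x y

  R? : ∀ x y → Dec (R x y)
  R? x y = T? _ ⊎-dec SameEdge? a b x y

  R-sym : ∀ {x y} → R x y → R y x
  R-sym = Sum.map (Adj-sym G) SameEdge-sym

  R-irr : ∀ {x} → ¬ R x x
  R-irr (inj₁ t) = Adj-irr G t refl
  R-irr (inj₂ (inj₁ (refl , e))) = a≢b e
  R-irr (inj₂ (inj₂ (refl , e))) = a≢b (sym e)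

  suppressed : Graph n
  suppressed = graphOf R? R-sym R-irr

  sup⁻ : ∀ {x y} → Adj suppressed x y → R x y
  sup⁻ = graphOf⁻ R? R-sym R-irr

  sup⁺ : ∀ {x y} → R x y → Adj suppressed x y
  sup⁺ = graphOf⁺ R? R-sym R-irr

  -- A passage through `w` enters and leaves by `a` or `b`. If the two differ, the edge `ab`
  -- replaces the passage; if they are equal, the passage is cut out.
  reach : {ok : Fin (suc n) → Set} {ok′ : Fin n → Set} → (∀ {p} → ok (κ p) → ok′ p) →
    ∀ {X Y} → Reach G ok X Y → ∀ {x y} → X ≡ κ x → Y ≡ κ y → Reach suppressed ok′ x y
  reach h stop e e′ = subst (Reach suppressed _ _) (κ-inj (trans (sym e) e′)) stop
  reach h (move {y = Z} t o r) refl e′ with cover Z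
  ... | inj₁ (z , refl) = move (sup⁺ (inj₁ t)) (h o) (reach h r refl e′)
  reach h (move t o stop) refl e′ | inj₂ refl = ⊥-elim (punchInᵢ≢i w _ (sym e′))
  reach h (move t o (move {y = Z} t′ o′ r)) {x} {y} refl e′ | inj₂ refl = go (only (Adj-sym G t)) (only t′)
    where
    go : κ x ≡ κ a ⊎ κ x ≡ κ b → Z ≡ κ a ⊎ Z ≡ κ b → Reach suppressed _ x y
    go (inj₁ e) (inj₁ f) = reach h r (trans f (sym e)) e′
    go (inj₂ e) (inj₂ f) = reach h r (trans f (sym e)) e′
    go (inj₁ e) (inj₂ f) = move (sup⁺ (inj₂ (inj₁ (κ-inj e , refl)))) (h (subst _ f o′)) (reach h r f e′)
    go (inj₂ e) (inj₁ f) = move (sup⁺ (inj₂ (inj₂ (κ-inj e , refl)))) (h (subst _ f o′)) (reach h r f e′)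

  suppressed-TwoConnected : 3 ≤ n → TwoConnected G → TwoConnected suppressed
  suppressed-TwoConnected 3≤n (_ , _ , 2conn) = two-connected {G = suppressed} 3≤n λ z x y x≢ y≢ →
    reach (λ p≢ e → p≢ (cong κ e)) (2conn (κ z) (κ x) (κ y) (x≢ ∘ κ-inj) (y≢ ∘ κ-inj)) refl refl

  κ≢w : ∀ x → κ x ≢ w
  κ≢w x = punchInᵢ≢i w x

  module _ (ab : Adj G (κ a) (κ b)) where
    old⁻ : ∀ {x y} → R x y → Adj G (κ x) (κ y)
    old⁻ (inj₁ t) = t
    old⁻ (inj₂ (inj₁ (refl , refl))) = ab
    old⁻ (inj₂ (inj₂ (refl , refl))) = Adj-sym G ab

    suppressed-embeds : Embeds suppressed G κ
    suppressed-embeds = record { inj = κ-inj ; old = λ x y → T-ext (λ t → sup⁺ (inj₁ t)) (λ t → old⁻ (sup⁻ t)) }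

    suppressed-ear : Ear suppressed G κ a b [ w ]
    suppressed-ear = record
      { embeds = suppressed-embeds ; uv = sup⁺ (inj₁ ab) ; int≢ = λ () ; int-u = [] ∷ []
      ; disj = λ { (here refl) c → κ≢w c } ; cover = λ x → Sum.map₂ here (cover x)
      ; path = path ; new = new }
      where
      path : ∀ {x y} → Edge ((κ a , w) ∷ (w , κ b) ∷ []) x y → Adj G x y
      path (inj₁ (here refl)) = Adj-sym G wa
      path (inj₁ (there (here refl))) = wb
      path (inj₂ (here refl)) = wa
      path (inj₂ (there (here refl))) = Adj-sym G wb
      new : ∀ {x y} → x ∈ [ w ] → Adj G x y → Edge ((κ a , w) ∷ (w , κ b) ∷ []) x y
      new (here refl) t with only t
      ... | inj₁ refl = inj₂ (here refl)
      ... | inj₂ refl = inj₁ (there (here refl))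

  module _ (¬ab : ¬ Adj G (κ a) (κ b)) where
    open Subdivision a b κ w

    suppressed-subdivides : Subdivides suppressed a b G κ w
    suppressed-subdivides = record
      { inj = κ-inj ; w∉ = κ≢w ; cover = cover ; ab = sup⁺ (inj₂ (inj₁ (refl , refl))) ; to = to ; from = from }
      where
      notSame : ∀ {p q} → Adj G (κ p) (κ q) → ¬ SameEdge a b p q
      notSame t (inj₁ (refl , refl)) = ¬ab t
      notSame t (inj₂ (refl , refl)) = ¬ab (Adj-sym G t)
      to : ∀ {x y} → Adj G x y → Subd (Adj suppressed) x y
      to {x} {y} t with cover x | cover y
      ... | inj₁ (p , refl) | inj₁ (q , refl) = inj₁ (p , q , sup⁺ (inj₁ t) , notSame t , refl , refl)
      ... | inj₂ refl | _ = inj₂ (sup⁺ (inj₂ (inj₁ (refl , refl))) , inj₁ (refl , only t))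
      ... | inj₁ _ | inj₂ refl = inj₂ (sup⁺ (inj₂ (inj₁ (refl , refl))) , inj₂ (refl , only (Adj-sym G t)))
      w~ : ∀ {y} → y ≡ κ a ⊎ y ≡ κ b → Adj G w y
      w~ (inj₁ refl) = wa
      w~ (inj₂ refl) = wb
      from : ∀ {x y} → Subd (Adj suppressed) x y → Adj G x y
      from (inj₂ (_ , inj₁ (refl , h))) = w~ h
      from (inj₂ (_ , inj₂ (refl , h))) = Adj-sym G (w~ h)
      from (inj₁ (p , q , t , ¬s , refl , refl)) with sup⁻ t
      ... | inj₁ t′ = t′
      ... | inj₂ s = ⊥-elim (¬s s)

  -- The induction hypothesis waits for the independence of `suppressed`, which has a different
  -- reason in each case: extension by zero if `ab` is an edge of `G`, subdivision otherwise.
  restore : (Indep suppressed → Polygonal2Tree suppressed) → Indep G → Polygonal2Tree G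
  restore ih indep with T? (at (adj G) (κ a) (κ b))
  ... | yes ab = addPath κ a b [ w ] (ih (Indep-embedded (suppressed-embeds ab) indep)) (Ear⇒AddsPath suppressed G (suppressed-ear ab))
  ... | no ¬ab = subdivide-polygonal (ih (Lift.Indep-subdivided S indep)) S (AtMostOne-subdivided S indep)
    where S = suppressed-subdivides ¬ab

-- Induction on the 2-tree with `G` arbitrary: either `G` misses the last vertex and lies in the
-- smaller 2-tree, or the suppressed graph does.
polygonal : {T₂ : Graph m} → TwoTree T₂ → (G : Graph n) → TwoConnected G → (g : Fin n → Fin m) → (∀ {x y} → g x ≡ g y → x ≡ y) →
  (∀ {x y} → Adj G x y → Adj T₂ (g x) (g y)) → Indep G → Polygonal2Tree G
polygonal (triangle _) G 2c g g-inj g-adj indep = small G (injective⇒≤ g-inj) 2c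
polygonal {n = n} {T₂ = T₂} (addVertex {n = k} {G = T₀} ι u v w₀ t A) G 2c g g-inj g-adj indep with n ≤? 3 | any? (λ x → g x ≟ w₀)
-- Small graphs are settled first, because suppression has to leave at least three vertices.
... | yes n≤3 | _ = small G n≤3 2c
... | no _ | no ¬w = polygonal t G 2c (proj₁ ∘ pre) inj′ adj′ indep
  where
  open Ear (AddsPath⇒Ear T₀ T₂ A)
  pre : ∀ x → ∃ λ c → ι c ≡ g x
  pre x with cover (g x)
  ... | inj₁ h = h
  ... | inj₂ (here e) = ⊥-elim (¬w (x , e))
  inj′ : ∀ {x y} → proj₁ (pre x) ≡ proj₁ (pre y) → x ≡ y
  inj′ {x} {y} e = g-inj (trans (sym (proj₂ (pre x))) (trans (cong ι e) (proj₂ (pre y))))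
  adj′ : ∀ {x y} → Adj G x y → Adj T₀ (proj₁ (pre x)) (proj₁ (pre y))
  adj′ {x} {y} xy = T-≡ (trans (cong₂ (at (adj T₂)) (sym (proj₂ (pre x))) (sym (proj₂ (pre y)))) (old _ _)) (g-adj xy)
polygonal {n = suc n} {T₂ = T₂} (addVertex {n = k} {G = T₀} ι u v .(g w) t A) G 2c g g-inj g-adj indep | no n≰3 | yes (w , refl)
  with a₁ , b₁ , a≢b , wa , wb ← two-neighbours G 2c w =
  restore (λ i → polygonal t suppressed (suppressed-TwoConnected (s≤s⁻¹ (≰⇒> n≰3)) 2c) (proj₁ ∘ pre) inj′ adj′ i) indep
  where
  module E = Ear (AddsPath⇒Ear T₀ T₂ A)
  wa≢ : w ≢ a₁
  wa≢ = Adj-irr G wa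
  wb≢ : w ≢ b₁
  wb≢ = Adj-irr G wb
  a b : Fin n
  a = punchOut wa≢
  b = punchOut wb≢
  κa : punchIn w a ≡ a₁
  κa = punchIn-punchOut wa≢
  κb : punchIn w b ≡ b₁
  κb = punchIn-punchOut wb≢
  nbr : ∀ {y} → Adj G w y → g y ≡ ι u ⊎ g y ≡ ι v
  nbr wy with E.new (here refl) (g-adj wy)
  ... | inj₁ (here e) = ⊥-elim (E.disj (here refl) u (sym (cong proj₁ e)))
  ... | inj₁ (there (here e)) = inj₂ (cong proj₂ e)
  ... | inj₂ (here e) = inj₁ (cong proj₁ e)
  ... | inj₂ (there (here e)) = ⊥-elim (E.disj (here refl) v (sym (cong proj₂ e)))
  -- The two known neighbours occupy both `ι u` and `ι v`, so by the injectivity of `g` there is no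
  -- third one.
  only : ∀ {y} → Adj G w y → y ≡ punchIn w a ⊎ y ≡ punchIn w b
  only wy rewrite κa | κb with nbr wa | nbr wb | nbr wy
  ... | inj₁ p | inj₁ q | _ = ⊥-elim (a≢b (g-inj (trans p (sym q))))
  ... | inj₂ p | inj₂ q | _ = ⊥-elim (a≢b (g-inj (trans p (sym q))))
  ... | inj₁ p | inj₂ q | inj₁ r = inj₁ (g-inj (trans r (sym p)))
  ... | inj₁ p | inj₂ q | inj₂ r = inj₂ (g-inj (trans r (sym q)))
  ... | inj₂ p | inj₁ q | inj₁ r = inj₂ (g-inj (trans r (sym q)))
  ... | inj₂ p | inj₁ q | inj₂ r = inj₁ (g-inj (trans r (sym p)))
  open Suppress G w a b (λ e → a≢b (trans (sym κa) (trans (cong (punchIn w) e) κb)))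
    (subst (Adj G w) (sym κa) wa) (subst (Adj G w) (sym κb) wb) only
  pre : ∀ x → ∃ λ c → ι c ≡ g (κ x)
  pre x with E.cover (g (κ x))
  ... | inj₁ h = h
  ... | inj₂ (here e) = ⊥-elim (κ≢w x (g-inj e))
  inj′ : ∀ {x y} → proj₁ (pre x) ≡ proj₁ (pre y) → x ≡ y
  inj′ {x} {y} e = κ-inj (g-inj (trans (sym (proj₂ (pre x))) (trans (cong ι e) (proj₂ (pre y)))))
  -- `a₁` and `b₁` sit on the ends of the edge `uv`, so the added edge `ab` also lies in the smaller
  -- 2-tree.
  base : Adj T₂ (g a₁) (g b₁)
  base with nbr wa | nbr wb
  ... | inj₁ p | inj₁ q = ⊥-elim (a≢b (g-inj (trans p (sym q))))
  ... | inj₂ p | inj₂ q = ⊥-elim (a≢b (g-inj (trans p (sym q))))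
  ... | inj₁ p | inj₂ q = T-≡ (trans (sym (E.old u v)) (cong₂ (at (adj T₂)) (sym p) (sym q))) E.uv
  ... | inj₂ p | inj₁ q = T-≡ (trans (sym (E.old v u)) (cong₂ (at (adj T₂)) (sym p) (sym q))) (Adj-sym T₀ E.uv)
  adjT : ∀ {x y} → R x y → Adj T₂ (g (κ x)) (g (κ y))
  adjT (inj₁ t) = g-adj t
  adjT (inj₂ (inj₁ (refl , refl))) rewrite κa | κb = base
  adjT (inj₂ (inj₂ (refl , refl))) rewrite κa | κb = Adj-sym T₂ base
  adj′ : ∀ {x y} → Adj suppressed x y → Adj T₀ (proj₁ (pre x)) (proj₁ (pre y))
  adj′ {x} {y} xy = T-≡ (trans (cong₂ (at (adj T₂)) (sym (proj₂ (pre x))) (sym (proj₂ (pre y)))) (E.old _ _)) (adjT (sup⁻ xy))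

theorem5 : ∀ {n : ℕ} (G : Graph n) →
    Polygonal2Tree G ⇔ (TwoConnected G × PartialTwoTree G × CycleBasis G (InducedCycles G))
theorem5 G = mk⇔
  (λ p → Polygonal⇒TwoConnected p , Polygonal⇒PartialTwoTree p , Indep⇒CycleBasis G (Polygonal⇒Indep p))
  (λ (2c , (m , T₂ , t , g , g-inj , g-adj) , basis) →
    polygonal t G 2c g g-inj (λ {x} {y} → g-adj x y) (CycleBasis⇒Indep G basis))
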